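{- Consider Swap Bribery for $k$-approval, where $k$ is part of the input, restricted to instances in which the minimum cost of a swap is $1$ (every swap costs at least $1$). With combined parameter $(n,\beta)$, where $n$ is the number of votes and $\beta$ is the budget, this problem admits a kernel with $O(n^2\beta)$ votes and $O(n^2\beta^2)$ candidates.
   Context: Elections. An election consists of a set $C=\{c_1,\dots,c_m\}$ of candidates and votes $V=\{v_1,\dots,v_n\}$; each vote is a strict linear order over $C$ (several voters may have the same order), and $\mathrm{rank}(c,v)$ is the position of $c$ in $v$ (position $1$ is best). In $k$-approval, a candidate $c$ receives one point from $v$ if $\mathrm{rank}(c,v)\le k$ and zero points otherwise; the winners are all candidates with the highest total number of points (ties are allowed, so there may be several winners). Swaps. A swap in a vote $v$ is a triple $(v,a,b)$ with $a,b\in C$, $a\ne b$. It is admissible in $v$ if $\mathrm{rank}(a,v)=\mathrm{rank}(b,v)-1$; applying it exchanges the positions of $a$ and $b$ in $v$. A set $\Gamma$ of swaps is admissible in $v$ if its elements can be applied to $v$ one after the other in some order, each being admissible in the vote obtained so far; the resulting vote is $v^{\Gamma}$. This extends vote by vote to several votes, the resulting votes being denoted $V^{\Gamma}$. Swap Bribery for an election system $\mathcal{E}$: given an $\mathcal{E}$-election $(C,V)$, a preferred candidate $p\in C$, a cost function assigning to each possible swap in each vote a non-negative integer, and a budget $\beta\in\mathbb{N}$, decide whether there is an admissible set $\Gamma$ of swaps of total cost at most $\beta$ such that $p$ is a winner in the $\mathcal{E}$-election $(C,V^{\Gamma})$. Kernel. A kernelization for a parameterized problem is a polynomial-time algorithm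 transforming an instance $(I,\kappa)$ into an instance $(I',\kappa')$ of the same problem (the kernel) such that $(I,\kappa)$ is a yes-instance if and only if $(I',\kappa')$ is, and the size of $(I',\kappa')$ is bounded by a computable function of $\kappa$ only. Here the approval number $k$ is part of the instance and may be different in the kernel. -}

module Defs where

open import Data.Bool.Base using (if_then_else_)
open import Data.Fin.Base using (Fin; toℕ)
open import Data.Fin.Permutation using (Permutation′; transpose; _∘ₚ_; _⟨$⟩ʳ_; _⟨$⟩ˡ_)
import Data.Fin.Properties as Fin
open import Data.List.Base using (List; []; _∷_; map; tabulate)
open import Data.List.Relation.Binary.Permutation.Propositional using (_↭_)
open import Data.List.Relation.Unary.Unique.Propositional using (Unique)
open import Data.Nat.Base using (ℕ; suc; _+_; _*_; _∸_; _^_; _≤_)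
open import Data.Nat.ListAction using (sum)
open import Data.Nat.Logarithm using (⌊log₂_⌋)
open import Data.Nat.Properties using (_≤?_)
open import Data.Product.Base using (Σ-syntax; ∃-syntax; _×_; _,_)
open import Function.Bundles using (_⇔_)
open import Relation.Binary.PropositionalEquality.Core using (_≡_; _≢_)
open import Relation.Nullary.Decidable.Core using (does; yes; no)

-- A strict linear order on Fin m, given as the bijection from candidates
-- to positions; positions are counted from 0, with 0 the best.
Vote : ℕ → Set
Vote m = Permutation′ m

rank : ∀ {m} → Fin m → Vote m → ℕ
rank c v = suc (toℕ (v ⟨$⟩ʳ c))

score : ∀ {m n} → ℕ → (Fin n → Vote m) → Fin m → ℕ
score k V c = sum (tabulate λ i → if does (rank c (V i) ≤? k) then 1 else 0)

Winner : ∀ {m n} → ℕ → (Fin n → Vote m) → Fin m → Set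
Winner k V p = ∀ c → score k V c ≤ score k V p

record Swap (m : ℕ) : Set where
  constructor swap
  field
    left right  : Fin m
    .left≢right : left ≢ right

open Swap public

Admissible : ∀ {m} → Vote m → Swap m → Set
Admissible v s = rank (left s) v ≡ rank (right s) v ∸ 1

applySwap : ∀ {m} → Vote m → Swap m → Vote m
applySwap v s = transpose (left s) (right s) ∘ₚ v

infix 4 _⟶[_]_

data _⟶[_]_ {m : ℕ} : Vote m → List (Swap m) → Vote m → Set where
  done : ∀ {v} → v ⟶[ [] ] v
  step : ∀ {v w s ss} →
         Admissible v s → applySwap v s ⟶[ ss ] w → v ⟶[ s ∷ ss ] w

-- A finite set of swaps is a duplicate-free list. ResultOf v Γ w says that
-- Γ is admissible in v and that w is the resulting vote.
ResultOf : ∀ {m} → Vote m → List (Swap m) → Vote m → Set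
ResultOf v Γ w = Unique Γ × ∃[ ss ] (ss ↭ Γ × v ⟶[ ss ] w)

record Instance : Set where
  field
    #candidates : ℕ
    #votes      : ℕ
    votes       : Fin #votes → Vote #candidates
    approval    : ℕ
    preferred   : Fin #candidates
    cost        : Fin #votes → Swap #candidates → ℕ
    cost≥1      : ∀ i s → 1 ≤ cost i s
    budget      : ℕ

open Instance public

totalCost : (I : Instance) → (Fin (#votes I) → List (Swap (#candidates I))) → ℕ
totalCost I Γ = sum (tabulate λ i → sum (map (cost I i) (Γ i)))

-- A set of swaps in several votes is given by its part in each vote.
Bribable : Instance → Set
Bribable I =
  Σ[ Γ ∈ (Fin (#votes I) → List (Swap (#candidates I))) ]
  Σ[ VΓ ∈ (Fin (#votes I) → Vote (#candidates I)) ]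
    (∀ i → ResultOf (votes I i) (Γ i) (VΓ i)) ×
    totalCost I Γ ≤ budget I ×
    Winner (approval I) VΓ (preferred I)

-- Machine model: while programs on numbers, pairs and lists. Numbers have
-- the size of their binary representation, and every basic step costs the
-- size of the data it is applied to (logarithmic cost), so that running
-- times are polynomially related to those of Turing machines.

infixr 6 _⊗_

data Ty : Set where
  nat  : Ty
  _⊗_  : Ty → Ty → Ty
  list : Ty → Ty

⟦_⟧ : Ty → Set
⟦ nat ⟧    = ℕ
⟦ A ⊗ B ⟧  = ⟦ A ⟧ × ⟦ B ⟧
⟦ list A ⟧ = List ⟦ A ⟧

size : (A : Ty) → ⟦ A ⟧ → ℕ
size nat      n       = suc ⌊log₂ n ⌋
size (A ⊗ B)  (x , y) = suc (size A x + size B y)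
size (list A) xs      = suc (sum (map (size A) xs))

data Op : Ty → Ty → Set where
  idₒ            : ∀ {A} → Op A A
  fstₒ           : ∀ {A B} → Op (A ⊗ B) A
  sndₒ           : ∀ {A B} → Op (A ⊗ B) B
  constₒ         : ∀ {A} → ℕ → Op A nat
  addₒ subₒ mulₒ : Op (nat ⊗ nat) nat
  nilₒ           : ∀ {A B} → Op A (list B)
  consₒ          : ∀ {A} → Op (A ⊗ list A) (list A)

evalOp : ∀ {A B} → Op A B → ⟦ A ⟧ → ⟦ B ⟧
evalOp idₒ        x        = x
evalOp fstₒ       (x , _)  = x
evalOp sndₒ       (_ , y)  = y
evalOp (constₒ n) _        = n
evalOp addₒ       (x , y)  = x + y
evalOp subₒ       (x , y)  = x ∸ y
evalOp mulₒ       (x , y)  = x * y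
evalOp nilₒ       _        = []
evalOp consₒ      (x , xs) = x ∷ xs

infixr 5 _⨾_

data Prog : Ty → Ty → Set where
  op       : ∀ {A B} → Op A B → Prog A B
  _⨾_      : ∀ {A B C} → Prog A B → Prog B C → Prog A C
  fork     : ∀ {A B C} → Prog A B → Prog A C → Prog A (B ⊗ C)
  ifzero   : ∀ {A B} → Prog A B → Prog A B → Prog (nat ⊗ A) B
  caselist : ∀ {A B C} → Prog C B → Prog (A ⊗ list A ⊗ C) B → Prog (list A ⊗ C) B
  while    : ∀ {A} → Prog A nat → Prog A A → Prog A A

infix 4 _⊢_⇓_[_]

-- p ⊢ x ⇓ y [ t ]: on input x, program p halts with output y after time t.
data _⊢_⇓_[_] : ∀ {A B} → Prog A B → ⟦ A ⟧ → ⟦ B ⟧ → ℕ → Set where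
  op⇓ : ∀ {A B} {f : Op A B} {x} →
        op f ⊢ x ⇓ evalOp f x [ size A x ]

  ⨾⇓ : ∀ {A B C} {p : Prog A B} {q : Prog B C} {x y z t u} →
       p ⊢ x ⇓ y [ t ] → q ⊢ y ⇓ z [ u ] →
       p ⨾ q ⊢ x ⇓ z [ t + u ]

  fork⇓ : ∀ {A B C} {p : Prog A B} {q : Prog A C} {x y z t u} →
          p ⊢ x ⇓ y [ t ] → q ⊢ x ⇓ z [ u ] →
          fork p q ⊢ x ⇓ (y , z) [ suc (t + u) ]

  ifzero⇓₀ : ∀ {A B} {p q : Prog A B} {x y t} →
             p ⊢ x ⇓ y [ t ] →
             ifzero p q ⊢ (0 , x) ⇓ y [ size (nat ⊗ A) (0 , x) + t ]

  ifzero⇓₊ : ∀ {A B} {p q : Prog A B} {n x y t} →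
             q ⊢ x ⇓ y [ t ] →
             ifzero p q ⊢ (suc n , x) ⇓ y [ size (nat ⊗ A) (suc n , x) + t ]

  caselist⇓[] : ∀ {A B C} {p : Prog C B} {q : Prog (A ⊗ list A ⊗ C) B} {z y t} →
                p ⊢ z ⇓ y [ t ] →
                caselist p q ⊢ ([] , z) ⇓ y [ size (list A ⊗ C) ([] , z) + t ]

  caselist⇓∷ : ∀ {A B C} {p : Prog C B} {q : Prog (A ⊗ list A ⊗ C) B} {x xs z y t} →
               q ⊢ (x , xs , z) ⇓ y [ t ] →
               caselist p q ⊢ (x ∷ xs , z) ⇓ y [ size (list A ⊗ C) (x ∷ xs , z) + t ]

  while⇓₀ : ∀ {A} {p : Prog A nat} {q : Prog A A} {x t} →
            p ⊢ x ⇓ 0 [ t ] →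
            while p q ⊢ x ⇓ x [ t ]

  while⇓₊ : ∀ {A} {p : Prog A nat} {q : Prog A A} {n x y z t u w} →
            p ⊢ x ⇓ suc n [ t ] → q ⊢ x ⇓ y [ u ] → while p q ⊢ y ⇓ z [ w ] →
            while p q ⊢ x ⇓ z [ t + u + w ]

Computable : ∀ {A B} → (⟦ A ⟧ → ⟦ B ⟧) → Set
Computable {A} {B} f =
  Σ[ p ∈ Prog A B ] ∀ x → ∃[ t ] p ⊢ x ⇓ f x [ t ]

PolynomialTime : ∀ {X Y : Set} (A B : Ty) →
                 (X → ⟦ A ⟧) → (Y → ⟦ B ⟧) → (X → Y) → Set
PolynomialTime A B encX encY f =
  Σ[ p ∈ Prog A B ] ∃[ c ] ∃[ d ] ∀ x →
  ∃[ t ] (p ⊢ encX x ⇓ encY (f x) [ t ] × t ≤ c * size A (encX x) ^ d)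

record ParameterizedProblem : Set₁ where
  field
    Inst      : Set
    Yes       : Inst → Set
    instTy    : Ty
    encode    : Inst → ⟦ instTy ⟧
    paramTy   : Ty
    parameter : Inst → ⟦ paramTy ⟧

  pairTy : Ty
  pairTy = instTy ⊗ paramTy

  encodePair : Inst → ⟦ pairTy ⟧
  encodePair I = encode I , parameter I

record Kernelization (P : ParameterizedProblem) : Set where
  open ParameterizedProblem P
  field
    kernel          : Inst → Inst
    polynomialTime  : PolynomialTime pairTy pairTy encodePair encodePair kernel
    correct         : ∀ I → Yes I ⇔ Yes (kernel I)
    bound           : ⟦ paramTy ⟧ → ℕ
    boundComputable : Computable {paramTy} {nat} bound
    sizeBound       : ∀ I → size pairTy (encodePair (kernel I)) ≤ bound (parameter I)

encodeVote : ∀ {m} → Vote m → List ℕ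
encodeVote v = tabulate λ j → toℕ (v ⟨$⟩ˡ j)

-- The m × m matrix of swap costs, with 0 on the diagonal, where there is
-- no swap.
encodeCosts : ∀ {m} → (Swap m → ℕ) → List (List ℕ)
encodeCosts {m} γ = tabulate λ a → tabulate λ b → entry a b
  where
  entry : Fin m → Fin m → ℕ
  entry a b with a Fin.≟ b
  ... | yes _   = 0
  ... | no  a≢b = γ (swap a b a≢b)

instanceTy : Ty
instanceTy = nat ⊗ nat ⊗ nat ⊗ nat ⊗ list (list nat ⊗ list (list nat))

encodeInstance : Instance → ⟦ instanceTy ⟧
encodeInstance I =
  #candidates I , approval I , toℕ (preferred I) , budget I ,
  tabulate λ i → encodeVote (votes I i) , encodeCosts (cost I i)

SwapBribery[n,β] : ParameterizedProblem
SwapBribery[n,β] = record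
  { Inst      = Instance
  ; Yes       = Bribable
  ; instTy    = instanceTy
  ; encode    = encodeInstance
  ; paramTy   = nat ⊗ nat
  ; parameter = λ I → #votes I , budget I
  }

{-# OPTIONS --safe #-}

-- Every swap costs at least 1, so only candidates within distance β of the
-- approval boundary of some vote can gain or lose a point: at most 2βn of them.
-- The kernel keeps these, the preferred candidate, and one candidate of maximal
-- score among the others, in the order of the original votes. In each vote a
-- kept candidate that is not approved is compensated by a dummy in front; so
-- the boundary comes after exactly as many candidates as are kept, while every
-- dummy is approved at most once and costs more than β to move. No votes are
-- added. Bribes are translated back and forth by copying the swaps near the
-- boundary and dropping the others.

module Submission where

open import Defs
import Data.Fin.Permutation.Components as PC
import Data.Fin.Properties as Fin
import Data.List.Relation.Binary.Permutation.Setoid.Properties as ↭ₛ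
import Data.List.Relation.Unary.All as All
import Data.List.Relation.Unary.Unique.Propositional.Properties as Unique
open import Data.Bool.Base using (Bool; true; false; T; if_then_else_; not; _∧_; _∨_)
open import Data.Bool.ListAction using (all; any)
open import Data.Bool.Properties using (T-not-≡; T-≡; ∧-zeroʳ)
open import Data.Empty using (⊥; ⊥-elim; ⊥-elim-irr)
open import Data.Fin.Base using (Fin; zero; suc; toℕ; fromℕ<)
open import Data.Fin.Permutation using (_⟨$⟩ʳ_; _⟨$⟩ˡ_; inverseʳ; inverseˡ; permutation)
open import Data.List.Base using (List; []; _∷_; _++_; _ʳ++_; applyUpTo; downFrom; filterᵇ; foldr; length; map; reverse; tabulate; upTo)
open import Data.List.Membership.Propositional using (_∈_; _∉_)
open import Data.List.Membership.Propositional.Properties using (∈-++⁺ʳ; ∈-++⁺ˡ; ∈-++⁻; ∈-filter⁺; ∈-filter⁻; ∈-map⁺; ∈-map⁻; ∈-tabulate⁺; ∈-tabulate⁻; ∈-upTo⁺; ∈-upTo⁻)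
open import Data.List.Membership.Propositional.Properties.WithK using (unique∧set⇒bag)
open import Data.List.Properties using (length-++; length-filter; length-map; length-tabulate; length-upTo; map-++; map-tabulate; map-upTo; reverse-downFrom; reverse-involutive; tabulate-cong)
open import Data.List.Relation.Binary.BagAndSetEquality using (∼bag⇒↭)
open import Data.List.Relation.Binary.Permutation.Propositional using (_↭_; ↭-refl; ↭-sym; ↭⇒↭ₛ)
open import Data.List.Relation.Binary.Permutation.Propositional.Properties using (map⁺; ↭-length)
open import Data.List.Relation.Unary.AllPairs using ([]; _∷_)
open import Data.List.Relation.Unary.Any using (here; there)
open import Data.List.Relation.Unary.Unique.Propositional using (Unique)
open import Data.Nat.Base
open import Data.Nat.Induction using (<-rec)
open import Data.Nat.ListAction using (sum)
open import Data.Nat.ListAction.Properties using (sum-++; sum-↭)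
open import Data.Nat.Logarithm using (⌊log₂_⌋; ⌊log₂⌋-mono-≤; ⌊log₂[2^n]⌋≡n; ⌊log₂⌊n/2⌋⌋≡⌊log₂n⌋∸1)
open import Data.Nat.Properties
open import Data.Nat.Tactic.RingSolver using (solve-∀)
open import Data.Product.Base using (Σ-syntax; ∃₂; ∃-syntax; _×_; _,_; proj₁; proj₂)
open import Data.Sum.Base using (_⊎_; inj₁; inj₂)
open import Data.Unit.Base using (tt)
open import Function.Base using (_∘_; case_of_)
open import Function.Bundles using (Equivalence; _⇔_; mk⇔)
open import Relation.Binary.Definitions using (tri<; tri>; tri≈)
open import Relation.Binary.PropositionalEquality
open import Relation.Nullary using (¬_; Dec; yes; no; does; contradiction; map′; T?; _×-dec_)

-- Padding is forced by the single approval number: after the deletions different votes approve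
-- different numbers of kept candidates. The dummies must not outscore the preferred candidate. Each
-- vote draws its dummies from its own block of names, so that none has more than one point, while
-- with at least one vote and `1 ≤ k` some candidate has a point after any bribe, hence so has every
-- winner. These blocks, next to the kept candidates, give the factor `n + 1` in the number of
-- candidates.
--
-- Deleting candidates shifts positions and could bring distant candidates close to the boundary. It
-- does not, because the `β` positions on either side of the boundary are kept completely and merely
-- translated. This relation is symmetric enough for one simulation to serve both directions.
--
-- Time bounds are proved for programs on arbitrary data, not only on codes of instances. Hence the
-- kernel occurs twice: as a total function on codes, built from combinators that carry their time
-- bounds, and as an `Instance`, about which correctness is proved. The two are compared once, in
-- `encode-kernel`.

-- Polynomial bounds

infixl 6 _⊞_
infixl 7 _⊠_
infixr 9 _⊚_

-- Syntax instead of functions: running times of composed programs add and substitute into each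
-- other, and both monotonicity and the final bound `c * N ^ d` are then single inductions.
data Poly : Set where
  con         : ℕ → Poly
  var         : Poly
  _⊞_ _⊠_ _⊚_ : Poly → Poly → Poly

⟪_⟫ : Poly → ℕ → ℕ
⟪ con c ⟫ N = c
⟪ var ⟫   N = N
⟪ p ⊞ q ⟫ N = ⟪ p ⟫ N + ⟪ q ⟫ N
⟪ p ⊠ q ⟫ N = ⟪ p ⟫ N * ⟪ q ⟫ N
⟪ p ⊚ q ⟫ N = ⟪ p ⟫ (⟪ q ⟫ N)

⟪⟫-mono : ∀ p {M N} → M ≤ N → ⟪ p ⟫ M ≤ ⟪ p ⟫ N
⟪⟫-mono (con c) M≤N = ≤-refl
⟪⟫-mono var     M≤N = M≤N
⟪⟫-mono (p ⊞ q) M≤N = +-mono-≤ (⟪⟫-mono p M≤N) (⟪⟫-mono q M≤N)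
⟪⟫-mono (p ⊠ q) M≤N = *-mono-≤ (⟪⟫-mono p M≤N) (⟪⟫-mono q M≤N)
⟪⟫-mono (p ⊚ q) M≤N = ⟪⟫-mono p (⟪⟫-mono q M≤N)

^-distribˡ-* : ∀ m n d → (m * n) ^ d ≡ m ^ d * n ^ d
^-distribˡ-* m n zero    = refl
^-distribˡ-* m n (suc d) =
  trans (cong (m * n *_) (^-distribˡ-* m n d)) ([m*n]*[o*p]≡[m*o]*[n*p] m n (m ^ d) (n ^ d))

1≤^ : ∀ {N} d → 1 ≤ N → 1 ≤ N ^ d
1≤^ {N@(suc _)} d _ = m^n>0 N d

⟪⟫-power : ∀ p → ∃₂ λ c d → ∀ N → 1 ≤ N → ⟪ p ⟫ N ≤ c * N ^ d
⟪⟫-power (con c) = c , 0 , λ N _ → ≤-reflexive (sym (*-identityʳ c))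
⟪⟫-power var = 1 , 1 , λ N _ → ≤-reflexive (sym (trans (*-identityˡ _) (^-identityʳ N)))
⟪⟫-power (p ⊞ q) with ⟪⟫-power p | ⟪⟫-power q
... | c , d , p≤ | c′ , d′ , q≤ = c + c′ , d + d′ , λ N 1≤N → begin
  ⟪ p ⟫ N + ⟪ q ⟫ N                       ≤⟨ +-mono-≤ (p≤ N 1≤N) (q≤ N 1≤N) ⟩
  c * N ^ d + c′ * N ^ d′                 ≤⟨ +-mono-≤
      (*-monoʳ-≤ c (≤-trans (m≤m*n (N ^ d) (N ^ d′) ⦃ >-nonZero (1≤^ d′ 1≤N) ⦄) (≤-reflexive (sym (^-distribˡ-+-* N d d′)))))
      (*-monoʳ-≤ c′ (≤-trans (m≤n*m (N ^ d′) (N ^ d) ⦃ >-nonZero (1≤^ d 1≤N) ⦄) (≤-reflexive (sym (^-distribˡ-+-* N d d′))))) ⟩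
  c * N ^ (d + d′) + c′ * N ^ (d + d′)    ≡⟨ *-distribʳ-+ (N ^ (d + d′)) c c′ ⟨
  (c + c′) * N ^ (d + d′)                 ∎
  where open ≤-Reasoning
⟪⟫-power (p ⊠ q) with ⟪⟫-power p | ⟪⟫-power q
... | c , d , p≤ | c′ , d′ , q≤ = c * c′ , d + d′ , λ N 1≤N → begin
  ⟪ p ⟫ N * ⟪ q ⟫ N             ≤⟨ *-mono-≤ (p≤ N 1≤N) (q≤ N 1≤N) ⟩
  (c * N ^ d) * (c′ * N ^ d′)   ≡⟨ [m*n]*[o*p]≡[m*o]*[n*p] c (N ^ d) c′ (N ^ d′) ⟩
  (c * c′) * (N ^ d * N ^ d′)   ≡⟨ cong (c * c′ *_) (^-distribˡ-+-* N d d′) ⟨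
  c * c′ * N ^ (d + d′)         ∎
  where open ≤-Reasoning
⟪⟫-power (p ⊚ q) with ⟪⟫-power p | ⟪⟫-power q
-- `suc c′` rather than `c′`: the bound for `p` is available only at arguments that are at least 1.
... | c , d , p≤ | c′ , d′ , q≤ = c * suc c′ ^ d , d′ * d , λ N 1≤N → begin
  ⟪ p ⟫ (⟪ q ⟫ N)                  ≤⟨ ⟪⟫-mono p (≤-trans (q≤ N 1≤N) (m≤n+m _ (N ^ d′))) ⟩
  ⟪ p ⟫ (suc c′ * N ^ d′)          ≤⟨ p≤ _ (≤-trans (1≤^ d′ 1≤N) (m≤m+n _ _)) ⟩
  c * (suc c′ * N ^ d′) ^ d        ≡⟨ cong (c *_) (^-distribˡ-* (suc c′) (N ^ d′) d) ⟩
  c * (suc c′ ^ d * (N ^ d′) ^ d)  ≡⟨ *-assoc c _ _ ⟨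
  c * suc c′ ^ d * (N ^ d′) ^ d    ≡⟨ cong (c * suc c′ ^ d *_) (^-*-assoc N d′ d) ⟩
  c * suc c′ ^ d * N ^ (d′ * d)    ∎
  where open ≤-Reasoning

-- Sizes and running times

n<2^size : ∀ n → n < 2 ^ suc ⌊log₂ n ⌋
n<2^size = <-rec _ go
  where
  go : ∀ n → (∀ {i} → i < n → i < 2 ^ suc ⌊log₂ i ⌋) → n < 2 ^ suc ⌊log₂ n ⌋
  go 0 _ = s≤s z≤n
  go 1 _ = s≤s (s≤s z≤n)
  go n@(suc (suc m)) rec = begin-strict
    n                                        ≡⟨ ⌊n/2⌋+⌈n/2⌉≡n n ⟨
    ⌊ n /2⌋ + ⌈ n /2⌉                         ≤⟨ +-monoʳ-≤ ⌊ n /2⌋ (⌈n/2⌉≤ n) ⟩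
    ⌊ n /2⌋ + suc ⌊ n /2⌋                     <⟨ s≤s ≤-refl ⟩
    suc ⌊ n /2⌋ + suc ⌊ n /2⌋                 ≤⟨ +-mono-≤ h h ⟩
    2 ^ suc l + 2 ^ suc l                     ≡⟨ cong (2 ^ suc l +_) (+-identityʳ (2 ^ suc l)) ⟨
    2 ^ suc (suc l)                           ≡⟨ cong (λ z → 2 ^ suc z) eq ⟩
    2 ^ suc ⌊log₂ n ⌋                         ∎
    where
    open ≤-Reasoning
    l : ℕ
    l = ⌊log₂ ⌊ n /2⌋ ⌋
    h : ⌊ n /2⌋ < 2 ^ suc l
    h = rec (⌊n/2⌋<n (suc m))
    ⌈n/2⌉≤ : ∀ k → ⌈ k /2⌉ ≤ suc ⌊ k /2⌋
    ⌈n/2⌉≤ 0 = z≤n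
    ⌈n/2⌉≤ 1 = s≤s z≤n
    ⌈n/2⌉≤ (suc (suc k)) = s≤s (⌈n/2⌉≤ k)
    eq : suc l ≡ ⌊log₂ n ⌋
    eq = trans (cong suc (⌊log₂⌊n/2⌋⌋≡⌊log₂n⌋∸1 n)) (m+[n∸m]≡n (≤-trans (≤-reflexive (sym (⌊log₂[2^n]⌋≡n 1))) (⌊log₂⌋-mono-≤ {2} {n} (s≤s (s≤s z≤n)))))

size-≤2^ : ∀ {n s} → n ≤ 2 ^ s → size nat n ≤ suc s
size-≤2^ {n} {s} n≤ = s≤s (≤-trans (⌊log₂⌋-mono-≤ n≤) (≤-reflexive (⌊log₂[2^n]⌋≡n s)))

n≤2^n : ∀ n → n ≤ 2 ^ n
n≤2^n zero = z≤n
n≤2^n (suc n) = ≤-trans (+-mono-≤ (m^n>0 2 n) (n≤2^n n)) (≤-reflexive (cong (2 ^ n +_) (sym (+-identityʳ (2 ^ n)))))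

size-nat≤ : ∀ n → size nat n ≤ suc n
size-nat≤ n = size-≤2^ (n≤2^n n)

size-mono : ∀ {m n} → m ≤ n → size nat m ≤ size nat n
size-mono m≤n = s≤s (⌊log₂⌋-mono-≤ m≤n)

size≥1 : ∀ A x → 1 ≤ size A x
size≥1 nat      x = s≤s z≤n
size≥1 (A ⊗ B)  x = s≤s z≤n
size≥1 (list A) x = s≤s z≤n

sumsize-≥-length : ∀ A (xs : List ⟦ A ⟧) → length xs ≤ sum (map (size A) xs)
sumsize-≥-length A [] = z≤n
sumsize-≥-length A (x ∷ xs) = +-mono-≤ (size≥1 A x) (sumsize-≥-length A xs)

-- Since `a + b < (a + 1) * (b + 1)`, binary lengths may simply be added. This crude form iterates:
-- the sum of a list is bounded by the total size of its entries.
+<2^ : ∀ {a b s t} → a < 2 ^ s → b < 2 ^ t → a + b < 2 ^ (s + t)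
+<2^ {a} {b} {s} {t} a< b< = begin-strict
  a + b          <⟨ s≤s (+-monoʳ-≤ a (m≤m*n b (suc a))) ⟩
  suc (a + b * suc a) ≡⟨ +-comm (suc a) (b * suc a) ⟩
  b * suc a + suc a ≡⟨ +-comm (b * suc a) (suc a) ⟩
  suc b * suc a  ≡⟨ *-comm (suc b) (suc a) ⟩
  suc a * suc b  ≤⟨ *-mono-≤ a< b< ⟩
  2 ^ s * 2 ^ t  ≡⟨ ^-distribˡ-+-* 2 s t ⟨
  2 ^ (s + t)    ∎
  where open ≤-Reasoning

opGrowth : ∀ {A B} → Op A B → ℕ
opGrowth (constₒ n) = size nat n
opGrowth _          = 1

size-evalOp : ∀ {A B} (f : Op A B) x → size B (evalOp f x) ≤ opGrowth f * size A x
size-evalOp = go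
  where
  one : ∀ {m n} → m ≤ n → m ≤ 1 * n
  one {n = n} m≤n = ≤-trans m≤n (≤-reflexive (sym (*-identityˡ n)))
  go : ∀ {A B} (f : Op A B) x → size B (evalOp f x) ≤ opGrowth f * size A x
  go idₒ        x        = one ≤-refl
  go (fstₒ {A}) (x , y)  = one (m≤n⇒m≤1+n (m≤m+n (size A x) _))
  go (sndₒ {A} {B}) (x , y)  = one (m≤n⇒m≤1+n (m≤n+m (size B y) _))
  go (constₒ {A} n) x        = m≤m*n (size nat n) (size A x) ⦃ >-nonZero (size≥1 A x) ⦄
  go addₒ       (x , y)  = one (size-≤2^ (<⇒≤ (+<2^ {s = size nat x} {size nat y} (n<2^size x) (n<2^size y))))
  go subₒ       (x , y)  = one (≤-trans (size-mono (m∸n≤m x y)) (m≤n⇒m≤1+n (m≤m+n (size nat x) _)))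
  go mulₒ       (x , y)  = one (size-≤2^ (≤-trans (*-mono-≤ (<⇒≤ (n<2^size x)) (<⇒≤ (n<2^size y)))
                             (≤-reflexive (sym (^-distribˡ-+-* 2 (size nat x) (size nat y))))))
  go (nilₒ {A})  x       = one (size≥1 A x)
  go (consₒ {A}) (x , xs) = one (s≤s (+-monoʳ-≤ (size A x) (n≤1+n _)))

-- The output of a program is at most growth times as large as its running
-- time; this makes polynomial time bounds compose.
growth : ∀ {A B} → Prog A B → ℕ
growth (op f)         = opGrowth f
growth (p ⨾ q)        = growth q
growth (fork p q)     = suc (growth p + growth q)
growth (ifzero p q)   = growth p + growth q
growth (caselist p q) = growth p + growth q
growth (while p q)    = 1

input≤time : ∀ {A B} {p : Prog A B} {x y t} → p ⊢ x ⇓ y [ t ] → size A x ≤ t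
input≤time op⇓               = ≤-refl
input≤time (⨾⇓ d e)          = ≤-trans (input≤time d) (m≤m+n _ _)
input≤time (fork⇓ d e)       = m≤n⇒m≤1+n (≤-trans (input≤time d) (m≤m+n _ _))
input≤time (ifzero⇓₀ d)      = m≤m+n _ _
input≤time (ifzero⇓₊ d)      = m≤m+n _ _
input≤time (caselist⇓[] d)   = m≤m+n _ _
input≤time (caselist⇓∷ d)    = m≤m+n _ _
input≤time (while⇓₀ d)       = input≤time d
input≤time (while⇓₊ {t = t} {u} {w} d e f) = ≤-trans (input≤time d) (≤-trans (m≤m+n t u) (m≤m+n (t + u) w))

output≤time : ∀ {A B} {p : Prog A B} {x y t} → p ⊢ x ⇓ y [ t ] → size B y ≤ growth p * t
output≤time (op⇓ {f = f} {x}) = size-evalOp f x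
output≤time (⨾⇓ {q = q} {t = t} d e) = ≤-trans (output≤time e) (*-monoʳ-≤ (growth q) (m≤n+m _ t))
output≤time (fork⇓ {p = p} {q} {t = t} {u} d e) =
  s≤s (≤-trans (+-mono-≤ (output≤time d) (output≤time e))
      (≤-trans (+-mono-≤ (*-monoʳ-≤ (growth p) (m≤m+n t u)) (*-monoʳ-≤ (growth q) (m≤n+m u t)))
      (≤-trans (≤-reflexive (sym (*-distribʳ-+ (t + u) (growth p) (growth q))))
      (≤-trans (*-monoʳ-≤ (growth p + growth q) (n≤1+n (t + u))) (m≤n+m _ (t + u))))))
output≤time (ifzero⇓₀ {p = p} {q} {x} d) =
  ≤-trans (output≤time d) (*-mono-≤ (m≤m+n (growth p) (growth q)) (m≤n+m _ (size _ (0 , x))))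
output≤time (ifzero⇓₊ {p = p} {q} {n} {x} d) =
  ≤-trans (output≤time d) (*-mono-≤ (m≤n+m (growth q) (growth p)) (m≤n+m _ (size _ (suc n , x))))
output≤time (caselist⇓[] {A} {B} {C} {p} {q} {z} d) =
  ≤-trans (output≤time d) (*-mono-≤ (m≤m+n (growth p) (growth q)) (m≤n+m _ (size (list A ⊗ C) ([] , z))))
output≤time (caselist⇓∷ {A} {B} {C} {p} {q} {x} {xs} {z} d) =
  ≤-trans (output≤time d) (*-mono-≤ (m≤n+m (growth q) (growth p)) (m≤n+m _ (size (list A ⊗ C) (x ∷ xs , z))))
-- A loop returns the state on which its test last ran, so the time of that test already bounds the
-- output.
output≤time (while⇓₀ d) = ≤-trans (input≤time d) (≤-reflexive (sym (*-identityˡ _)))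
output≤time (while⇓₊ {t = t} {u} {w} d e f) =
  ≤-trans (output≤time f) (≤-trans (≤-reflexive (*-identityˡ w)) (≤-trans (m≤n+m w (t + u)) (≤-reflexive (sym (*-identityˡ _)))))

-- Polynomial-time functions and their combinators

record PT (A B : Ty) (f : ⟦ A ⟧ → ⟦ B ⟧) : Set where
  field
    prog : Prog A B
    time : Poly
    run  : ∀ x → ∃[ t ] (prog ⊢ x ⇓ f x [ t ] × t ≤ ⟪ time ⟫ (size A x))

  out : Poly
  out = con (growth prog) ⊠ time

  size-out : ∀ x → size B (f x) ≤ ⟪ out ⟫ (size A x)
  size-out x with run x
  ... | t , d , t≤ = ≤-trans (output≤time d) (*-monoʳ-≤ (growth prog) t≤)

open PT

ptOp : ∀ {A B} (f : Op A B) → PT A B (evalOp f)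
ptOp f = record { prog = op f ; time = var ; run = λ x → _ , op⇓ , ≤-refl }

infixr 5 _⟫_
_⟫_ : ∀ {A B C f g} → PT A B f → PT B C g → PT A C (λ x → g (f x))
time (F ⟫ G) = time F ⊞ time G ⊚ out F
prog (F ⟫ G) = prog F ⨾ prog G
run (_⟫_ {A} {f = f} F G) x with run F x | run G (f x)
... | t , d , t≤ | u , e , u≤ = t + u , ⨾⇓ d e ,
  +-mono-≤ t≤ (≤-trans u≤ (⟪⟫-mono (time G) (size-out F x)))

⟨_,_⟩ : ∀ {A B C f g} → PT A B f → PT A C g → PT A (B ⊗ C) (λ x → f x , g x)
prog ⟨ F , G ⟩ = fork (prog F) (prog G)
time ⟨ F , G ⟩ = con 1 ⊞ (time F ⊞ time G)
run ⟨ F , G ⟩ x with run F x | run G x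
... | t , d , t≤ | u , e , u≤ = _ , fork⇓ d e , s≤s (+-mono-≤ t≤ u≤)

ext : ∀ {A B f g} → (∀ x → f x ≡ g x) → PT A B f → PT A B g
prog (ext eq F) = prog F
time (ext eq F) = time F
run (ext {A} {B} eq F) x with run F x
... | t , d , t≤ = t , subst (λ y → prog F ⊢ x ⇓ y [ t ]) (eq x) d , t≤

topₚ : ∀ {A B} → PT (A ⊗ B) A proj₁
topₚ = ext (λ _ → refl) (ptOp fstₒ)

popₚ : ∀ {A B} → PT (A ⊗ B) B proj₂
popₚ = ext (λ _ → refl) (ptOp sndₒ)

selfₚ : ∀ {A} → PT A A (λ x → x)
selfₚ = ptOp idₒ

wk : ∀ {A X B f} → PT A B f → PT (X ⊗ A) B (λ x → f (proj₂ x))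
wk F = popₚ ⟫ F

π₁ : ∀ {Γ A B f} → PT Γ (A ⊗ B) f → PT Γ A (λ γ → proj₁ (f γ))
π₁ F = F ⟫ topₚ

π₂ : ∀ {Γ A B f} → PT Γ (A ⊗ B) f → PT Γ B (λ γ → proj₂ (f γ))
π₂ F = F ⟫ popₚ

lit : ∀ {A} n → PT A nat (λ _ → n)
lit n = ptOp (constₒ n)

infixl 6 _+ₚ_ _∸ₚ_
infixl 7 _*ₚ_
infixr 5 _∷ₚ_

_+ₚ_ : ∀ {Γ f g} → PT Γ nat f → PT Γ nat g → PT Γ nat (λ γ → f γ + g γ)
F +ₚ G = ⟨ F , G ⟩ ⟫ ptOp addₒ

_∸ₚ_ : ∀ {Γ f g} → PT Γ nat f → PT Γ nat g → PT Γ nat (λ γ → f γ ∸ g γ)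
F ∸ₚ G = ⟨ F , G ⟩ ⟫ ptOp subₒ

_*ₚ_ : ∀ {Γ f g} → PT Γ nat f → PT Γ nat g → PT Γ nat (λ γ → f γ * g γ)
F *ₚ G = ⟨ F , G ⟩ ⟫ ptOp mulₒ

sucₚ : ∀ {Γ f} → PT Γ nat f → PT Γ nat (λ γ → suc (f γ))
sucₚ F = lit 1 +ₚ F

nilₚ : ∀ {Γ A} → PT Γ (list A) (λ _ → [])
nilₚ = ptOp nilₒ

_∷ₚ_ : ∀ {Γ A f g} → PT Γ A f → PT Γ (list A) g → PT Γ (list A) (λ γ → f γ ∷ g γ)
F ∷ₚ G = ⟨ F , G ⟩ ⟫ ptOp consₒ

-- Branching, loops and comparisons

bit : Bool → ℕ
bit b = if b then 1 else 0

PTᵇ : ∀ Γ → (⟦ Γ ⟧ → Bool) → Set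
PTᵇ Γ b = PT Γ nat (λ γ → bit (b γ))

ifₚ : ∀ {Γ A b f g} → PTᵇ Γ b → PT Γ A f → PT Γ A g → PT Γ A (λ γ → if b γ then f γ else g γ)
ifₚ {Γ} {A} {b} {f} {g} B F G = ext eq (⟨ B , selfₚ ⟩ ⟫ branch)
  where
  h : ⟦ nat ⊗ Γ ⟧ → ⟦ A ⟧
  h (zero  , γ) = g γ
  h (suc _ , γ) = f γ
  branch : PT (nat ⊗ Γ) A h
  prog branch = ifzero (prog G) (prog F)
  time branch = var ⊞ (time F ⊞ time G)
  run branch (zero , γ) with run G γ
  ... | t , d , t≤ = _ , ifzero⇓₀ d ,
    +-monoʳ-≤ _ (≤-trans t≤ (≤-trans (⟪⟫-mono (time G) (m≤n⇒m≤1+n (m≤n+m _ _))) (m≤n+m _ _)))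
  run branch (suc n , γ) with run F γ
  ... | t , d , t≤ = _ , ifzero⇓₊ d ,
    +-monoʳ-≤ (size (nat ⊗ Γ) (suc n , γ)) (≤-trans t≤ (≤-trans (⟪⟫-mono (time F) (m≤n⇒m≤1+n (m≤n+m _ (size nat (suc n))))) (m≤m+n _ _)))
  eq : ∀ γ → h (bit (b γ) , γ) ≡ (if b γ then f γ else g γ)
  eq γ with b γ
  ... | true  = refl
  ... | false = refl

-- The loop state is a list still to be processed, the accumulator and the
-- environment. Consuming reverse xs, every accumulator is the fold of a
-- suffix of xs, so a bound on the size of folds bounds all of them.
module Loop {A S Γ : Ty} {step : ⟦ A ⊗ S ⊗ Γ ⟧ → ⟦ S ⟧} (Step : PT (A ⊗ S ⊗ Γ) S step) where

  St : Ty
  St = list A ⊗ S ⊗ Γ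

  f : ⟦ Γ ⟧ → ⟦ A ⟧ → ⟦ S ⟧ → ⟦ S ⟧
  f γ x s = step (x , s , γ)

  nonempty : Prog St nat
  nonempty = caselist (op (constₒ 0)) (op (constₒ 1))

  stepₚ : PT (A ⊗ list A ⊗ S ⊗ Γ) St (λ { (x , xs , s , γ) → xs , f γ x s , γ })
  stepₚ = ext (λ _ → refl) ⟨ π₁ popₚ , ⟨ ⟨ topₚ , ⟨ π₁ (π₂ popₚ) , π₂ (π₂ popₚ) ⟩ ⟩ ⟫ Step , π₂ (π₂ popₚ) ⟩ ⟩

  loop : Prog St St
  loop = while nonempty (caselist (fork (op nilₒ) (op idₒ)) (prog stepₚ))

  -- Time of one round on a state of size `M`: the test and the body both open the list, at cost `M`
  -- each. What they receive, with the head split off as a pair component, has size `M + 1`.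
  iteration : Poly
  iteration = (var ⊞ (con 1 ⊞ var)) ⊞ (var ⊞ time stepₚ ⊚ (con 1 ⊞ var))

  loop-run : ∀ γ i M ys zs → (∀ ys′ zs′ → ys′ ʳ++ zs′ ≡ ys ʳ++ zs → size St (ys′ , foldr (f γ) i zs′ , γ) ≤ M) →
             ∃[ t ] (loop ⊢ (ys , foldr (f γ) i zs , γ) ⇓ ([] , foldr (f γ) i (ys ʳ++ zs) , γ) [ t ] ×
                     t ≤ suc (length ys) * ⟪ iteration ⟫ M)
  loop-run γ i M [] zs bd = _ , while⇓₀ (caselist⇓[] op⇓) , (begin
    size St ([] , s , γ) + size (S ⊗ Γ) (s , γ)  ≤⟨ +-mono-≤ h (m≤n⇒m≤1+n (≤-trans (m≤n+m _ 2) h)) ⟩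
    M + suc M                                   ≤⟨ m≤m+n (M + suc M) _ ⟩
    ⟪ iteration ⟫ M                              ≡⟨ *-identityˡ _ ⟨
    1 * ⟪ iteration ⟫ M                          ∎)
    where
    open ≤-Reasoning
    s = foldr (f γ) i zs
    h : size St ([] , s , γ) ≤ M
    h = bd [] zs refl
  loop-run γ i M (y ∷ ys) zs bd
    with run stepₚ (y , ys , foldr (f γ) i zs , γ) | loop-run γ i M ys (y ∷ zs) bd
  ... | t , d , t≤ | u , e , u≤ = _ , while⇓₊ (caselist⇓∷ op⇓) (caselist⇓∷ d) e , (begin
    (size St σ + size U τ) + (size St σ + t) + u
      ≤⟨ +-mono-≤ (+-mono-≤ (+-mono-≤ h h′) (+-mono-≤ h (≤-trans t≤ (⟪⟫-mono (time stepₚ) h′)))) u≤ ⟩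
    ⟪ iteration ⟫ M + suc (length ys) * ⟪ iteration ⟫ M ∎)
    where
    open ≤-Reasoning
    U = A ⊗ list A ⊗ S ⊗ Γ
    s = foldr (f γ) i zs
    σ : ⟦ St ⟧
    σ = y ∷ ys , s , γ
    τ : ⟦ U ⟧
    τ = y , ys , s , γ
    h : size St σ ≤ M
    h = bd (y ∷ ys) zs refl
    h′ : size U τ ≤ suc M
    h′ = ≤-trans (≤-reflexive (eq (size A y) (sum (map (size A) ys)) (size (S ⊗ Γ) (s , γ)))) (s≤s h)
      where
      eq : ∀ a b c → 1 + (a + (1 + (1 + b + c))) ≡ 1 + (1 + (1 + (a + b) + c))
      eq = solve-∀

  Bounded : (⟦ Γ ⟧ → ⟦ S ⟧) → Poly → Set
  Bounded i P = ∀ xs γ → size S (foldr (f γ) (i γ) xs) ≤ ⟪ P ⟫ (size (list A ⊗ Γ) (xs , γ))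

  reverse-fold : ∀ {i} → PT Γ S i → ∀ P → Bounded i P →
                 PT (list A ⊗ Γ) S (λ { (ys , γ) → foldr (f γ) (i γ) (reverse ys) })
  reverse-fold {i} I P bd = record { prog = prog start ⨾ loop ⨾ prog end
                               ; time = time start ⊞ ((con 1 ⊞ var) ⊠ iteration ⊚ M ⊞ time end ⊚ M)
                               ; run  = go }
    where
    M : Poly
    M = con 1 ⊞ (var ⊞ (con 1 ⊞ (P ⊞ var)))
    start : PT (list A ⊗ Γ) St (λ { (ys , γ) → ys , i γ , γ })
    start = ext (λ _ → refl) ⟨ topₚ , ⟨ wk I , popₚ ⟩ ⟩
    end : PT St S (λ { (_ , s , _) → s })
    end = ext (λ _ → refl) (π₁ popₚ)
    sum-ʳ++ : ∀ (ys zs : List ⟦ A ⟧) → sum (map (size A) (ys ʳ++ zs)) ≡ sum (map (size A) ys) + sum (map (size A) zs)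
    sum-ʳ++ [] zs = refl
    sum-ʳ++ (y ∷ ys) zs = trans (sum-ʳ++ ys (y ∷ zs)) (eq (size A y) (sum (map (size A) ys)) (sum (map (size A) zs)))
      where
      eq : ∀ a b c → b + (a + c) ≡ a + b + c
      eq = solve-∀
    bound : ∀ ys γ ys′ zs′ → ys′ ʳ++ zs′ ≡ ys ʳ++ [] →
            size St (ys′ , foldr (f γ) (i γ) zs′ , γ) ≤ ⟪ M ⟫ (size (list A ⊗ Γ) (ys , γ))
    bound ys γ ys′ zs′ eq = s≤s (+-mono-≤
      (≤-trans (s≤s (≤-trans (m≤m+n _ _) total)) (m≤n⇒m≤1+n (m≤m+n _ _)))
      (s≤s (+-mono-≤ (≤-trans (bd zs′ γ) (⟪⟫-mono P (s≤s (+-monoˡ-≤ (size Γ γ) (s≤s (≤-trans (m≤n+m _ _) total))))))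
                     (m≤n⇒m≤1+n (m≤n+m _ _)))))
      where
      total : sum (map (size A) ys′) + sum (map (size A) zs′) ≤ sum (map (size A) ys)
      total = ≤-reflexive (begin
        sum (map (size A) ys′) + sum (map (size A) zs′) ≡⟨ sum-ʳ++ ys′ zs′ ⟨
        sum (map (size A) (ys′ ʳ++ zs′))                ≡⟨ cong (λ l → sum (map (size A) l)) eq ⟩
        sum (map (size A) (ys ʳ++ []))                  ≡⟨ sum-ʳ++ ys [] ⟩
        sum (map (size A) ys) + 0                       ≡⟨ +-identityʳ _ ⟩
        sum (map (size A) ys)                           ∎)
        where open ≡-Reasoning
    go : ∀ x → ∃[ t ] (_ × t ≤ _)
    go (ys , γ) with run start (ys , γ)
                   | loop-run γ (i γ) (⟪ M ⟫ (size (list A ⊗ Γ) (ys , γ))) ys [] (bound ys γ)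
                   | run end ([] , foldr (f γ) (i γ) (reverse ys) , γ)
    ... | t , d , t≤ | u , e , u≤ | v , g , v≤ = _ , ⨾⇓ d (⨾⇓ e g) ,
      +-mono-≤ t≤ (+-mono-≤
        (≤-trans u≤ (*-monoˡ-≤ _ (s≤s (≤-trans (sumsize-≥-length A ys) (m≤n⇒m≤1+n (m≤n⇒m≤1+n (m≤m+n _ _)))))))
        (≤-trans v≤ (⟪⟫-mono (time end) (bound ys γ [] (reverse ys) refl))))

open Loop using (Bounded; reverse-fold)

-- With `_∷_` as its step the loop rebuilds the list it consumes in reverse order. Run beforehand,
-- this undoes the reversal in `reverse-fold`, which gives `foldₚ`.
reverseₚ : ∀ {A Γ} → PT (list A ⊗ Γ) (list A) (λ { (xs , _) → reverse xs })
reverseₚ {A} {Γ} = ext (λ { (xs , γ) → id-is-foldr′ (reverse xs) })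
  (reverse-fold {A} {list A} {Γ} (topₚ ∷ₚ π₁ popₚ) nilₚ var
    λ xs γ → ≤-trans (≤-reflexive (cong (size (list A)) (id-is-foldr′ xs))) (m≤n⇒m≤1+n (m≤m+n _ _)))
  where
  id-is-foldr′ : ∀ (xs : List ⟦ A ⟧) → foldr _∷_ [] xs ≡ xs
  id-is-foldr′ [] = refl
  id-is-foldr′ (x ∷ xs) = cong (x ∷_) (id-is-foldr′ xs)

foldₚ : ∀ {Γ A S f i xs} (Step : PT (A ⊗ S ⊗ Γ) S f) → PT Γ S i → PT Γ (list A) xs →
        ∀ P → Bounded Step i P → PT Γ S (λ γ → foldr (λ x s → f (x , s , γ)) (i γ) (xs γ))
foldₚ {Γ} {A} {f = f} {i} {xs} Step I XS P bd =
  ext (λ γ → cong (foldr (λ x s → f (x , s , γ)) (i γ)) (reverse-involutive (xs γ)))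
      (⟨ ⟨ XS , selfₚ ⟩ ⟫ reverseₚ , selfₚ ⟩ ⟫ reverse-fold Step I P bd)

letₚ : ∀ {Γ A B f g} → PT Γ A f → PT (A ⊗ Γ) B g → PT Γ B (λ γ → g (f γ , γ))
letₚ F G = ⟨ F , selfₚ ⟩ ⟫ G

_<ₚ_ : ∀ {Γ f g} → PT Γ nat f → PT Γ nat g → PTᵇ Γ (λ γ → f γ <ᵇ g γ)
_<ₚ_ {f = f} {g} F G = ext (λ γ → eq (f γ) (g γ)) (lit 1 ∸ₚ (lit 1 ∸ₚ (G ∸ₚ F)))
  where
  eq : ∀ a b → 1 ∸ (1 ∸ (b ∸ a)) ≡ bit (a <ᵇ b)
  eq zero    zero    = refl
  eq zero    (suc b) = cong (1 ∸_) (0∸n≡0 b)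
  eq (suc a) zero    = refl
  eq (suc a) (suc b) = eq a b

_≤ₚ_ : ∀ {Γ f g} → PT Γ nat f → PT Γ nat g → PTᵇ Γ (λ γ → f γ ≤ᵇ g γ)
_≤ₚ_ {f = f} {g} F G = ext (λ γ → eq (f γ) (g γ)) (F <ₚ sucₚ G)
  where
  eq : ∀ a b → bit (a <ᵇ suc b) ≡ bit (a ≤ᵇ b)
  eq zero    b = refl
  eq (suc a) b = refl

_∧ₚ_ : ∀ {Γ f g} → PTᵇ Γ f → PTᵇ Γ g → PTᵇ Γ (λ γ → f γ ∧ g γ)
_∧ₚ_ {f = f} {g} F G = ext (λ γ → eq (f γ) (g γ)) (ifₚ F G (lit 0))
  where
  eq : ∀ a b → (if a then bit b else 0) ≡ bit (a ∧ b)
  eq true  b = refl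
  eq false b = refl

notₚ : ∀ {Γ f} → PTᵇ Γ f → PTᵇ Γ (λ γ → not (f γ))
notₚ {f = f} F = ext (λ γ → eq (f γ)) (ifₚ F (lit 0) (lit 1))
  where
  eq : ∀ a → (if a then 0 else 1) ≡ bit (not a)
  eq true  = refl
  eq false = refl

_≡ₚ_ : ∀ {Γ f g} → PT Γ nat f → PT Γ nat g → PTᵇ Γ (λ γ → f γ ≡ᵇ g γ)
_≡ₚ_ {f = f} {g} F G = ext (λ γ → cong bit (eq (f γ) (g γ))) ((F ≤ₚ G) ∧ₚ (G ≤ₚ F))
  where
  eq : ∀ a b → (a ≤ᵇ b) ∧ (b ≤ᵇ a) ≡ (a ≡ᵇ b)
  eq zero          zero          = refl
  eq zero          (suc b)       = refl
  eq (suc a)       zero          = refl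
  eq (suc zero)    (suc zero)    = refl
  eq (suc zero)    (suc (suc b)) = refl
  eq (suc (suc a)) (suc zero)    = refl
  eq (suc (suc a)) (suc (suc b)) = eq (suc a) (suc b)

infix  5 _<ₚ_ _≤ₚ_ _≡ₚ_
infixr 4 _∧ₚ_

-- List operations in polynomial time

element : ∀ {A S Γ B f} → PT (A ⊗ Γ) B f → PT (A ⊗ S ⊗ Γ) B (λ (x , s , γ) → f (x , γ))
element F = ⟨ topₚ , π₂ popₚ ⟩ ⟫ F

accum : ∀ {A S Γ} → PT (A ⊗ S ⊗ Γ) S (λ (x , s , γ) → s)
accum = π₁ popₚ

Σsize : ∀ A → List ⟦ A ⟧ → ℕ
Σsize A xs = sum (map (size A) xs)

Σsize≤ : ∀ {A Γ} (xs : List ⟦ A ⟧) (γ : ⟦ Γ ⟧) → Σsize A xs ≤ size (list A ⊗ Γ) (xs , γ)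
Σsize≤ xs γ = m≤n⇒m≤1+n (m≤n⇒m≤1+n (m≤m+n _ _))

length≤ : ∀ {A Γ} (xs : List ⟦ A ⟧) (γ : ⟦ Γ ⟧) → length xs ≤ size (list A ⊗ Γ) (xs , γ)
length≤ {A} xs γ = ≤-trans (sumsize-≥-length A xs) (Σsize≤ {A} xs γ)

mapₚ : ∀ {Γ A B f xs} → PT (A ⊗ Γ) B f → PT Γ (list A) xs →
       PT Γ (list B) (λ γ → map (λ x → f (x , γ)) (xs γ))
mapₚ {Γ} {A} {B} {f} {xs} F XS = ext (λ γ → eq γ (xs γ)) (foldₚ (element F ∷ₚ accum) nilₚ XS P bounded)
  where
  eq : ∀ γ ys → foldr (λ x s → f (x , γ) ∷ s) [] ys ≡ map (λ x → f (x , γ)) ys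
  eq γ []       = refl
  eq γ (y ∷ ys) = cong (f (y , γ) ∷_) (eq γ ys)
  P : Poly
  P = con 1 ⊞ (var ⊠ out F)
  sums : ∀ γ ys {N} → suc (suc (Σsize A ys) + size Γ γ) ≤ N →
         Σsize B (map (λ x → f (x , γ)) ys) ≤ length ys * ⟪ out F ⟫ N
  sums γ []       N≥ = z≤n
  sums γ (y ∷ ys) N≥ = +-mono-≤
    (≤-trans (size-out F (y , γ)) (⟪⟫-mono (out F) (≤-trans (s≤s (+-monoˡ-≤ (size Γ γ) (m≤n⇒m≤1+n (m≤m+n _ _)))) N≥)))
    (sums γ ys (≤-trans (s≤s (s≤s (+-monoˡ-≤ (size Γ γ) (m≤n+m _ (size A y))))) N≥))
  bounded : Bounded (element F ∷ₚ accum) (λ _ → []) P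
  bounded ys γ = ≤-trans (≤-reflexive (cong (size (list B)) (eq γ ys)))
    (s≤s (≤-trans (sums γ ys ≤-refl) (*-monoˡ-≤ _ (length≤ {A} {Γ} ys γ))))

filterₚ : ∀ {Γ A f xs} → PTᵇ (A ⊗ Γ) f → PT Γ (list A) xs →
          PT Γ (list A) (λ γ → filterᵇ (λ x → f (x , γ)) (xs γ))
filterₚ {Γ} {A} {f} {xs} F XS = ext (λ γ → eq γ (xs γ)) (foldₚ Step nilₚ XS var bounded)
  where
  Step : PT (A ⊗ list A ⊗ Γ) (list A) (λ (x , s , γ) → if f (x , γ) then x ∷ s else s)
  Step = ifₚ (element F) (topₚ ∷ₚ accum) accum
  eq : ∀ γ ys → foldr (λ x s → if f (x , γ) then x ∷ s else s) [] ys ≡ filterᵇ (λ x → f (x , γ)) ys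
  eq γ []       = refl
  eq γ (y ∷ ys) with f (y , γ)
  ... | true  = cong (y ∷_) (eq γ ys)
  ... | false = eq γ ys
  sums : ∀ γ ys → Σsize A (foldr (λ x s → if f (x , γ) then x ∷ s else s) [] ys) ≤ Σsize A ys
  sums γ []       = z≤n
  sums γ (y ∷ ys) with f (y , γ)
  ... | true  = +-monoʳ-≤ (size A y) (sums γ ys)
  ... | false = ≤-trans (sums γ ys) (m≤n+m _ _)
  bounded : Bounded Step (λ _ → []) var
  bounded ys γ = s≤s (≤-trans (sums γ ys) (m≤n⇒m≤1+n (m≤m+n _ _)))

anyₚ : ∀ {Γ A f xs} → PTᵇ (A ⊗ Γ) f → PT Γ (list A) xs →
       PTᵇ Γ (λ γ → any (λ x → f (x , γ)) (xs γ))
anyₚ {Γ} {A} {f} {xs} F XS = ext (λ γ → eq γ (xs γ)) (foldₚ Step (lit 0) XS (con 1) bounded)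
  where
  Step : PT (A ⊗ nat ⊗ Γ) nat (λ (x , s , γ) → if f (x , γ) then 1 else s)
  Step = ifₚ (element F) (lit 1) accum
  eq : ∀ γ ys → foldr (λ x s → if f (x , γ) then 1 else s) 0 ys ≡ bit (any (λ x → f (x , γ)) ys)
  eq γ []       = refl
  eq γ (y ∷ ys) with f (y , γ)
  ... | true  = refl
  ... | false = eq γ ys
  bounded : Bounded Step (λ _ → 0) (con 1)
  bounded ys γ rewrite eq γ ys with any (λ x → f (x , γ)) ys
  ... | true  = ≤-refl
  ... | false = ≤-refl

allₚ : ∀ {Γ A f xs} → PTᵇ (A ⊗ Γ) f → PT Γ (list A) xs →
       PTᵇ Γ (λ γ → all (λ x → f (x , γ)) (xs γ))
allₚ {f = f} {xs} F XS = ext (λ γ → cong bit (eq γ (xs γ))) (notₚ (anyₚ (notₚ F) XS))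
  where
  eq : ∀ γ ys → not (any (λ x → not (f (x , γ))) ys) ≡ all (λ x → f (x , γ)) ys
  eq γ []       = refl
  eq γ (y ∷ ys) with f (y , γ)
  ... | true  = eq γ ys
  ... | false = refl

sumₚ : ∀ {Γ xs} → PT Γ (list nat) xs → PT Γ nat (λ γ → sum (xs γ))
sumₚ {Γ} XS = foldₚ (topₚ +ₚ accum) (lit 0) XS var
  (λ ys γ → ≤-trans (size-≤2^ {s = Σsize nat ys} (<⇒≤ (sum<2^ ys))) (m≤n⇒m≤1+n (m≤m+n _ _)))
  where
  sum<2^ : ∀ ys → sum ys < 2 ^ Σsize nat ys
  sum<2^ []       = ≤-refl
  sum<2^ (y ∷ ys) = +<2^ {s = size nat y} (n<2^size y) (sum<2^ ys)

lengthₚ : ∀ {Γ A xs} → PT Γ (list A) xs → PT Γ nat (λ γ → length (xs γ))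
lengthₚ {Γ} {A} {xs} XS = ext (λ γ → eq (xs γ)) (foldₚ (sucₚ accum) (lit 0) XS var bounded)
  where
  eq : ∀ (ys : List ⟦ A ⟧) → foldr (λ _ s → suc s) 0 ys ≡ length ys
  eq []       = refl
  eq (y ∷ ys) = cong suc (eq ys)
  bounded : Bounded {A} {nat} {Γ} (sucₚ accum) (λ _ → 0) var
  bounded ys γ = ≤-trans (≤-reflexive (cong (size nat) (eq ys)))
    (≤-trans (size-nat≤ _) (s≤s (≤-trans (sumsize-≥-length A ys) (m≤n⇒m≤1+n (m≤m+n _ _)))))

_++ₚ_ : ∀ {Γ A xs ys} → PT Γ (list A) xs → PT Γ (list A) ys → PT Γ (list A) (λ γ → xs γ ++ ys γ)
_++ₚ_ {Γ} {A} {xs} {ys} XS YS = ext (λ γ → eq γ (xs γ)) (foldₚ (topₚ ∷ₚ accum) YS XS (var ⊞ out YS) bounded)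
  where
  eq : ∀ γ zs → foldr _∷_ (ys γ) zs ≡ zs ++ ys γ
  eq γ []       = refl
  eq γ (z ∷ zs) = cong (z ∷_) (eq γ zs)
  bounded : Bounded (topₚ ∷ₚ accum) ys (var ⊞ out YS)
  bounded zs γ = begin
    size (list A) (foldr _∷_ (ys γ) zs)      ≡⟨ cong (size (list A)) (eq γ zs) ⟩
    suc (sum (map (size A) (zs ++ ys γ)))    ≡⟨ cong (suc ∘ sum) (map-++ (size A) zs (ys γ)) ⟩
    suc (sum (map (size A) zs ++ map (size A) (ys γ))) ≡⟨ cong suc (sum-++ (map (size A) zs) _) ⟩
    suc (Σsize A zs + Σsize A (ys γ))        ≤⟨ +-monoʳ-≤ (suc (Σsize A zs)) (≤-trans (n≤1+n _) (size-out YS γ)) ⟩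
    suc (Σsize A zs) + ⟪ out YS ⟫ (size Γ γ)
      ≤⟨ +-mono-≤ (m≤n⇒m≤1+n (m≤m+n _ _)) (⟪⟫-mono (out YS) (m≤n⇒m≤1+n (m≤n+m _ _))) ⟩
    ⟪ var ⊞ out YS ⟫ (size (list A ⊗ Γ) (zs , γ)) ∎
    where open ≤-Reasoning

-- Counting from the end keeps the labelling a fold.
label : ∀ {X : Set} → List X → List (ℕ × X)
label = foldr (λ x s → (length s , x) ∷ s) []

length-label : ∀ {X : Set} (xs : List X) → length (label xs) ≡ length xs
length-label []       = refl
length-label (x ∷ xs) = cong suc (length-label xs)

labelₚ : ∀ {Γ A xs} → PT Γ (list A) xs → PT Γ (list (nat ⊗ A)) (λ γ → label (xs γ))
labelₚ {Γ} {A} XS = foldₚ (⟨ lengthₚ accum , topₚ ⟩ ∷ₚ accum) nilₚ XS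
  (con 1 ⊞ (var ⊠ (con 2 ⊞ var) ⊞ var)) bounded
  where
  sums : ∀ ys {N} → Σsize A ys ≤ N → Σsize (nat ⊗ A) (label ys) ≤ length ys * (2 + N) + Σsize A ys
  sums []       _  = z≤n
  sums (y ∷ ys) {N} N≥ = begin
    suc (size nat (length (label ys)) + size A y) + Σsize (nat ⊗ A) (label ys)
      ≤⟨ +-mono-≤ (s≤s (+-monoˡ-≤ (size A y) (≤-trans (size-nat≤ (length (label ys))) (s≤s len)))) (sums ys (≤-trans (m≤n+m _ _) N≥)) ⟩
    suc (suc N + size A y) + (length ys * (2 + N) + Σsize A ys)
      ≡⟨ rearrange N (size A y) (length ys * (2 + N)) (Σsize A ys) ⟩
    2 + N + length ys * (2 + N) + (size A y + Σsize A ys) ∎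
    where
    open ≤-Reasoning
    len : length (label ys) ≤ N
    len = ≤-trans (≤-reflexive (length-label ys)) (≤-trans (sumsize-≥-length A ys) (≤-trans (m≤n+m _ _) N≥))
    rearrange : ∀ a b c d → 1 + (1 + a + b) + (c + d) ≡ 2 + a + c + (b + d)
    rearrange = solve-∀
  bounded : ∀ ys γ → size (list (nat ⊗ A)) (label ys) ≤ _
  bounded ys γ = s≤s (≤-trans (sums ys (Σsize≤ {A} {Γ} ys γ))
    (+-mono-≤ (*-monoˡ-≤ _ (length≤ {A} {Γ} ys γ)) (Σsize≤ {A} {Γ} ys γ)))

-- Labels count from the end; d is the value beyond the end of xs.
nth : ∀ {X : Set} → X → List X → ℕ → X
nth d xs i = foldr (λ y s → if proj₁ y ≡ᵇ length xs ∸ suc i then proj₂ y else s) d (label xs)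

nthₚ : ∀ {Γ A d xs i} → PT Γ A d → PT Γ (list A) xs → PT Γ nat i →
       PT Γ A (λ γ → nth (d γ) (xs γ) (i γ))
nthₚ {Γ} {A} {d} {xs} {i} D XS I =
  letₚ (lengthₚ XS ∸ₚ sucₚ I)
       (foldₚ Step (wk D) (labelₚ (wk XS)) (out D ⊞ var) bounded)
  where
  Step : PT ((nat ⊗ A) ⊗ A ⊗ nat ⊗ Γ) A (λ (y , s , j , γ) → if proj₁ y ≡ᵇ j then proj₂ y else s)
  Step = ifₚ (π₁ topₚ ≡ₚ π₁ (π₂ popₚ)) (π₂ topₚ) accum
  select : ∀ j γ ys → size A (foldr (λ y s → if proj₁ y ≡ᵇ j then proj₂ y else s) (d γ) ys) ≤
                      ⟪ out D ⟫ (size Γ γ) + Σsize (nat ⊗ A) ys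
  select j γ [] = ≤-trans (size-out D γ) (m≤m+n _ _)
  select j γ ((l , y) ∷ ys) with l ≡ᵇ j
  ... | true  = ≤-trans (m≤n⇒m≤1+n (m≤n+m (size A y) (size nat l))) (≤-trans (m≤m+n _ _) (m≤n+m _ (⟪ out D ⟫ (size Γ γ))))
  ... | false = ≤-trans (select j γ ys) (+-monoʳ-≤ (⟪ out D ⟫ (size Γ γ)) (m≤n+m _ _))
  bounded : Bounded Step (λ γ → d (proj₂ γ)) (out D ⊞ var)
  bounded ys (j , γ) = ≤-trans (select j γ ys) (+-mono-≤
    (⟪⟫-mono (out D) (m≤n⇒m≤1+n (≤-trans (m≤n⇒m≤1+n (m≤n+m _ (size nat j))) (m≤n+m _ (size (list (nat ⊗ A)) ys)))))
    (m≤n⇒m≤1+n (m≤n⇒m≤1+n (m≤m+n _ _))))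

-- The kernel as a function on codes

-- The length of the list if c does not occur in it.
pos : ℕ → List ℕ → ℕ
pos c []       = 0
pos c (x ∷ xs) = if x ≡ᵇ c then 0 else suc (pos c xs)

member : ℕ → List ℕ → Bool
member c = any (_≡ᵇ c)

indices : ∀ {X : Set} → List X → List ℕ
indices xs = reverse (map proj₁ (label xs))

-- For xs the kept candidates and ys the votes, one entry per candidate of the
-- kernel: a unary bound, over which the names can be listed in polynomial time.
copies : ∀ {X Y : Set} → List X → List Y → List X
copies xs = foldr (λ _ s → xs ++ s) xs

best : (ℕ → ℕ) → List ℕ → List ℕ
best f = foldr (λ c s → if all (λ d → f d ≤ᵇ f c) s then c ∷ [] else s) []

firstVote : List (List ℕ) → List ℕ
firstVote = foldr (λ v _ → v) []

-- The candidates whose approval in v can change within budget β.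
inWindow : ℕ → ℕ → List ℕ → ℕ → Bool
inWindow k β v c = (k ≤ᵇ pos c v + β) ∧ (pos c v <ᵇ k + β)

relevant : ℕ → ℕ → List (List ℕ) → ℕ → Bool
relevant k β vs c = any (λ v → inWindow k β v c) vs

points : ℕ → List (List ℕ) → ℕ → ℕ
points k vs c = sum (map (λ v → bit (pos c v <ᵇ k)) vs)

-- The candidates kept by the kernel: p, the relevant ones, and a best one
-- among the others, whose points are fixed.
kept : ℕ → ℕ → ℕ → List (List ℕ) → List ℕ
kept k β p vs =
  p ∷ filterᵇ (λ c → not (c ≡ᵇ p) ∧ relevant k β vs c) (firstVote vs) ++
  best (points k vs) (filterᵇ (λ c → not (c ≡ᵇ p) ∧ not (relevant k β vs c)) (firstVote vs))

-- Candidate x < length L of the kernel stands for entry x of L. Candidate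
-- length L * suc b + x is a dummy standing in the approved part of the vote
-- labelled b for an entry of L that this vote does not approve, so that every
-- vote approves length L candidates.
front : ℕ → List ℕ → ℕ → List ℕ → List ℕ
front k L b v =
  map (λ c → length L * suc b + pos c L) (filterᵇ (λ c → k ≤ᵇ pos c v) (filterᵇ (λ c → member c L) v)) ++
  map (λ c → pos c L) (filterᵇ (λ c → member c L) v)

-- A vote has to rank every candidate. What is appended behind a `front` is approved by nobody
-- there: the dummies of other votes and those this vote does not need.
extend : List ℕ → List ℕ → List ℕ
extend ids xs = xs ++ filterᵇ (λ x → not (member x xs)) ids

-- The cost capped at β + 1, written so that it is positive for every input.
kernelCost : ℕ → List ℕ → List (List ℕ) → ℕ → ℕ → ℕ
kernelCost β L C x y = suc (if (x <ᵇ length L) ∧ (y <ᵇ length L)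
  then β ∸ (β ∸ (nth 0 (nth [] C (nth 0 L x)) (nth 0 L y) ∸ 1))
  else β)

kernelCosts : ℕ → List ℕ → List (List ℕ) → List ℕ → List (List ℕ)
kernelCosts β L C ids = map (λ x → map (λ y → if x ≡ᵇ y then 0 else kernelCost β L C x y) ids) ids

kernelRows : ℕ → ℕ → List ℕ → List ℕ → List (List ℕ × List (List ℕ)) → List (List ℕ × List (List ℕ))
kernelRows k β L ids rows = map
  (λ { (b , v , C) → extend ids (front k L b v) , kernelCosts β L C ids }) (label rows)

-- If k = 0 or k ≥ m, all candidates are tied, as they are for approval 0.
kernelCode : ⟦ instanceTy ⟧ → ⟦ instanceTy ⟧
kernelCode (m , k , p , β , rows) =
  length (copies L rows) , (if (0 <ᵇ k) ∧ (k <ᵇ m) then length L else 0) , 0 , β ,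
  kernelRows k β L (indices (copies L rows)) rows
  where
  L : List ℕ
  L = kept k β p (map proj₁ rows)

-- The kernel function runs in polynomial time

row : Ty
row = list nat ⊗ list (list nat)

posₚ : ∀ {Γ c xs} → PT Γ nat c → PT Γ (list nat) xs → PT Γ nat (λ γ → pos (c γ) (xs γ))
posₚ {Γ} {c} {xs} C XS = ext (λ γ → eq (c γ) (xs γ)) (letₚ C (foldₚ Step (lit 0) (wk XS) (con 1 ⊞ var) bounded))
  where
  Step : PT (nat ⊗ nat ⊗ nat ⊗ Γ) nat (λ (x , s , c , γ) → if x ≡ᵇ c then 0 else suc s)
  Step = ifₚ (topₚ ≡ₚ π₁ (π₂ popₚ)) (lit 0) (sucₚ accum)
  eq : ∀ c ys → foldr (λ x s → if x ≡ᵇ c then 0 else suc s) 0 ys ≡ pos c ys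
  eq c []       = refl
  eq c (y ∷ ys) = cong (λ s → if y ≡ᵇ c then 0 else suc s) (eq c ys)
  len : ∀ c ys → foldr (λ x s → if x ≡ᵇ c then 0 else suc s) 0 ys ≤ length ys
  len c []       = z≤n
  len c (y ∷ ys) with y ≡ᵇ c
  ... | true  = z≤n
  ... | false = s≤s (len c ys)
  bounded : Bounded Step (λ _ → 0) (con 1 ⊞ var)
  bounded ys (c , γ) = ≤-trans (size-nat≤ _) (s≤s (≤-trans (len c ys) (length≤ {nat} {nat ⊗ Γ} ys (c , γ))))

memberₚ : ∀ {Γ c xs} → PT Γ nat c → PT Γ (list nat) xs → PTᵇ Γ (λ γ → member (c γ) (xs γ))
memberₚ C XS = anyₚ (topₚ ≡ₚ wk C) XS

indicesₚ : ∀ {Γ A xs} → PT Γ (list A) xs → PT Γ (list nat) (λ γ → indices (xs γ))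
indicesₚ XS = ⟨ mapₚ (π₁ topₚ) (labelₚ XS) , lit 0 ⟩ ⟫ reverseₚ

copiesₚ : ∀ {Γ A B xs ys} → PT Γ (list A) xs → PT Γ (list B) ys → PT Γ (list A) (λ γ → copies (xs γ) (ys γ))
copiesₚ {Γ} {A} {B} {xs} {ys} XS YS = foldₚ Step XS YS ((con 1 ⊞ var) ⊠ out XS) bounded
  where
  Step : PT (B ⊗ list A ⊗ Γ) (list A) (λ (_ , s , γ) → xs γ ++ s)
  Step = wk (wk XS) ++ₚ accum
  sums : ∀ (us : List ⟦ A ⟧) (zs : List ⟦ B ⟧) → size (list A) (copies us zs) ≤ suc (length zs) * size (list A) us
  sums us []       = m≤m+n _ 0
  sums us (z ∷ zs) = begin
    suc (sum (map (size A) (us ++ copies us zs)))  ≡⟨ cong (suc ∘ sum) (map-++ (size A) us _) ⟩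
    suc (sum (map (size A) us ++ map (size A) (copies us zs))) ≡⟨ cong suc (sum-++ (map (size A) us) _) ⟩
    suc (Σsize A us) + Σsize A (copies us zs) ≤⟨ +-monoʳ-≤ (suc (Σsize A us)) (≤-trans (n≤1+n _) (sums us zs)) ⟩
    suc (suc (length zs)) * size (list A) us  ∎
    where open ≤-Reasoning
  bounded : Bounded Step xs ((con 1 ⊞ var) ⊠ out XS)
  bounded zs γ = ≤-trans (sums (xs γ) zs) (*-mono-≤ (s≤s (length≤ {B} {Γ} zs γ))
    (≤-trans (size-out XS γ) (⟪⟫-mono (out XS) (m≤n⇒m≤1+n (m≤n+m _ _)))))

bestₚ : ∀ {Γ f xs} → PT (nat ⊗ Γ) nat f → PT Γ (list nat) xs →
        PT Γ (list nat) (λ γ → best (λ c → f (c , γ)) (xs γ))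
bestₚ {Γ} {f} F XS = foldₚ Step nilₚ XS var bounded
  where
  Step : PT (nat ⊗ list nat ⊗ Γ) (list nat) (λ (c , s , γ) → if all (λ d → f (d , γ) ≤ᵇ f (c , γ)) s then c ∷ [] else s)
  Step = ifₚ (allₚ ((⟨ topₚ , π₂ (π₂ popₚ) ⟩ ⟫ F) ≤ₚ wk (element F)) accum) (topₚ ∷ₚ nilₚ) accum
  sums : ∀ γ ys → Σsize nat (best (λ c → f (c , γ)) ys) ≤ Σsize nat ys
  sums γ []       = z≤n
  sums γ (y ∷ ys) with all (λ d → f (d , γ) ≤ᵇ f (y , γ)) (best (λ c → f (c , γ)) ys)
  ... | true  = +-monoʳ-≤ (size nat y) z≤n
  ... | false = ≤-trans (sums γ ys) (m≤n+m _ _)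
  bounded : Bounded Step (λ _ → []) var
  bounded ys γ = s≤s (≤-trans (sums γ ys) (m≤n⇒m≤1+n (m≤m+n _ _)))

firstVoteₚ : ∀ {Γ vs} → PT Γ (list (list nat)) vs → PT Γ (list nat) (λ γ → firstVote (vs γ))
firstVoteₚ {Γ} VS = foldₚ topₚ nilₚ VS (con 1 ⊞ var) bounded
  where
  bounded : Bounded {S = list nat} {Γ} topₚ (λ _ → []) (con 1 ⊞ var)
  bounded []       γ = s≤s z≤n
  bounded (v ∷ vs) γ = m≤n⇒m≤1+n (≤-trans (m≤m+n _ _) (Σsize≤ {list nat} {Γ} (v ∷ vs) γ))

inWindowₚ : ∀ {Γ k β v c} → PT Γ nat k → PT Γ nat β → PT Γ (list nat) v → PT Γ nat c →
            PTᵇ Γ (λ γ → inWindow (k γ) (β γ) (v γ) (c γ))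
inWindowₚ K Β V C = (K ≤ₚ posₚ C V +ₚ Β) ∧ₚ (posₚ C V <ₚ K +ₚ Β)

relevantₚ : ∀ {Γ k β vs c} → PT Γ nat k → PT Γ nat β → PT Γ (list (list nat)) vs → PT Γ nat c →
            PTᵇ Γ (λ γ → relevant (k γ) (β γ) (vs γ) (c γ))
relevantₚ K Β VS C = anyₚ (inWindowₚ (wk K) (wk Β) topₚ (wk C)) VS

pointsₚ : ∀ {Γ k vs c} → PT Γ nat k → PT Γ (list (list nat)) vs → PT Γ nat c →
          PT Γ nat (λ γ → points (k γ) (vs γ) (c γ))
pointsₚ K VS C = sumₚ (mapₚ (posₚ (wk C) topₚ <ₚ wk K) VS)

keptₚ : ∀ {Γ k β p vs} → PT Γ nat k → PT Γ nat β → PT Γ nat p → PT Γ (list (list nat)) vs →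
        PT Γ (list nat) (λ γ → kept (k γ) (β γ) (p γ) (vs γ))
keptₚ K Β P VS =
  P ∷ₚ (filterₚ (notₚ (topₚ ≡ₚ wk P) ∧ₚ relevantₚ (wk K) (wk Β) (wk VS) topₚ) (firstVoteₚ VS) ++ₚ
  bestₚ (pointsₚ (wk K) (wk VS) topₚ)
        (filterₚ (notₚ (topₚ ≡ₚ wk P) ∧ₚ notₚ (relevantₚ (wk K) (wk Β) (wk VS) topₚ)) (firstVoteₚ VS)))

frontₚ : ∀ {Γ k L b v} → PT Γ nat k → PT Γ (list nat) L → PT Γ nat b → PT Γ (list nat) v →
         PT Γ (list nat) (λ γ → front (k γ) (L γ) (b γ) (v γ))
frontₚ K L B V =
  mapₚ (lengthₚ (wk L) *ₚ sucₚ (wk B) +ₚ posₚ topₚ (wk L)) (filterₚ (wk K ≤ₚ posₚ topₚ (wk V)) keptV) ++ₚ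
  mapₚ (posₚ topₚ (wk L)) keptV
  where keptV = filterₚ (memberₚ topₚ (wk L)) V

extendₚ : ∀ {Γ ids xs} → PT Γ (list nat) ids → PT Γ (list nat) xs →
            PT Γ (list nat) (λ γ → extend (ids γ) (xs γ))
extendₚ I XS = XS ++ₚ filterₚ (notₚ (memberₚ topₚ (wk XS))) I

kernelCostₚ : ∀ {Γ β L C x y} → PT Γ nat β → PT Γ (list nat) L → PT Γ (list (list nat)) C →
              PT Γ nat x → PT Γ nat y → PT Γ nat (λ γ → kernelCost (β γ) (L γ) (C γ) (x γ) (y γ))
kernelCostₚ Β L C X Y = sucₚ (ifₚ ((X <ₚ lengthₚ L) ∧ₚ (Y <ₚ lengthₚ L))
  (Β ∸ₚ (Β ∸ₚ (nthₚ (lit 0) (nthₚ nilₚ C (nthₚ (lit 0) L X)) (nthₚ (lit 0) L Y) ∸ₚ lit 1))) Β)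

kernelCostsₚ : ∀ {Γ β L C ids} → PT Γ nat β → PT Γ (list nat) L → PT Γ (list (list nat)) C → PT Γ (list nat) ids →
               PT Γ (list (list nat)) (λ γ → kernelCosts (β γ) (L γ) (C γ) (ids γ))
kernelCostsₚ Β L C I = mapₚ (mapₚ
  (ifₚ (wk topₚ ≡ₚ topₚ) (lit 0) (kernelCostₚ (wk (wk Β)) (wk (wk L)) (wk (wk C)) (wk topₚ) topₚ)) (wk I)) I

kernelRowsₚ : ∀ {Γ k β L ids rows} → PT Γ nat k → PT Γ nat β → PT Γ (list nat) L → PT Γ (list nat) ids →
              PT Γ (list row) rows → PT Γ (list row) (λ γ → kernelRows (k γ) (β γ) (L γ) (ids γ) (rows γ))
kernelRowsₚ K Β L I R = mapₚ
  ⟨ extendₚ (wk I) (frontₚ (wk K) (wk L) (π₁ topₚ) (π₁ (π₂ topₚ)))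
  , kernelCostsₚ (wk Β) (wk L) (π₂ (π₂ topₚ)) (wk I) ⟩ (labelₚ R)

kernelCodeₚ : PT instanceTy instanceTy kernelCode
kernelCodeₚ = letₚ (keptₚ K Β P (mapₚ (π₁ topₚ) R)) (letₚ (copiesₚ topₚ (wk R))
  ⟨ lengthₚ topₚ , ⟨ ifₚ ((lit 0 <ₚ wk (wk K)) ∧ₚ (wk (wk K) <ₚ wk (wk M))) (lengthₚ (wk topₚ)) (lit 0) , ⟨ lit 0 , ⟨ wk (wk Β) ,
  kernelRowsₚ (wk (wk K)) (wk (wk Β)) (wk topₚ) (indicesₚ topₚ) (wk (wk R)) ⟩ ⟩ ⟩ ⟩)
  where
  M = π₁ {instanceTy} selfₚ
  K = π₁ (π₂ {instanceTy} selfₚ)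
  P = π₁ (π₂ (π₂ {instanceTy} selfₚ))
  Β = π₁ (π₂ (π₂ (π₂ {instanceTy} selfₚ)))
  R = π₂ (π₂ (π₂ (π₂ {instanceTy} selfₚ)))

-- Boolean predicates on lists

∈-filterᵇ⁺ : ∀ {X : Set} (p : X → Bool) {x xs} → x ∈ xs → T (p x) → x ∈ filterᵇ p xs
∈-filterᵇ⁺ p = ∈-filter⁺ (T? ∘ p)

∈-filterᵇ⁻ : ∀ {X : Set} (p : X → Bool) {x xs} → x ∈ filterᵇ p xs → x ∈ xs × T (p x)
∈-filterᵇ⁻ p {xs = xs} = ∈-filter⁻ (T? ∘ p) {xs = xs}

filterᵇ-unique : ∀ {X : Set} (p : X → Bool) {xs} → Unique xs → Unique (filterᵇ p xs)
filterᵇ-unique p = Unique.filter⁺ (T? ∘ p)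

any⁺ : ∀ {X : Set} (p : X → Bool) {x xs} → x ∈ xs → T (p x) → T (any p xs)
any⁺ p {xs = y ∷ ys} (here refl) px with p y
... | true = _
any⁺ p {xs = y ∷ ys} (there x∈) px with p y
... | true  = _
... | false = any⁺ p x∈ px

any⁻ : ∀ {X : Set} (p : X → Bool) xs → T (any p xs) → ∃[ x ] (x ∈ xs × T (p x))
any⁻ p (y ∷ ys) t with p y in eq
... | true  = y , here refl , subst T (sym eq) _
... | false with any⁻ p ys t
...   | x , x∈ , px = x , there x∈ , px

T-not : ∀ {b} → ¬ T b → T (not b)
T-not {true}  ¬t = ⊥-elim (¬t _)
T-not {false} ¬t = _

T-not⁻ : ∀ {b} → T (not b) → ¬ T b
T-not⁻ {true} ()

∧⁺ : ∀ {a b} → T a → T b → T (a ∧ b)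
∧⁺ {true} _ tb = tb

∧⁻ : ∀ {a b} → T (a ∧ b) → T a × T b
∧⁻ {true} tb = _ , tb

member⁺ : ∀ {c xs} → c ∈ xs → T (member c xs)
member⁺ {c} c∈ = any⁺ (_≡ᵇ c) c∈ (≡⇒≡ᵇ c c refl)

member⁻ : ∀ {c xs} → T (member c xs) → c ∈ xs
member⁻ {c} {xs} t with any⁻ (_≡ᵇ c) xs t
... | x , x∈ , x≡c = subst (_∈ xs) (≡ᵇ⇒≡ x c x≡c) x∈

member? : ∀ c xs → Dec (c ∈ xs)
member? c xs = map′ member⁻ member⁺ (T? (member c xs))

-- Lists of candidates

pos-≡ : ∀ c xs → pos c (c ∷ xs) ≡ 0
pos-≡ c xs with c ≡ᵇ c | ≡⇒≡ᵇ c c refl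
... | true | _ = refl

pos-≢ : ∀ {x c} xs → x ≢ c → pos c (x ∷ xs) ≡ suc (pos c xs)
pos-≢ {x} {c} xs x≢c with x ≡ᵇ c in eq
... | true  = contradiction (≡ᵇ⇒≡ x c (subst T (sym eq) tt)) x≢c
... | false = refl

∈-tail : ∀ {x c : ℕ} {xs} → x ≢ c → c ∈ x ∷ xs → c ∈ xs
∈-tail x≢c (here refl) = contradiction refl x≢c
∈-tail x≢c (there c∈)  = c∈

pos<length : ∀ {c xs} → c ∈ xs → pos c xs < length xs
pos<length {c} {x ∷ xs} c∈ with x ≟ c
... | yes refl = subst (_< suc (length xs)) (sym (pos-≡ c xs)) z<s
... | no x≢c   = subst (_< suc (length xs)) (sym (pos-≢ xs x≢c)) (s<s (pos<length (∈-tail x≢c c∈)))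

pos-injective : ∀ {c d xs} → c ∈ xs → pos c xs ≡ pos d xs → c ≡ d
pos-injective {c} {d} {x ∷ xs} c∈ eq with x ≟ c | x ≟ d
... | yes refl | yes refl = refl
... | yes refl | no x≢d   = contradiction (trans (sym (pos-≡ x xs)) (trans eq (pos-≢ xs x≢d))) λ ()
... | no x≢c   | yes refl = contradiction (trans (sym (pos-≢ xs x≢c)) (trans eq (pos-≡ x xs))) λ ()
... | no x≢c   | no x≢d   = pos-injective (∈-tail x≢c c∈)
  (suc-injective (trans (sym (pos-≢ xs x≢c)) (trans eq (pos-≢ xs x≢d))))

pos-++ˡ : ∀ {c xs} ys → c ∈ xs → pos c (xs ++ ys) ≡ pos c xs
pos-++ˡ {c} {x ∷ xs} ys c∈ with x ≟ c
... | yes refl = trans (pos-≡ c (xs ++ ys)) (sym (pos-≡ c xs))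
... | no x≢c   = trans (pos-≢ (xs ++ ys) x≢c) (trans (cong suc (pos-++ˡ ys (∈-tail x≢c c∈))) (sym (pos-≢ xs x≢c)))

pos-++ʳ : ∀ {c} xs ys → c ∉ xs → pos c (xs ++ ys) ≡ length xs + pos c ys
pos-++ʳ [] ys c∉ = refl
pos-++ʳ {c} (x ∷ xs) ys c∉ = trans (pos-≢ {x} {c} (xs ++ ys) (λ { refl → c∉ (here refl) })) (cong suc (pos-++ʳ xs ys (c∉ ∘ there)))

pos-map : ∀ {c} (g : ℕ → ℕ) xs → (∀ {d} → d ∈ xs → g d ≡ g c → d ≡ c) → pos (g c) (map g xs) ≡ pos c xs
pos-map g [] inj = refl
pos-map {c} g (x ∷ xs) inj with x ≟ c
... | yes refl = trans (pos-≡ (g x) (map g xs)) (sym (pos-≡ x xs))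
... | no x≢c   = trans (pos-≢ (map g xs) (x≢c ∘ inj (here refl)))
                   (trans (cong suc (pos-map g xs (inj ∘ there))) (sym (pos-≢ xs x≢c)))

pos-tabulate : ∀ {n} (f : Fin n → ℕ) → (∀ {i j} → f i ≡ f j → i ≡ j) → ∀ i → pos (f i) (tabulate f) ≡ toℕ i
pos-tabulate f inj zero = pos-≡ (f zero) (tabulate (f ∘ suc))
pos-tabulate {suc n} f inj (suc i) = trans (pos-≢ (tabulate (f ∘ suc)) (λ eq → case inj eq of λ ()))
  (cong suc (pos-tabulate (f ∘ suc) (Fin.suc-injective ∘ inj) i))

nth-zero : ∀ {X : Set} (d : X) x xs → nth d (x ∷ xs) 0 ≡ x
nth-zero d x xs with length (label xs) ≡ᵇ length xs | ≡⇒≡ᵇ _ _ (length-label xs)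
... | true | _ = refl

-- The bound on `i` matters: beyond the end the truncated subtraction always asks for label 0, which
-- for empty `xs` is the label of `x`.
nth-suc : ∀ {X : Set} (d : X) x xs {i} → i < length xs → nth d (x ∷ xs) (suc i) ≡ nth d xs i
nth-suc d x xs {i} i< with length (label xs) ≡ᵇ length xs ∸ suc i in eq
... | false = refl
... | true  = contradiction
      (trans (sym (length-label xs)) (≡ᵇ⇒≡ (length (label xs)) (length xs ∸ suc i) (subst T (sym eq) tt)))
      (>⇒≢ (∸-monoʳ-< {length xs} z<s i<))

nth-tabulate : ∀ {X : Set} (d : X) {n} (f : Fin n → X) i → nth d (tabulate f) (toℕ i) ≡ f i
nth-tabulate d f zero = nth-zero d (f zero) (tabulate (f ∘ suc))
nth-tabulate d {suc n} f (suc i) = trans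
  (nth-suc d (f zero) (tabulate (f ∘ suc)) (subst (toℕ i <_) (sym (length-tabulate (f ∘ suc))) (Fin.toℕ<n i)))
  (nth-tabulate d (f ∘ suc) i)

nth∈ : ∀ {X : Set} (d : X) xs {i} → i < length xs → nth d xs i ∈ xs
nth∈ d (x ∷ xs) {zero}  i< = here (nth-zero d x xs)
nth∈ d (x ∷ xs) {suc i} (s<s i<) = there (subst (_∈ xs) (sym (nth-suc d x xs i<)) (nth∈ d xs i<))

nth-pos : ∀ {d c xs} → c ∈ xs → nth d xs (pos c xs) ≡ c
nth-pos {d} {c} {x ∷ xs} c∈ with x ≟ c
... | yes refl = trans (cong (nth d (x ∷ xs)) (pos-≡ x xs)) (nth-zero d x xs)
... | no x≢c   = trans (cong (nth d (x ∷ xs)) (pos-≢ xs x≢c))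
  (trans (nth-suc d x xs (pos<length (∈-tail x≢c c∈))) (nth-pos (∈-tail x≢c c∈)))

pos-nth : ∀ {d xs i} → Unique xs → i < length xs → pos (nth d xs i) xs ≡ i
pos-nth {d} {x ∷ xs} {zero} u i< = trans (cong (λ c → pos c (x ∷ xs)) (nth-zero d x xs)) (pos-≡ x xs)
pos-nth {d} {x ∷ xs} {suc i} (x∉ ∷ u) (s<s i<) = trans (cong (λ c → pos c (x ∷ xs)) (nth-suc d x xs i<))
  (trans (pos-≢ xs (All.lookup x∉ (nth∈ d xs i<))) (cong suc (pos-nth u i<)))

tabulate-nth : ∀ {d : ℕ} xs {m} → length xs ≡ m → tabulate {n = m} (λ j → nth d xs (toℕ j)) ≡ xs
tabulate-nth [] refl = refl
tabulate-nth {d} (x ∷ xs) refl = cong₂ _∷_ (nth-zero d x xs)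
  (trans (tabulate-cong (λ j → nth-suc d x xs (Fin.toℕ<n j))) (tabulate-nth xs refl))

-- Filtering moves an entry that survives from position `j` to `count p j xs` (`pos-filter`). Hence
-- everything about positions in the kernel votes is a statement about the growth of this function.
count : (ℕ → Bool) → ℕ → List ℕ → ℕ
count p zero    xs       = 0
count p (suc j) []       = 0
count p (suc j) (x ∷ xs) = bit (p x) + count p j xs

count-mono : ∀ p xs {i j} → i ≤ j → count p i xs ≤ count p j xs
count-mono p xs       z≤n       = z≤n
count-mono p []       (s≤s i≤j) = z≤n
count-mono p (x ∷ xs) (s≤s i≤j) = +-monoʳ-≤ (bit (p x)) (count-mono p xs i≤j)

count-suc : ∀ p {c xs} → c ∈ xs → T (p c) → count p (suc (pos c xs)) xs ≡ suc (count p (pos c xs) xs)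
count-suc p {c} {x ∷ xs} c∈ pc with x ≟ c
... | yes refl rewrite pos-≡ c xs with p c
...   | true = refl
count-suc p {c} {x ∷ xs} c∈ pc | no x≢c rewrite pos-≢ xs x≢c =
  trans (cong (bit (p x) +_) (count-suc p (∈-tail x≢c c∈) pc)) (+-suc (bit (p x)) _)

count-strict : ∀ p {c xs j} → c ∈ xs → T (p c) → pos c xs < j → count p (pos c xs) xs < count p j xs
count-strict p {xs = xs} c∈ pc pos<j = ≤-trans (≤-reflexive (sym (count-suc p c∈ pc))) (count-mono p xs pos<j)

-- Where no entry is dropped, filtering is a translation. Uniqueness allows the entry at a position
-- to be named by `nth` and its position to be recovered.
count-interval : ∀ p {xs} → Unique xs → ∀ lo d → lo + d ≤ length xs →
  (∀ {c} → c ∈ xs → lo ≤ pos c xs → pos c xs < lo + d → T (p c)) → count p (lo + d) xs ≡ count p lo xs + d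
count-interval p {xs} u lo zero    _ _ = trans (cong (λ i → count p i xs) (+-identityʳ lo)) (sym (+-identityʳ _))
count-interval p {xs} u lo (suc d) lo+d≤ all = begin
  count p (lo + suc d) xs      ≡⟨ cong (λ i → count p i xs) (+-suc lo d) ⟩
  count p (suc (lo + d)) xs    ≡⟨ cong (λ i → count p (suc i) xs) at-c ⟨
  count p (suc (pos c xs)) xs  ≡⟨ count-suc p (nth∈ 0 xs lo+d<) (all (nth∈ 0 xs lo+d<)
      (≤-trans (m≤m+n lo d) (≤-reflexive (sym at-c)))
      (≤-trans (≤-reflexive (cong suc at-c)) (≤-reflexive (sym (+-suc lo d))))) ⟩
  suc (count p (pos c xs) xs)  ≡⟨ cong (λ i → suc (count p i xs)) at-c ⟩
  suc (count p (lo + d) xs)    ≡⟨ cong suc (count-interval p u lo d (<⇒≤ lo+d<)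
      λ c∈ lo≤ <hi → all c∈ lo≤ (<-trans <hi (+-monoʳ-< lo ≤-refl))) ⟩
  suc (count p lo xs + d)      ≡⟨ +-suc _ d ⟨
  count p lo xs + suc d        ∎
  where
  open ≡-Reasoning
  lo+d< : lo + d < length xs
  lo+d< = ≤-trans (≤-reflexive (sym (+-suc lo d))) lo+d≤
  c = nth 0 xs (lo + d)
  at-c : pos c xs ≡ lo + d
  at-c = pos-nth u lo+d<

pos-filter : ∀ p {c xs} → c ∈ xs → T (p c) → pos c (filterᵇ p xs) ≡ count p (pos c xs) xs
pos-filter p {c} {x ∷ xs} c∈ pc with x ≟ c
... | yes refl rewrite pos-≡ c xs with p c
...   | true = pos-≡ c (filterᵇ p xs)
pos-filter p {c} {x ∷ xs} c∈ pc | no x≢c rewrite pos-≢ xs x≢c with p x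
... | true  = trans (pos-≢ (filterᵇ p xs) x≢c) (cong suc (pos-filter p (∈-tail x≢c c∈) pc))
... | false = pos-filter p (∈-tail x≢c c∈) pc

filterᵇ-cong : ∀ {X : Set} {p q : X → Bool} xs → (∀ {x} → x ∈ xs → p x ≡ q x) → filterᵇ p xs ≡ filterᵇ q xs
filterᵇ-cong [] eq = refl
filterᵇ-cong {p = p} {q} (x ∷ xs) eq with p x | q x | eq (here refl)
... | true  | .true  | refl = cong (x ∷_) (filterᵇ-cong xs (eq ∘ there))
... | false | .false | refl = filterᵇ-cong xs (eq ∘ there)

-- The entries that pass split at position `k`. With `p` as membership among the kept candidates,
-- the first summand is the number of dummies of a vote.
count-rest : ∀ p k xs → Unique xs →
  length (filterᵇ (λ c → k ≤ᵇ pos c xs) (filterᵇ p xs)) + count p k xs ≡ length (filterᵇ p xs)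
count-rest p zero xs u = trans (+-identityʳ _) (cong length (all-true (filterᵇ p xs)))
  where
  all-true : ∀ (ys : List ℕ) → filterᵇ (λ _ → true) ys ≡ ys
  all-true []       = refl
  all-true (y ∷ ys) = cong (y ∷_) (all-true ys)
count-rest p (suc k) [] u = refl
count-rest p (suc k) (x ∷ xs) (x∉ ∷ u) = go
  where
  tail-eq : filterᵇ (λ c → suc k ≤ᵇ pos c (x ∷ xs)) (filterᵇ p xs) ≡ filterᵇ (λ c → k ≤ᵇ pos c xs) (filterᵇ p xs)
  tail-eq = filterᵇ-cong (filterᵇ p xs) λ {c} c∈ →
    trans (cong (suc k ≤ᵇ_) (pos-≢ xs (All.lookup x∉ (proj₁ (∈-filterᵇ⁻ p c∈))))) (≤ᵇ-suc k (pos c xs))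
    where
    ≤ᵇ-suc : ∀ a b → (suc a ≤ᵇ suc b) ≡ (a ≤ᵇ b)
    ≤ᵇ-suc zero    b = refl
    ≤ᵇ-suc (suc a) b = refl
  go : length (filterᵇ (λ c → suc k ≤ᵇ pos c (x ∷ xs)) (filterᵇ p (x ∷ xs))) + count p (suc k) (x ∷ xs) ≡ length (filterᵇ p (x ∷ xs))
  go with p x
  ... | false = trans (cong (λ l → length l + count p k xs) tail-eq) (count-rest p k xs u)
  ... | true rewrite pos-≡ x xs = trans (+-suc _ _)
        (cong suc (trans (cong (λ l → length l + count p k xs) tail-eq) (count-rest p k xs u)))

map-unique : ∀ {X Y : Set} (f : X → Y) {xs} → (∀ {x y} → x ∈ xs → y ∈ xs → f x ≡ f y → x ≡ y) →
             Unique xs → Unique (map f xs)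
map-unique f {[]} inj [] = []
map-unique f {x ∷ xs} inj (x∉ ∷ u) =
  All.tabulate (λ fy∈ eq → let y , y∈ , fy≡ = ∈-map⁻ f fy∈ in
    All.lookup x∉ y∈ (inj (here refl) (there y∈) (trans eq fy≡))) ∷
  map-unique f (λ x∈ y∈ → inj (there x∈) (there y∈)) u

unique-length-≡ : ∀ {xs ys : List ℕ} → Unique xs → Unique ys →
                  (∀ {c} → c ∈ xs → c ∈ ys) → (∀ {c} → c ∈ ys → c ∈ xs) → length xs ≡ length ys
unique-length-≡ u u′ to from = ↭-length (∼bag⇒↭ (unique∧set⇒bag u u′ (mk⇔ to from)))

-- Pigeonhole: `xs` is as long as the sublist of `upTo N` formed by its own entries.
unique-length-≤ : ∀ {xs N} → Unique xs → (∀ {c} → c ∈ xs → c < N) → length xs ≤ N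
unique-length-≤ {xs} {N} u <N = ≤-trans (≤-reflexive (unique-length-≡ u (filterᵇ-unique _ (Unique.upTo⁺ N))
    (λ c∈ → ∈-filterᵇ⁺ (λ c → member c xs) (∈-upTo⁺ (<N c∈)) (member⁺ c∈))
    (λ c∈ → member⁻ (proj₂ (∈-filterᵇ⁻ (λ c → member c xs) {xs = upTo N} c∈)))))
  (≤-trans (length-filterᵇ (λ c → member c xs) (upTo N)) (≤-reflexive (length-upTo N)))
  where
  length-filterᵇ : ∀ {X : Set} (p : X → Bool) xs → length (filterᵇ p xs) ≤ length xs
  length-filterᵇ p = length-filter (T? ∘ p)

-- Votes as lists

record IsRanking (m : ℕ) (xs : List ℕ) : Set where
  field
    unique   : Unique xs
    complete : ∀ {c} → c < m → c ∈ xs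
    bounded  : ∀ {c} → c ∈ xs → c < m

  length≡ : length xs ≡ m
  length≡ = trans (unique-length-≡ unique (Unique.upTo⁺ m) (∈-upTo⁺ ∘ bounded) (complete ∘ ∈-upTo⁻)) (length-upTo m)

open IsRanking public

module _ {m} {xs} (r : IsRanking m xs) where

  position : Fin m → Fin m
  position c = fromℕ< (subst (pos (toℕ c) xs <_) (length≡ r) (pos<length (complete r (Fin.toℕ<n c))))

  candidate : Fin m → Fin m
  candidate j = fromℕ< (bounded r (nth∈ 0 xs (subst (toℕ j <_) (sym (length≡ r)) (Fin.toℕ<n j))))

  vote : Vote m
  vote = permutation position candidate
    (λ j → Fin.toℕ-injective (trans (Fin.toℕ-fromℕ< _) (trans (cong (λ c → pos c xs) (Fin.toℕ-fromℕ< _))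
      (pos-nth (unique r) (subst (toℕ j <_) (sym (length≡ r)) (Fin.toℕ<n j))))))
    (λ c → Fin.toℕ-injective (trans (Fin.toℕ-fromℕ< _) (trans (cong (nth 0 xs) (Fin.toℕ-fromℕ< _))
      (nth-pos (complete r (Fin.toℕ<n c))))))

  vote-at : ∀ c → toℕ (vote ⟨$⟩ʳ c) ≡ pos (toℕ c) xs
  vote-at c = Fin.toℕ-fromℕ< _

  encodeVote-vote : encodeVote vote ≡ xs
  encodeVote-vote = trans (tabulate-cong (λ j → Fin.toℕ-fromℕ< _)) (tabulate-nth xs (length≡ r))

encodeVote-ranking : ∀ {m} (v : Vote m) → IsRanking m (encodeVote v)
encodeVote-ranking {m} v = record
  { unique   = Unique.tabulate⁺ injective
  ; complete = λ {c} c<m → subst (_∈ encodeVote v)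
      (trans (cong toℕ (inverseˡ v)) (Fin.toℕ-fromℕ< c<m)) (∈-tabulate⁺ (v ⟨$⟩ʳ fromℕ< c<m))
  ; bounded  = λ c∈ → let j , c≡ = ∈-tabulate⁻ c∈ in subst (_< m) (sym c≡) (Fin.toℕ<n _) }
  where
  injective : ∀ {i j} → toℕ (v ⟨$⟩ˡ i) ≡ toℕ (v ⟨$⟩ˡ j) → i ≡ j
  injective eq = trans (sym (inverseʳ v)) (trans (cong (v ⟨$⟩ʳ_) (Fin.toℕ-injective eq)) (inverseʳ v))

pos-encodeVote : ∀ {m} (v : Vote m) c → pos (toℕ c) (encodeVote v) ≡ toℕ (v ⟨$⟩ʳ c)
pos-encodeVote v c = trans (cong (λ d → pos (toℕ d) (encodeVote v)) (sym (inverseˡ v)))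
  (pos-tabulate _ (λ eq → trans (sym (inverseʳ v)) (trans (cong (v ⟨$⟩ʳ_) (Fin.toℕ-injective eq)) (inverseʳ v))) (v ⟨$⟩ʳ c))

indices≡upTo : ∀ {X : Set} (xs : List X) → indices xs ≡ upTo (length xs)
indices≡upTo xs = trans (cong reverse (labels xs)) (reverse-downFrom (length xs))
  where
  labels : ∀ {X : Set} (xs : List X) → map proj₁ (label xs) ≡ downFrom (length xs)
  labels []       = refl
  labels (x ∷ xs) = cong₂ _∷_ (length-label xs) (labels xs)

length-copies : ∀ {X Y : Set} (xs : List X) (ys : List Y) → length (copies xs ys) ≡ suc (length ys) * length xs
length-copies xs []       = sym (+-identityʳ _)
length-copies xs (y ∷ ys) = trans (length-++ xs) (cong (length xs +_) (length-copies xs ys))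

label-tabulate : ∀ {X : Set} {n} (f : Fin n → X) → label (tabulate f) ≡ tabulate (λ i → n ∸ suc (toℕ i) , f i)
label-tabulate {n = zero}  f = refl
label-tabulate {n = suc n} f = cong₂ _∷_
  (cong (_, f zero) (trans (length-label (tabulate (f ∘ suc))) (length-tabulate (f ∘ suc)))) (label-tabulate (f ∘ suc))

extend-ranking : ∀ {m xs} → Unique xs → (∀ {c} → c ∈ xs → c < m) → IsRanking m (extend (upTo m) xs)
extend-ranking {m} {xs} u <m = record
  { unique   = Unique.++⁺ u (filterᵇ-unique outside (Unique.upTo⁺ m))
      λ { (x∈ , x∈′) → T-not⁻ (proj₂ (∈-filterᵇ⁻ outside {xs = upTo m} x∈′)) (member⁺ x∈) }
  ; complete = λ {c} c<m → case member? c xs of λ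
      { (yes c∈) → ∈-++⁺ˡ c∈
      ; (no c∉)  → ∈-++⁺ʳ xs (∈-filterᵇ⁺ outside (∈-upTo⁺ c<m) (T-not (c∉ ∘ member⁻))) }
  ; bounded  = λ c∈ → case ∈-++⁻ xs c∈ of λ
      { (inj₁ c∈) → <m c∈
      ; (inj₂ c∈) → ∈-upTo⁻ (proj₁ (∈-filterᵇ⁻ outside {xs = upTo m} c∈)) } }
  where
  outside : ℕ → Bool
  outside x = not (member x xs)

-- Swaps and their simulation in another election

at : ∀ {m} → Vote m → Fin m → ℕ
at v c = toℕ (v ⟨$⟩ʳ c)

at-swap-left : ∀ {m} (v : Vote m) s → at (applySwap v s) (left s) ≡ at v (right s)
at-swap-left v s with left s Fin.≟ left s
... | yes _  = refl
... | no l≢l = contradiction refl l≢l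

at-swap-right : ∀ {m} (v : Vote m) s → at (applySwap v s) (right s) ≡ at v (left s)
at-swap-right v s with right s Fin.≟ left s
... | yes r≡l = cong (at v) r≡l
... | no _ with right s Fin.≟ right s
...   | yes _  = refl
...   | no r≢r = contradiction refl r≢r

at-swap-other : ∀ {m} (v : Vote m) s {c} → c ≢ left s → c ≢ right s → at (applySwap v s) c ≡ at v c
at-swap-other v s {c} c≢l c≢r with c Fin.≟ left s
... | yes c≡l = contradiction c≡l c≢l
... | no _ with c Fin.≟ right s
...   | yes c≡r = contradiction c≡r c≢r
...   | no _    = refl

data SwapView {m} (s : Swap m) : Fin m → Set where
  isLeft  : SwapView s (left s)
  isRight : SwapView s (right s)
  other   : ∀ {c} → c ≢ left s → c ≢ right s → SwapView s c

swapView : ∀ {m} (s : Swap m) c → SwapView s c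
swapView s c with c Fin.≟ left s | c Fin.≟ right s
... | yes refl | _        = isLeft
... | no _     | yes refl = isRight
... | no c≢l   | no c≢r   = other c≢l c≢r

swap-≡ : ∀ {m} {s t : Swap m} → left s ≡ left t → right s ≡ right t → s ≡ t
swap-≡ refl refl = refl

-- An admissible swap moves two candidates by one position each, leaves the others alone, and costs
-- at least 1.
drift : ∀ {m} (cost : Swap m → ℕ) → (∀ s → 1 ≤ cost s) → ∀ {v ss w} → v ⟶[ ss ] w → ∀ c →
        at w c ≤ at v c + sum (map cost ss) × at v c ≤ at w c + sum (map cost ss)
drift cost cost≥1 done c = m≤m+n _ _ , m≤m+n _ _
drift cost cost≥1 {v} {s ∷ ss} {w} (step adm run) c with drift cost cost≥1 run c
... | up , down = glue (at v c) (at v₁ c) (at w c) (proj₁ near) up , glue′ (proj₂ near) down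
  where
  v₁ = applySwap v s
  S = sum (map cost ss)
  near : at v₁ c ≤ suc (at v c) × at v c ≤ suc (at v₁ c)
  near with swapView s c
  -- As `rank` counts from 1, `adm` reduces to `suc (at v (left s)) ≡ at v (right s)`.
  ... | isLeft  rewrite at-swap-left v s  | sym adm = ≤-refl , m≤n⇒m≤1+n (n≤1+n _)
  ... | isRight rewrite at-swap-right v s | sym adm = m≤n⇒m≤1+n (n≤1+n _) , ≤-refl
  ... | other c≢l c≢r rewrite at-swap-other v s c≢l c≢r = n≤1+n _ , n≤1+n _
  glue : ∀ x y z → y ≤ suc x → z ≤ y + S → z ≤ x + (cost s + S)
  glue x y z y≤ z≤ = begin
    z                  ≤⟨ z≤ ⟩
    y + S              ≤⟨ +-monoˡ-≤ S y≤ ⟩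
    suc x + S          ≡⟨ +-suc x S ⟨
    x + (1 + S)        ≤⟨ +-monoʳ-≤ x (+-monoˡ-≤ S (cost≥1 s)) ⟩
    x + (cost s + S)   ∎
    where open ≤-Reasoning
  glue′ : ∀ {x y z} → x ≤ suc y → y ≤ z + S → x ≤ z + (cost s + S)
  glue′ {x} {y} {z} x≤ y≤ = begin
    x                  ≤⟨ x≤ ⟩
    suc y              ≤⟨ s≤s y≤ ⟩
    suc (z + S)        ≡⟨ +-suc z S ⟨
    z + (1 + S)        ≤⟨ +-monoʳ-≤ z (+-monoˡ-≤ S (cost≥1 s)) ⟩
    z + (cost s + S)   ∎
    where open ≤-Reasoning

-- R identifies some candidates of two elections. Swaps inside a window around
-- position k are copied and the others dropped; as the window shrinks with
-- the remaining budget, a dropped swap cannot matter later.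
module Simulation {m m′ : ℕ} (β k k′ : ℕ)
  (R : Fin m → Fin m′ → Set)
  (R-functional : ∀ {a x y} → R a x → R a y → x ≡ y)
  (R-injective : ∀ {a b x} → R a x → R b x → a ≡ b)
  (cost : Swap m → ℕ) (cost′ : Swap m′ → ℕ)
  (cost≥1 : ∀ s → 1 ≤ cost s)
  (cost-≤ : ∀ {s s′} → R (left s) (left s′) → R (right s) (right s′) → cost s ≤ β → cost′ s′ ≤ cost s)
  (Dummy : Fin m → Set)
  (dummy-cost : ∀ s → Dummy (left s) ⊎ Dummy (right s) → β < cost s)
  (X Y : ℕ)
  where

  -- Positions count from 0, so `r` swaps can carry a candidate across the boundary only from the
  -- positions `k - r` to `k + r - 1`. The lower end is written additively to avoid truncation.
  Window : ℕ → Vote m → Fin m → Set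
  Window r v a = k ≤ at v a + r × at v a < k + r

  -- Inside the window the two votes differ by a translation. With an offset on each side the
  -- equation can be read backwards, so exchanging `X` and `Y` gives the other direction. A dummy
  -- needs no counterpart, as no affordable swap touches it.
  Aligned : ℕ → Vote m → Vote m′ → Set
  Aligned r v v′ = ∀ a → Window r v a → Dummy a ⊎ ∃[ x ] (R a x × at v′ x + X ≡ at v a + Y)

  -- Positions may drift apart outside the window. This weaker relation survives for all identified
  -- pairs, and scores depend on nothing else.
  SameApproval : Vote m → Vote m′ → Set
  SameApproval v v′ = ∀ {a x} → R a x → (at v a < k → at v′ x < k′) × (at v′ x < k′ → at v a < k)

  -- Serves duplicate-freeness: `R` is injective, so a copied swap determines its original, and two
  -- equal copies would come from equal swaps.
  CopiedFrom : List (Swap m) → List (Swap m′) → Set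
  CopiedFrom ss ss′ = ∀ {s′} → s′ ∈ ss′ → ∃[ s ] (s ∈ ss × R (left s) (left s′) × R (right s) (right s′))

  record Simulated (ss : List (Swap m)) (w : Vote m) (v′ : Vote m′) : Set where
    field
      swaps   : List (Swap m′)
      result  : Vote m′
      path    : v′ ⟶[ swaps ] result
      cheap   : sum (map cost′ swaps) ≤ sum (map cost ss)
      copied  : CopiedFrom ss swaps
      distinct  : Unique ss → Unique swaps
      same    : SameApproval w result
      fixed   : ∀ x → (∀ a → ¬ R a x) → at result x ≡ at v′ x
  open Simulated

  -- The radius `r` bounds the cost still to come. It falls by exactly one per swap, whatever the
  -- swap costs, which is sound because every cost is at least 1.
  simulate : ∀ {ss v w} r v′ → v ⟶[ ss ] w → sum (map cost ss) ≤ r → r ≤ β →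
             Aligned r v v′ → SameApproval v v′ → Simulated ss w v′
  simulate r v′ done _ _ _ app = record
    { swaps = [] ; result = v′ ; path = done ; cheap = z≤n ; copied = λ () ; distinct = λ _ → []
    ; same = app ; fixed = λ _ _ → refl }
  simulate zero v′ (step {s = s} _ _) ≤r _ _ _ = contradiction (≤-trans (cost≥1 s) (m+n≤o⇒m≤o (cost s) ≤r)) λ ()
  simulate {s ∷ ss} {v} {w} (suc r) v′ (step adm run) ≤r r≤β win app
    with (k ≤? at v (left s) + suc r) ×-dec (at v (right s) <? k + suc r)
  -- The two candidates are adjacent and not both in the window of radius `r + 1`, so after the swap
  -- neither is in the window of radius `r`. They are also on the same side of the boundary:
  -- straddling it they would stand at `k - 1` and `k`, which every window of positive radius
  -- contains. Hence both invariants survive when the swap is dropped.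
  ... | no outside = record
    { swaps  = swaps rest ; result = result rest ; path = path rest
    ; cheap  = ≤-trans (cheap rest) (m≤n+m _ (cost s))
    ; copied = λ s′∈ → let t , t∈ , Rs = copied rest s′∈ in t , there t∈ , Rs
    ; distinct = λ { (_ ∷ u) → distinct rest u }
    ; same   = same rest ; fixed = fixed rest }
    where
    v₁ = applySwap v s
    ≤r₁ : sum (map cost ss) ≤ r
    ≤r₁ = s≤s⁻¹ (≤-trans (+-monoˡ-≤ (sum (map cost ss)) (cost≥1 s)) ≤r)
    weaken : ∀ {i} → k ≤ i + r → k ≤ i + suc r
    weaken {i} k≤ = ≤-trans k≤ (+-monoʳ-≤ i (n≤1+n r))
    weaken′ : ∀ {i} → i < k + r → i < k + suc r
    weaken′ i< = ≤-trans i< (+-monoʳ-≤ k (n≤1+n r))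
    aligned : Aligned r v₁ v′
    aligned c (lo , hi) with swapView s c
    ... | isLeft rewrite at-swap-left v s = contradiction
          (≤-trans (subst (λ i → k ≤ i + r) (sym adm) lo) (≤-reflexive (sym (+-suc _ r))) , weaken′ hi) outside
    ... | isRight rewrite at-swap-right v s = contradiction
          (weaken lo , subst (_< k + suc r) adm (≤-trans (s≤s hi) (≤-reflexive (sym (+-suc k r))))) outside
    ... | other c≢l c≢r rewrite at-swap-other v s c≢l c≢r = win c (weaken lo , weaken′ hi)
    crossing : at v (left s) < k → at v (right s) < k
    crossing l<k with at v (right s) <? k
    ... | yes r<k = r<k
    ... | no r≮k = contradiction
      ( ≤-trans (≮⇒≥ r≮k) (≤-trans (≤-reflexive (sym adm)) (≤-trans (s≤s (m≤m+n _ r)) (≤-reflexive (sym (+-suc _ r)))))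
      , ≤-trans (subst (_< suc k) adm (s≤s l<k)) (≤-trans (s≤s (m≤m+n k r)) (≤-reflexive (sym (+-suc k r)))) ) outside
    crossing′ : at v (right s) < k → at v (left s) < k
    crossing′ = <-trans (≤-reflexive adm)
    sameApproval : SameApproval v₁ v′
    sameApproval {c} Rcx with swapView s c
    ... | isLeft  rewrite at-swap-left v s  = proj₁ (app Rcx) ∘ crossing′ , crossing ∘ proj₂ (app Rcx)
    ... | isRight rewrite at-swap-right v s = proj₁ (app Rcx) ∘ crossing , crossing′ ∘ proj₂ (app Rcx)
    ... | other c≢l c≢r rewrite at-swap-other v s c≢l c≢r = app Rcx
    rest : Simulated ss w v′
    rest = simulate r v′ run ≤r₁ (≤-trans (n≤1+n r) r≤β) aligned sameApproval
  ... | yes (lo , hi)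
    with win (left s) (lo , <-trans (≤-reflexive adm) hi)
       | win (right s) (≤-trans lo (+-monoˡ-≤ (suc r) (≤-trans (n≤1+n _) (≤-reflexive adm))) , hi)
  ... | inj₁ d | _ = contradiction (dummy-cost s (inj₁ d)) (≤⇒≯ (≤-trans (m+n≤o⇒m≤o (cost s) ≤r) r≤β))
  ... | inj₂ _ | inj₁ d = contradiction (dummy-cost s (inj₂ d)) (≤⇒≯ (≤-trans (m+n≤o⇒m≤o (cost s) ≤r) r≤β))
  ... | inj₂ (x , Rx , x-at) | inj₂ (y , Ry , y-at) = record
    { swaps  = s′ ∷ swaps rest ; result = result rest ; path = step adm′ (path rest)
    ; cheap  = +-mono-≤ (cost-≤ {s} {s′} Rx Ry (≤-trans (m+n≤o⇒m≤o (cost s) ≤r) r≤β)) (cheap rest)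
    ; copied = λ { (here refl) → s , here refl , Rx , Ry
                 ; (there s′∈) → let t , t∈ , Rs = copied rest s′∈ in t , there t∈ , Rs }
    ; distinct = λ { (s∉ ∷ u) → All.tabulate (fresh s∉) ∷ distinct rest u }
    ; same   = same rest
    ; fixed  = λ z ¬R → trans (fixed rest z ¬R) (at-swap-other v′ s′
                 (λ z≡x → ¬R (left s) (subst (R (left s)) (sym z≡x) Rx))
                 (λ z≡y → ¬R (right s) (subst (R (right s)) (sym z≡y) Ry))) }
    where
    x≢y : x ≢ y
    x≢y refl = 1+n≢n (trans adm (cong (at v) (sym (R-injective Rx Ry))))
    s′ : Swap m′
    s′ = swap x y x≢y
    v₁ = applySwap v s
    v₁′ = applySwap v′ s′
    adm′ : suc (at v′ x) ≡ at v′ y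
    adm′ = +-cancelʳ-≡ X _ _ (begin
      suc (at v′ x + X)       ≡⟨ cong suc x-at ⟩
      suc (at v (left s)) + Y ≡⟨ cong (_+ Y) adm ⟩
      at v (right s) + Y      ≡⟨ y-at ⟨
      at v′ y + X             ∎)
      where open ≡-Reasoning
    ≤r₁ : sum (map cost ss) ≤ r
    ≤r₁ = s≤s⁻¹ (≤-trans (+-monoˡ-≤ (sum (map cost ss)) (cost≥1 s)) ≤r)
    other′ : ∀ {c z} → c ≢ left s → c ≢ right s → R c z → at v₁′ z ≡ at v′ z
    other′ c≢l c≢r Rcz = at-swap-other v′ s′ (λ { refl → c≢l (R-injective Rcz Rx) }) (λ { refl → c≢r (R-injective Rcz Ry) })
    aligned : Aligned r v₁ v₁′
    aligned c (clo , chi) with swapView s c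
    ... | isLeft rewrite at-swap-left v s =
          inj₂ (x , Rx , trans (cong (_+ X) (at-swap-left v′ s′)) y-at)
    ... | isRight rewrite at-swap-right v s =
          inj₂ (y , Ry , trans (cong (_+ X) (at-swap-right v′ s′)) x-at)
    ... | other c≢l c≢r rewrite at-swap-other v s c≢l c≢r
        with win c (≤-trans clo (+-monoʳ-≤ (at v c) (n≤1+n r)) , ≤-trans chi (+-monoʳ-≤ k (n≤1+n r)))
    ...   | inj₁ d = inj₁ d
    ...   | inj₂ (z , Rz , z-at) = inj₂ (z , Rz , trans (cong (_+ X) (other′ c≢l c≢r Rz)) z-at)
    sameApproval : SameApproval v₁ v₁′
    sameApproval {c} Rcz with swapView s c
    ... | isLeft rewrite at-swap-left v s | R-functional Rcz Rx | at-swap-left v′ s′ = app Ry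
    ... | isRight rewrite at-swap-right v s | R-functional Rcz Ry | at-swap-right v′ s′ = app Rx
    ... | other c≢l c≢r rewrite at-swap-other v s c≢l c≢r | other′ c≢l c≢r Rcz = app Rcz
    rest : Simulated ss w v₁′
    rest = simulate r v₁′ run ≤r₁ (≤-trans (n≤1+n r) r≤β) aligned sameApproval
    fresh : All.All (s ≢_) ss → ∀ {t′} → t′ ∈ swaps rest → s′ ≢ t′
    fresh s∉ t′∈ refl with copied rest t′∈
    ... | t , t∈ , Rl , Rr = All.lookup s∉ t∈ (swap-≡ (R-injective Rx Rl) (R-injective Ry Rr))

-- Reading the encoded cost matrix

costOf : ∀ {m} → (Swap m → ℕ) → Fin m → Fin m → ℕ
costOf γ a b with a Fin.≟ b
... | yes _  = 0
... | no a≢b = γ (swap a b a≢b)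

nth-encodeCosts : ∀ {m} (γ : Swap m → ℕ) a b → nth 0 (nth [] (encodeCosts γ) (toℕ a)) (toℕ b) ≡ costOf γ a b
nth-encodeCosts {m} γ = costs
  where
  -- The entry function of `encodeCosts` is local and cannot be named. The underscores are solved by
  -- it, and the case distinction below then evaluates it together with `costOf`.
  rowOf : ∀ a → nth [] (encodeCosts γ) (toℕ a) ≡ _
  rowOf a = nth-tabulate [] _ a
  entryOf : ∀ a b → nth 0 (nth [] (encodeCosts γ) (toℕ a)) (toℕ b) ≡ _
  entryOf a b = trans (cong (λ r → nth 0 r (toℕ b)) (rowOf a)) (nth-tabulate 0 _ b)
  costs : ∀ a b → nth 0 (nth [] (encodeCosts γ) (toℕ a)) (toℕ b) ≡ costOf γ a b
  costs a b with entryOf a b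
  ... | eq with a Fin.≟ b | eq
  ...   | yes _ | eq′ = eq′
  ...   | no _  | eq′ = eq′

encodeCosts≡ : ∀ {m} (γ : Swap m → ℕ) → encodeCosts γ ≡ tabulate λ a → tabulate λ b → costOf γ a b
encodeCosts≡ {m} γ = tabulate-cong λ a → tabulate-cong λ b →
  trans (sym (trans (cong (λ r → nth 0 r (toℕ b)) (nth-tabulate [] _ a)) (nth-tabulate 0 _ b))) (nth-encodeCosts γ a b)

costOf-swap : ∀ {m} (γ : Swap m → ℕ) s → costOf γ (left s) (right s) ≡ γ s
costOf-swap γ (swap a b a≢b) with a Fin.≟ b
... | yes a≡b = ⊥-elim-irr (a≢b a≡b)
... | no _    = refl

-- The kept candidates: choice and number

all⁻ : ∀ {X : Set} (p : X → Bool) {x xs} → T (all p xs) → x ∈ xs → T (p x)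
all⁻ p {xs = y ∷ ys} t (here refl) = proj₁ (∧⁻ {p y} t)
all⁻ p {xs = y ∷ ys} t (there x∈)  = all⁻ p (proj₂ (∧⁻ {p y} t)) x∈

all-false : ∀ {X : Set} (p : X → Bool) xs → ¬ T (all p xs) → ∃[ x ] (x ∈ xs × ¬ T (p x))
all-false p [] ¬t = contradiction _ ¬t
all-false p (x ∷ xs) ¬t with p x in eq
... | false = x , here refl , subst T eq
... | true with all-false p xs ¬t
...   | y , y∈ , ¬py = y , there y∈ , ¬py

best⊆ : ∀ f xs {d} → d ∈ best f xs → d ∈ xs
best⊆ f (x ∷ xs) d∈ with all (λ d → f d ≤ᵇ f x) (best f xs)
best⊆ f (x ∷ xs) (here refl) | true  = here refl
best⊆ f (x ∷ xs) d∈          | false = there (best⊆ f xs d∈)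

-- `best` works from the end of the list: the head either dominates everything selected so far and
-- replaces it, or is dominated by a selected entry.
best-maximal : ∀ f xs {c} → c ∈ xs → ∃[ d ] (d ∈ best f xs × f c ≤ f d)
best-maximal f (x ∷ xs) c∈ with T? (all (λ d → f d ≤ᵇ f x) (best f xs))
best-maximal f (x ∷ xs) c∈ | yes t rewrite Equivalence.to T-≡ t with c∈
... | here refl = x , here refl , ≤-refl
... | there c∈ with best-maximal f xs c∈
...   | d , d∈ , c≤d = x , here refl , ≤-trans c≤d (≤ᵇ⇒≤ _ _ (all⁻ (λ d → f d ≤ᵇ f x) t d∈))
best-maximal f (x ∷ xs) c∈ | no ¬t rewrite Equivalence.to T-not-≡ (T-not ¬t) with c∈
... | there c∈ = best-maximal f xs c∈
... | here refl with all-false (λ d → f d ≤ᵇ f x) (best f xs) ¬t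
...   | d , d∈ , d≰x = d , d∈ , ≰⇒≥ (d≰x ∘ ≤⇒≤ᵇ)

best-length : ∀ f xs → length (best f xs) ≤ 1
best-length f [] = z≤n
best-length f (x ∷ xs) with all (λ d → f d ≤ᵇ f x) (best f xs)
... | true  = ≤-refl
... | false = best-length f xs

best-unique : ∀ f xs → Unique (best f xs)
best-unique f xs with best f xs | best-length f xs
... | []        | _ = []
... | _ ∷ []    | _ = All.[] ∷ []
... | _ ∷ _ ∷ _ | s≤s ()

-- The union bound, applied with one window for each vote.
length-filterᵇ-any : ∀ {X Y : Set} (p : Y → X → Bool) (ys : List Y) xs {b} →
  (∀ {y} → y ∈ ys → length (filterᵇ (p y) xs) ≤ b) → length (filterᵇ (λ x → any (λ y → p y x) ys) xs) ≤ length ys * b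
length-filterᵇ-any p [] xs _ = ≤-reflexive (none xs)
  where
  none : ∀ {X : Set} (xs : List X) → length (filterᵇ (λ _ → false) xs) ≡ 0
  none []       = refl
  none (x ∷ xs) = none xs
length-filterᵇ-any p (y ∷ ys) xs h =
  ≤-trans (either xs) (+-mono-≤ (h (here refl)) (length-filterᵇ-any p ys xs (h ∘ there)))
  where
  q = λ x → any (λ y → p y x) ys
  either : ∀ xs → length (filterᵇ (λ x → p y x ∨ q x) xs) ≤ length (filterᵇ (p y) xs) + length (filterᵇ q xs)
  either [] = z≤n
  either (x ∷ xs) with p y x | q x
  ... | true  | true  = s≤s (≤-trans (either xs) (+-monoʳ-≤ _ (n≤1+n _)))
  ... | true  | false = s≤s (either xs)
  ... | false | true  = ≤-trans (s≤s (either xs)) (≤-reflexive (sym (+-suc _ _)))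
  ... | false | false = either xs

length-filterᵇ-∧ : ∀ {X : Set} (p q : X → Bool) xs → length (filterᵇ (λ x → p x ∧ q x) xs) ≤ length (filterᵇ q xs)
length-filterᵇ-∧ p q [] = z≤n
length-filterᵇ-∧ p q (x ∷ xs) with p x | q x
... | true  | true  = s≤s (length-filterᵇ-∧ p q xs)
... | true  | false = length-filterᵇ-∧ p q xs
... | false | true  = m≤n⇒m≤1+n (length-filterᵇ-∧ p q xs)
... | false | false = length-filterᵇ-∧ p q xs

inWindow⁺ : ∀ {k β v c} → k ≤ pos c v + β → pos c v < k + β → T (inWindow k β v c)
inWindow⁺ lo hi = ∧⁺ (≤⇒≤ᵇ lo) (<⇒<ᵇ hi)

inWindow⁻ : ∀ {k β v c} → T (inWindow k β v c) → k ≤ pos c v + β × pos c v < k + β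
inWindow⁻ {k} {β} {v} {c} t with ∧⁻ {k ≤ᵇ pos c v + β} t
... | lo , hi = ≤ᵇ⇒≤ k (pos c v + β) lo , <ᵇ⇒< (pos c v) (k + β) hi

-- Subtracting `k ∸ β` maps the positions in the window injectively into the numbers below `2 * β`.
-- If `β` exceeds `k`, the truncation only shortens the window.
window-length : ∀ k β {v cands} → Unique cands → (∀ {c} → c ∈ cands → c ∈ v) →
                length (filterᵇ (inWindow k β v) cands) ≤ 2 * β
window-length k β {v} {cands} u ⊆v = ≤-trans (≤-reflexive (sym (length-map offset (filterᵇ (inWindow k β v) cands))))
  (unique-length-≤ (map-unique offset injective (filterᵇ-unique (inWindow k β v) {cands} u)) small)
  where
  offset : ℕ → ℕ
  offset c = pos c v ∸ (k ∸ β)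
  lower : ∀ {c} → c ∈ filterᵇ (inWindow k β v) cands → k ∸ β ≤ pos c v
  lower {c} c∈ = m≤n+o⇒m∸n≤o k β (≤-trans (proj₁ (inWindow⁻ {k} {β} {v} {c} (proj₂ (∈-filterᵇ⁻ (inWindow k β v) {xs = cands} c∈)))) (≤-reflexive (+-comm _ β)))
  injective : ∀ {c d} → c ∈ filterᵇ (inWindow k β v) cands → d ∈ filterᵇ (inWindow k β v) cands → offset c ≡ offset d → c ≡ d
  injective c∈ d∈ eq = pos-injective (⊆v (proj₁ (∈-filterᵇ⁻ (inWindow k β v) {xs = cands} c∈)))
    (∸-cancelʳ-≡ (lower c∈) (lower d∈) eq)
  small : ∀ {o} → o ∈ map offset (filterᵇ (inWindow k β v) cands) → o < 2 * β
  small o∈ with ∈-map⁻ offset o∈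
  ... | c , c∈ , refl = +-cancelʳ-< (k ∸ β) _ _ (begin-strict
    pos c v ∸ (k ∸ β) + (k ∸ β)  ≡⟨ m∸n+n≡m (lower c∈) ⟩
    pos c v                      <⟨ proj₂ (inWindow⁻ {k} {β} {v} {c} (proj₂ (∈-filterᵇ⁻ (inWindow k β v) {xs = cands} c∈))) ⟩
    k + β                        ≤⟨ +-monoˡ-≤ β (m≤n+m∸n k β) ⟩
    β + (k ∸ β) + β              ≡⟨ eq β (k ∸ β) ⟩
    2 * β + (k ∸ β)              ∎)
    where
    open ≤-Reasoning
    eq : ∀ b x → b + x + b ≡ 2 * b + x
    eq = solve-∀

module Kept (k β p : ℕ) (vs : List (List ℕ)) (cands-unique : Unique (firstVote vs)) where

  others : ℕ → Bool
  others c = not (c ≡ᵇ p)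

  close far : ℕ → Bool
  close c = not (c ≡ᵇ p) ∧ relevant k β vs c
  far   c = not (c ≡ᵇ p) ∧ not (relevant k β vs c)

  opaque

    L : List ℕ
    L = kept k β p vs

    L≡kept : L ≡ kept k β p vs
    L≡kept = refl

  Q : List ℕ
  Q = best (points k vs) (filterᵇ far (firstVote vs))

  Q⊆far : ∀ {c} → c ∈ Q → c ∈ firstVote vs × T (far c)
  Q⊆far c∈ = ∈-filterᵇ⁻ far (best⊆ (points k vs) (filterᵇ far (firstVote vs)) c∈)

  ≢p : ∀ {c b} → T (not (c ≡ᵇ p) ∧ b) → p ≢ c
  ≢p {c} t refl = T-not⁻ (proj₁ (∧⁻ {not (c ≡ᵇ c)} t)) (≡⇒≡ᵇ c c refl)

  not-p : ∀ {c b} → c ≢ p → T b → T (not (c ≡ᵇ p) ∧ b)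
  not-p {c} c≢p tb = ∧⁺ (T-not (c≢p ∘ ≡ᵇ⇒≡ c p)) tb

  opaque
    unfolding L

    kept-unique : Unique L
    kept-unique = All.tabulate p∉ ∷ Unique.++⁺ (filterᵇ-unique close cands-unique) (best-unique (points k vs) (filterᵇ far (firstVote vs)))
      λ { {c} (c∈ , c∈Q) → T-not⁻ (proj₂ (∧⁻ {others c} (proj₂ (Q⊆far c∈Q))))
                                 (proj₂ (∧⁻ {others c} (proj₂ (∈-filterᵇ⁻ close {xs = firstVote vs} c∈)))) }
      where
      p∉ : ∀ {c} → c ∈ filterᵇ close (firstVote vs) ++ Q → p ≢ c
      p∉ {c} c∈ with ∈-++⁻ (filterᵇ close (firstVote vs)) c∈
      ... | inj₁ c∈ = ≢p {c} {relevant k β vs c} (proj₂ (∈-filterᵇ⁻ close {xs = firstVote vs} c∈))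
      ... | inj₂ c∈ = ≢p {c} {not (relevant k β vs c)} (proj₂ (Q⊆far c∈))

    p∈kept : p ∈ L
    p∈kept = here refl

    pos-p : pos p L ≡ 0
    pos-p = pos-≡ p (filterᵇ close (firstVote vs) ++ Q)

    kept⊆ : ∀ {c} → c ∈ L → c ≡ p ⊎ c ∈ firstVote vs
    kept⊆ (here eq) = inj₁ eq
    kept⊆ (there c∈) with ∈-++⁻ (filterᵇ close (firstVote vs)) c∈
    ... | inj₁ c∈ = inj₂ (proj₁ (∈-filterᵇ⁻ close c∈))
    ... | inj₂ c∈ = inj₂ (proj₁ (Q⊆far c∈))

    relevant⇒kept : ∀ {c} → c ∈ firstVote vs → T (relevant k β vs c) → c ∈ L
    relevant⇒kept {c} c∈ rel with c ≟ p
    ... | yes refl = here refl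
    ... | no c≢p   = there (∈-++⁺ˡ (∈-filterᵇ⁺ close c∈ (not-p {c} c≢p rel)))

    -- A candidate that is left out witnesses that there are far candidates, so `best` has chosen
    -- some `q`. As `q` is irrelevant too, the points of both are immune to a bribe within the
    -- budget, and the comparison of the original points remains valid afterwards.
    unkept : ∀ {c} → c ∈ firstVote vs → c ∉ L →
             ¬ T (relevant k β vs c) ×
             ∃[ q ] (q ∈ L × q ∈ firstVote vs × ¬ T (relevant k β vs q) × points k vs c ≤ points k vs q)
    unkept {c} c∈ c∉ = irrelevant , (case best-maximal (points k vs) (filterᵇ far (firstVote vs)) c∈far of λ
      { (q , q∈ , c≤q) → q , there (∈-++⁺ʳ (filterᵇ close (firstVote vs)) q∈) , proj₁ (Q⊆far q∈)
                       , T-not⁻ (proj₂ (∧⁻ {others q} (proj₂ (Q⊆far q∈)))) , c≤q })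
      where
      irrelevant : ¬ T (relevant k β vs c)
      irrelevant = c∉ ∘ relevant⇒kept c∈
      c∈far : c ∈ filterᵇ far (firstVote vs)
      c∈far = ∈-filterᵇ⁺ far c∈ (not-p {c} (λ { refl → c∉ (here refl) }) (T-not irrelevant))

    -- The 2 accounts for `p` and the chosen far candidate.
    kept-length : (∀ {v c} → v ∈ vs → c ∈ firstVote vs → c ∈ v) → length L ≤ 2 + length vs * (2 * β)
    kept-length ⊆v = s≤s (begin
      length (filterᵇ close (firstVote vs) ++ Q)        ≡⟨ length-++ (filterᵇ close (firstVote vs)) ⟩
      length (filterᵇ close (firstVote vs)) + length Q
        ≤⟨ +-mono-≤ (≤-trans (length-filterᵇ-∧ others (relevant k β vs) (firstVote vs))
             (length-filterᵇ-any (inWindow k β) vs (firstVote vs) λ v∈ → window-length k β cands-unique (⊆v v∈)))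
             (best-length (points k vs) (filterᵇ far (firstVote vs))) ⟩
      length vs * (2 * β) + 1                           ≡⟨ +-comm _ 1 ⟩
      1 + length vs * (2 * β)                           ∎)
      where open ≤-Reasoning

-- A single vote of the kernel

module Front {L v : List ℕ} (L-unique : Unique L) (v-unique : Unique v) (L⊆v : ∀ {c} → c ∈ L → c ∈ v) (k b : ℕ) where

  ℓ : ℕ
  ℓ = length L

  inL : ℕ → Bool
  inL c = member c L

  unapproved : ℕ → Bool
  unapproved c = k ≤ᵇ pos c v

  index mirror : ℕ → ℕ
  index c  = pos c L
  mirror c = ℓ * suc b + pos c L

  order dummies reals : List ℕ
  order   = filterᵇ inL v
  dummies = map mirror (filterᵇ unapproved order)
  reals   = map index order

  #dummies : ℕ
  #dummies = length dummies

  order⊆L : ∀ {c} → c ∈ order → c ∈ L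
  order⊆L c∈ = member⁻ (proj₂ (∈-filterᵇ⁻ inL {xs = v} c∈))

  order-unique : Unique order
  order-unique = filterᵇ-unique inL v-unique

  unapproved⊆ : ∀ {c} → c ∈ filterᵇ unapproved order → c ∈ order
  unapproved⊆ c∈ = proj₁ (∈-filterᵇ⁻ unapproved {xs = order} c∈)

  length-order : length order ≡ ℓ
  length-order = unique-length-≡ order-unique L-unique order⊆L λ c∈ → ∈-filterᵇ⁺ inL (L⊆v c∈) (member⁺ c∈)

  dummies⁻ : ∀ {x} → x ∈ dummies → ∃[ t ] (t < ℓ × x ≡ ℓ * suc b + t)
  dummies⁻ x∈ with ∈-map⁻ mirror x∈
  ... | c , c∈ , x≡ = pos c L , pos<length (order⊆L (unapproved⊆ c∈)) , x≡

  reals⁻ : ∀ {x} → x ∈ reals → x < ℓ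
  reals⁻ x∈ with ∈-map⁻ index x∈
  ... | c , c∈ , refl = pos<length (order⊆L c∈)

  reals⁺ : ∀ {c} → c ∈ L → index c ∈ reals
  reals⁺ c∈ = ∈-map⁺ index (∈-filterᵇ⁺ inL (L⊆v c∈) (member⁺ c∈))

  dummies≥ : ∀ {x} → x ∈ dummies → ℓ ≤ x
  dummies≥ x∈ with dummies⁻ x∈
  ... | t , t< , refl = ≤-trans (m≤m*n ℓ (suc b)) (m≤m+n _ t)

  front-unique : Unique (front k L b v)
  front-unique = Unique.++⁺
    (map-unique mirror (λ c∈ _ eq → pos-injective (order⊆L (unapproved⊆ c∈)) (+-cancelˡ-≡ (ℓ * suc b) _ _ eq))
                (filterᵇ-unique unapproved order-unique))
    (map-unique index (λ c∈ _ → pos-injective (order⊆L c∈)) order-unique)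
    λ { (x∈ , x∈′) → <⇒≱ (reals⁻ x∈′) (dummies≥ x∈) }

  front-bounded : ∀ {x} → x ∈ front k L b v → x < suc (suc b) * ℓ
  front-bounded x∈ with ∈-++⁻ dummies x∈
  ... | inj₂ x∈ = ≤-trans (reals⁻ x∈) (m≤m+n ℓ _)
  ... | inj₁ x∈ with dummies⁻ x∈
  ...   | t , t< , refl = ≤-trans (+-monoʳ-< (ℓ * suc b) t<)
                            (≤-reflexive (trans (+-comm (ℓ * suc b) ℓ) (cong (ℓ +_) (*-comm ℓ (suc b)))))

  -- Each kept candidate is either approved by `v` or has its dummy in this vote. So the dummies
  -- followed by the approved kept candidates fill the first `ℓ` places, and `ℓ` is the right
  -- approval number for every vote.
  #dummies+count : #dummies + count inL k v ≡ ℓ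
  #dummies+count = trans (cong (_+ count inL k v) (length-map mirror (filterᵇ unapproved order)))
    (trans (count-rest inL k v v-unique) length-order)

  pos-real : ∀ {c} rest → c ∈ L → pos (index c) (front k L b v ++ rest) ≡ #dummies + count inL (pos c v) v
  pos-real {c} rest c∈ = begin
    pos (index c) (front k L b v ++ rest)  ≡⟨ pos-++ˡ rest (∈-++⁺ʳ dummies (reals⁺ c∈)) ⟩
    pos (index c) (dummies ++ reals)       ≡⟨ pos-++ʳ dummies reals (λ x∈ → <⇒≱ (pos<length c∈) (dummies≥ x∈)) ⟩
    #dummies + pos (index c) (map index order)
      ≡⟨ cong (#dummies +_) (pos-map index order (λ d∈ → pos-injective (order⊆L d∈))) ⟩
    #dummies + pos c order                 ≡⟨ cong (#dummies +_) (pos-filter inL (L⊆v c∈) (member⁺ c∈)) ⟩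
    #dummies + count inL (pos c v) v       ∎
    where open ≡-Reasoning

  -- The front contains all `ℓ` kept candidates, hence is at least `ℓ` long, and anything behind it
  -- is not approved. So an approved name from `ℓ` on belongs to the block of this vote.
  dummy-approved : ∀ {x} rest → ℓ ≤ x → pos x (front k L b v ++ rest) < ℓ → ∃[ t ] (t < ℓ × x ≡ ℓ * suc b + t)
  dummy-approved {x} rest ℓ≤x p< with member? x dummies
  ... | yes x∈ = dummies⁻ x∈
  ... | no x∉ = contradiction p< (≤⇒≯ (begin
    ℓ                                 ≡⟨ trans (length-map index order) length-order ⟨
    length reals                      ≤⟨ m≤n+m _ #dummies ⟩
    #dummies + length reals           ≡⟨ length-++ dummies ⟨
    length (front k L b v)            ≤⟨ m≤m+n _ (pos x rest) ⟩
    length (front k L b v) + pos x rest ≡⟨ pos-++ʳ (front k L b v) rest x∉front ⟨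
    pos x (front k L b v ++ rest)     ∎))
    where
    open ≤-Reasoning
    x∉front : x ∉ front k L b v
    x∉front x∈ with ∈-++⁻ dummies x∈
    ... | inj₁ x∈ = x∉ x∈
    ... | inj₂ x∈ = <⇒≱ (reals⁻ x∈) ℓ≤x

  module _ (rest : List ℕ) where

    place : ℕ → ℕ
    place c = pos (index c) (front k L b v ++ rest)

    approved⁺ : ∀ {c} → c ∈ L → pos c v < k → place c < ℓ
    approved⁺ {c} c∈ p<k = begin-strict
      place c                            ≡⟨ pos-real rest c∈ ⟩
      #dummies + count inL (pos c v) v   <⟨ +-monoʳ-< #dummies (count-strict inL (L⊆v c∈) (member⁺ c∈) p<k) ⟩
      #dummies + count inL k v           ≡⟨ #dummies+count ⟩
      ℓ                                  ∎
      where open ≤-Reasoning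

    approved⁻ : ∀ {c} → c ∈ L → place c < ℓ → pos c v < k
    approved⁻ {c} c∈ p<ℓ with pos c v <? k
    ... | yes p<k = p<k
    ... | no p≮k = contradiction p<ℓ (≤⇒≯ (begin
      ℓ                                  ≡⟨ #dummies+count ⟨
      #dummies + count inL k v           ≤⟨ +-monoʳ-≤ #dummies (count-mono inL v (≮⇒≥ p≮k)) ⟩
      #dummies + count inL (pos c v) v   ≡⟨ pos-real rest c∈ ⟨
      place c                            ∎))
      where open ≤-Reasoning

    module _ {β} (close⇒kept : ∀ {c} → c ∈ v → k ≤ pos c v + β → pos c v < k + β → c ∈ L) where

      lo : ℕ
      lo = k ∸ β

      k≤lo+β : k ≤ lo + β
      k≤lo+β = ≤-trans (m≤n+m∸n k β) (≤-reflexive (+-comm β lo))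

      window-count : ∀ d → lo + d ≤ length v → lo + d ≤ k + β → count inL (lo + d) v ≡ count inL lo v + d
      window-count d ≤len ≤k+β = count-interval inL v-unique lo d ≤len λ c∈ lo≤ <hi →
        member⁺ (close⇒kept c∈ (≤-trans k≤lo+β (+-monoˡ-≤ β lo≤)) (≤-trans <hi ≤k+β))

      -- All candidates from position `lo` up to that of `c` are kept, so on this stretch the kernel
      -- vote is a translate of `v`. The offset is read off at `lo`, the lower end of the window.
      aligned : ∀ {c} → c ∈ L → k ≤ pos c v + β → pos c v < k + β →
                place c + lo ≡ pos c v + (#dummies + count inL lo v)
      aligned {c} c∈ ≥lo <hi = begin
        place c + lo                               ≡⟨ cong (_+ lo) (pos-real rest c∈) ⟩
        #dummies + count inL (pos c v) v + lo      ≡⟨ cong (λ i → #dummies + count inL i v + lo) lo+d ⟨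
        #dummies + count inL (lo + d) v + lo       ≡⟨ cong (λ i → #dummies + i + lo) (window-count d
             (≤-trans (≤-reflexive lo+d) (<⇒≤ (pos<length (L⊆v c∈)))) (≤-trans (≤-reflexive lo+d) (<⇒≤ <hi))) ⟩
        #dummies + (count inL lo v + d) + lo       ≡⟨ eq #dummies (count inL lo v) d lo ⟩
        lo + d + (#dummies + count inL lo v)       ≡⟨ cong (_+ (#dummies + count inL lo v)) lo+d ⟩
        pos c v + (#dummies + count inL lo v)      ∎
        where
        open ≡-Reasoning
        d = pos c v ∸ lo
        lo+d : lo + d ≡ pos c v
        lo+d = m+[n∸m]≡n (m≤n+o⇒m∸n≤o k β (≤-trans ≥lo (≤-reflexive (+-comm _ β))))
        eq : ∀ a b c d → a + (b + c) + d ≡ d + c + (a + b)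
        eq = solve-∀

      module _ (k≤ : k ≤ length v) where

        -- Deletions bring no kept candidate into the window from outside: the `β` positions on its
        -- side of the boundary are all kept and still separate it from the boundary. Before the
        -- boundary they exist because `k ≤ length v`; after it, because `c` stands behind them.
        window⁻ : ∀ {c} → c ∈ L → ℓ ≤ place c + β → place c < ℓ + β → k ≤ pos c v + β × pos c v < k + β
        window⁻ {c} c∈ ≥ℓ <ℓ = lower , upper
          where
          open ≤-Reasoning
          lower : k ≤ pos c v + β
          lower with k ≤? pos c v + β
          ... | yes ≥k = ≥k
          ... | no ≱k = contradiction ≥ℓ (<⇒≱ (begin-strict
            place c + β                                   ≡⟨ cong (_+ β) (pos-real rest c∈) ⟩
            #dummies + count inL (pos c v) v + β          ≡⟨ +-assoc #dummies _ β ⟩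
            #dummies + (count inL (pos c v) v + β)        <⟨ +-monoʳ-< #dummies (+-monoˡ-< β (count-strict inL (L⊆v c∈) (member⁺ c∈) below)) ⟩
            #dummies + (count inL lo v + β)               ≡⟨ cong (#dummies +_) (window-count β (≤-trans (≤-reflexive lo+β) k≤) (≤-trans (≤-reflexive lo+β) (m≤m+n k β))) ⟨
            #dummies + count inL (lo + β) v               ≡⟨ cong (λ i → #dummies + count inL i v) lo+β ⟩
            #dummies + count inL k v                      ≡⟨ #dummies+count ⟩
            ℓ                                             ∎))
            where
            lo+β : lo + β ≡ k
            lo+β = m∸n+n≡m (<⇒≤ (≤-<-trans (m≤n+m β _) (≰⇒> ≱k)))
            below : pos c v < lo
            below = +-cancelʳ-< β _ _ (≤-trans (≰⇒> ≱k) (≤-reflexive (sym lo+β)))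
          upper : pos c v < k + β
          upper with pos c v <? k + β
          ... | yes <k = <k
          ... | no ≮k = contradiction <ℓ (≤⇒≯ (begin
            ℓ + β                                          ≡⟨ cong (_+ β) #dummies+count ⟨
            #dummies + count inL k v + β                   ≡⟨ +-assoc #dummies _ β ⟩
            #dummies + (count inL k v + β)                 ≡⟨ cong (#dummies +_) (count-interval inL v-unique k β k+β≤ λ c∈ k≤ <k+β →
                                                                member⁺ (close⇒kept c∈ (m≤n⇒m≤n+o β k≤) <k+β)) ⟨
            #dummies + count inL (k + β) v                 ≤⟨ +-monoʳ-≤ #dummies (count-mono inL v (≮⇒≥ ≮k)) ⟩
            #dummies + count inL (pos c v) v               ≡⟨ pos-real rest c∈ ⟨
            place c                                        ∎))
            where
            k+β≤ : k + β ≤ length v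
            k+β≤ = ≤-trans (≮⇒≥ ≮k) (<⇒≤ (pos<length (L⊆v c∈)))

-- The kernel instance and its size

map-upTo≡tabulate : ∀ {X : Set} (f : ℕ → X) n → map f (upTo n) ≡ tabulate {n = n} (f ∘ toℕ)
map-upTo≡tabulate f n = trans (map-upTo f n) (go f n)
  where
  go : ∀ {X : Set} (f : ℕ → X) n → applyUpTo f n ≡ tabulate {n = n} (f ∘ toℕ)
  go f zero    = refl
  go f (suc n) = cong (f 0 ∷_) (go (f ∘ suc) n)

size-tabulate : ∀ A {n} (f : Fin n → ⟦ A ⟧) {b} → (∀ i → size A (f i) ≤ b) → size (list A) (tabulate f) ≤ suc (n * b)
size-tabulate A f f≤ = s≤s (go f f≤)
  where
  go : ∀ {n} (f : Fin n → ⟦ A ⟧) {b} → (∀ i → size A (f i) ≤ b) → Σsize A (tabulate f) ≤ n * b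
  go {zero}  f f≤ = z≤n
  go {suc n} f f≤ = +-mono-≤ (f≤ zero) (go (f ∘ suc) (f≤ ∘ suc))

size-number : ∀ {x y} → x ≤ y → size nat x ≤ suc y
size-number {x} x≤y = ≤-trans (size-nat≤ x) (s≤s x≤y)

size-encodeVote : ∀ {m} (v : Vote m) → size (list nat) (encodeVote v) ≤ suc (m * suc m)
size-encodeVote v = size-tabulate nat (λ j → toℕ (v ⟨$⟩ˡ j)) λ j → size-number (<⇒≤ (Fin.toℕ<n (v ⟨$⟩ˡ j)))

size-encodeCosts : ∀ {m} (γ : Swap m → ℕ) {B} → (∀ s → γ s ≤ B) →
                   size (list (list nat)) (encodeCosts γ) ≤ suc (m * suc (m * suc B))
size-encodeCosts {m} γ {B} γ≤ = ≤-trans (≤-reflexive (cong (size (list (list nat))) (encodeCosts≡ γ)))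
  (size-tabulate (list nat) (λ a → tabulate (costOf γ a)) λ a → size-tabulate nat (costOf γ a) (entry≤ a))
  where
  entry≤ : ∀ a b → size nat (costOf γ a b) ≤ suc B
  entry≤ a b with a Fin.≟ b
  ... | yes _  = s≤s z≤n
  ... | no a≢b = size-number (γ≤ (swap a b a≢b))

kernelCost≤ : ∀ β L C x y → kernelCost β L C x y ≤ suc β
kernelCost≤ β L C x y with (x <ᵇ length L) ∧ (y <ᵇ length L)
... | true  = s≤s (m∸n≤m β (β ∸ (nth 0 (nth [] C (nth 0 L x)) (nth 0 L y) ∸ 1)))
... | false = ≤-refl

firstVote-unique : ∀ {m n} (V : Fin n → Vote m) → Unique (firstVote (tabulate (encodeVote ∘ V)))
firstVote-unique {n = zero}  V = []
firstVote-unique {n = suc n} V = unique (encodeVote-ranking (V zero))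

firstVote-bounded : ∀ {m n} (V : Fin n → Vote m) {c} → c ∈ firstVote (tabulate (encodeVote ∘ V)) → c < m
firstVote-bounded {n = suc n} V = bounded (encodeVote-ranking (V zero))

firstVote-complete : ∀ {m n} (V : Fin n → Vote m) → Fin n → ∀ {c} → c < m → c ∈ firstVote (tabulate (encodeVote ∘ V))
firstVote-complete {n = suc n} V _ = complete (encodeVote-ranking (V zero))

module Kernel (I : Instance) where

  m n k p β : ℕ
  m = #candidates I
  n = #votes I
  k = approval I
  p = toℕ (preferred I)
  β = budget I

  V : Fin n → Vote m
  V = votes I

  C : Fin n → List (List ℕ)
  C i = encodeCosts (cost I i)

  v : Fin n → List ℕ
  v i = encodeVote (V i)

  vs : List (List ℕ)
  vs = tabulate v

  open Kept k β p vs (firstVote-unique V) public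

  ℓ : ℕ
  ℓ = length L

  -- One block of `ℓ` names for the kept candidates and, for each vote, one block with a possible
  -- dummy for each of them.
  m′ : ℕ
  m′ = suc n * ℓ

  -- The number that `label` assigns to row `i`; it selects the block of dummies of this vote.
  b : Fin n → ℕ
  b i = n ∸ suc (toℕ i)

  kept-bounded : ∀ {c} → c ∈ L → c < m
  kept-bounded c∈ with kept⊆ c∈
  ... | inj₁ refl = Fin.toℕ<n (preferred I)
  ... | inj₂ c∈   = firstVote-bounded V c∈

  kept⊆v : ∀ i {c} → c ∈ L → c ∈ v i
  kept⊆v i c∈ = complete (encodeVote-ranking (V i)) (kept-bounded c∈)

  module Front′ i = Front kept-unique (unique (encodeVote-ranking (V i))) (kept⊆v i) k (b i)

  ranking : ∀ i → IsRanking m′ (extend (upTo m′) (front k L (b i) (v i)))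
  ranking i = extend-ranking (Front′.front-unique i) λ x∈ →
    ≤-trans (Front′.front-bounded i x∈) (*-monoˡ-≤ ℓ {suc (suc (b i))} {suc n} (s≤s (∸-monoʳ-< {n} z<s (Fin.toℕ<n i))))

  opaque

    kernelVote : ∀ (i : Fin n) → Vote m′
    kernelVote i = vote (ranking i)

    kernelVote-at : ∀ (i : Fin n) x → toℕ (kernelVote i ⟨$⟩ʳ x) ≡ pos (toℕ x) (extend (upTo m′) (front k L (b i) (v i)))
    kernelVote-at i = vote-at (ranking i)

    encode-kernelVote : ∀ (i : Fin n) → encodeVote (kernelVote i) ≡ extend (upTo m′) (front k L (b i) (v i))
    encode-kernelVote i = encodeVote-vote (ranking i)

    swapCost : ∀ (i : Fin n) → Swap m′ → ℕ
    swapCost i s = kernelCost β L (C i) (toℕ (left s)) (toℕ (right s))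

    swapCost≡ : ∀ (i : Fin n) s → swapCost i s ≡ kernelCost β L (C i) (toℕ (left s)) (toℕ (right s))
    swapCost≡ i s = refl

    swapCost≥1 : ∀ (i : Fin n) s → 1 ≤ swapCost i s
    swapCost≥1 i s = s≤s z≤n

    first : Fin m′
    first = fromℕ< (≤-trans (pos<length p∈kept) (m≤m+n ℓ (n * ℓ)))

    toℕ-first : toℕ first ≡ 0
    toℕ-first = trans (Fin.toℕ-fromℕ< _) pos-p

    k′ : ℕ
    k′ = if (0 <ᵇ k) ∧ (k <ᵇ m) then ℓ else 0

    k′≡ : k′ ≡ (if (0 <ᵇ k) ∧ (k <ᵇ m) then ℓ else 0)
    k′≡ = refl

  kernel : Instance
  kernel = record
    { #candidates = m′
    ; #votes      = n
    ; votes       = kernelVote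
    ; approval    = k′
    ; preferred   = first
    ; cost        = swapCost
    ; cost≥1      = swapCost≥1
    ; budget      = β }

  -- This carries the running time of the function on codes over to the instance about which
  -- correctness is proved.
  encode-kernel : encodeInstance kernel ≡ kernelCode (encodeInstance I)
  encode-kernel = trans encode≡ (cong code (trans L≡kept (cong (kept k β p) (sym (map-tabulate rows proj₁)))))
    where
    rows : Fin n → List ℕ × List (List ℕ)
    rows i = v i , C i
    code : List ℕ → ⟦ instanceTy ⟧
    code L = length (copies L (tabulate rows)) , (if (0 <ᵇ k) ∧ (k <ᵇ m) then length L else 0) , 0 , β ,
             kernelRows k β L (indices (copies L (tabulate rows))) (tabulate rows)
    m′≡ : m′ ≡ length (copies L (tabulate rows))
    m′≡ = sym (trans (length-copies L (tabulate rows)) (cong (λ j → suc j * ℓ) (length-tabulate rows)))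
    costs≡ : ∀ i → encodeCosts (cost kernel i) ≡ kernelCosts β L (C i) (upTo m′)
    costs≡ i = begin
      encodeCosts (cost kernel i)
        ≡⟨ encodeCosts≡ (cost kernel i) ⟩
      (tabulate λ x → tabulate λ y → costOf (cost kernel i) x y)
        ≡⟨ (tabulate-cong λ x → tabulate-cong λ y → entry≡ x y) ⟩
      (tabulate λ (x : Fin m′) → tabulate λ (y : Fin m′) → entry (toℕ x) (toℕ y))
        ≡⟨ (tabulate-cong λ x → sym (map-upTo≡tabulate (entry (toℕ x)) m′)) ⟩
      (tabulate λ (x : Fin m′) → map (entry (toℕ x)) (upTo m′))
        ≡⟨ map-upTo≡tabulate (λ x → map (entry x) (upTo m′)) m′ ⟨
      kernelCosts β L (C i) (upTo m′) ∎
      where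
      open ≡-Reasoning
      entry : ℕ → ℕ → ℕ
      entry x y = if x ≡ᵇ y then 0 else kernelCost β L (C i) x y
      entry≡ : ∀ x y → costOf (cost kernel i) x y ≡ entry (toℕ x) (toℕ y)
      entry≡ x y with x Fin.≟ y
      ... | yes refl rewrite Equivalence.to T-≡ (≡⇒≡ᵇ (toℕ x) (toℕ x) refl) = refl
      ... | no x≢y with toℕ x ≡ᵇ toℕ y in eq
      ...   | true  = contradiction (Fin.toℕ-injective (≡ᵇ⇒≡ (toℕ x) (toℕ y) (Equivalence.from T-≡ eq))) x≢y
      ...   | false = swapCost≡ i (swap x y x≢y)
    rows≡ : tabulate (λ i → encodeVote (votes kernel i) , encodeCosts (cost kernel i)) ≡
            kernelRows k β L (indices (copies L (tabulate rows))) (tabulate rows)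
    rows≡ = begin
      tabulate (λ i → encodeVote (votes kernel i) , encodeCosts (cost kernel i))
        ≡⟨ tabulate-cong (λ i → cong₂ _,_ (encode-kernelVote i) (costs≡ i)) ⟩
      tabulate (λ i → extend (upTo m′) (front k L (b i) (v i)) , kernelCosts β L (C i) (upTo m′))
        ≡⟨ map-tabulate (λ i → b i , rows i) _ ⟨
      map _ (tabulate (λ i → b i , rows i))
        ≡⟨ cong (map _) (label-tabulate rows) ⟨
      kernelRows k β L (upTo m′) (tabulate rows)
        ≡⟨ cong (λ ids → kernelRows k β L ids (tabulate rows)) (trans (indices≡upTo (copies L (tabulate rows))) (cong upTo (sym m′≡))) ⟨
      kernelRows k β L (indices (copies L (tabulate rows))) (tabulate rows) ∎
      where open ≡-Reasoning
    encode≡ : encodeInstance kernel ≡ code L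
    encode≡ = cong₂ _,_ m′≡ (cong₂ _,_ k′≡ (cong₂ _,_ toℕ-first (cong (β ,_) rows≡)))

  ℓ≤ : ℓ ≤ 2 + n * (2 * β)
  ℓ≤ = ≤-trans (kept-length λ v∈ c∈ → let i , v≡ = ∈-tabulate⁻ v∈ in
                  subst (_ ∈_) (sym v≡) (complete (encodeVote-ranking (V i)) (firstVote-bounded V c∈)))
               (≤-reflexive (cong (λ j → 2 + j * (2 * β)) (length-tabulate v)))

candidateBound : ℕ → ℕ → ℕ
candidateBound n β = suc n * (2 + n * (2 * β))

-- Follows the recursion of `size`, with every number bounded by its unary length. The entries of
-- the cost matrix are at most `β + 1`, whence `suc (suc β)`.
rowBound : ℕ → ℕ → ℕ
rowBound M β = suc (suc (M * suc M) + suc (M * suc (M * suc (suc β))))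

kernelBound : ℕ × ℕ → ℕ
kernelBound (n , β) =
  suc (suc (suc M + suc (suc M + suc (1 + suc (suc β + suc (n * rowBound M β))))) + suc (suc n + suc β))
  where M = candidateBound n β

kernelBoundₚ : PT (nat ⊗ nat) nat kernelBound
kernelBoundₚ = sucₚ (sucₚ (sucₚ M +ₚ sucₚ (sucₚ M +ₚ sucₚ (lit 1 +ₚ sucₚ (sucₚ Β +ₚ sucₚ (N *ₚ
    sucₚ (sucₚ (M *ₚ sucₚ M) +ₚ sucₚ (M *ₚ sucₚ (M *ₚ sucₚ (sucₚ Β))))))))) +ₚ sucₚ (sucₚ N +ₚ sucₚ Β))
  where
  N = topₚ {nat} {nat}
  Β = popₚ {nat} {nat}
  M = sucₚ N *ₚ (lit 2 +ₚ N *ₚ (lit 2 *ₚ Β))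

kernel-size : ∀ I → size (instanceTy ⊗ nat ⊗ nat) (encodeInstance (Kernel.kernel I) , #votes I , budget I) ≤
                    kernelBound (#votes I , budget I)
kernel-size I = s≤s (+-mono-≤
  (s≤s (+-mono-≤ (size-number m′≤M) (s≤s (+-mono-≤ (size-number k′≤M) (s≤s (+-mono-≤ (size-number (≤-reflexive toℕ-first))
    (s≤s (+-mono-≤ (size-nat≤ β) (size-tabulate row
      (λ i → encodeVote (votes kernel i) , encodeCosts (cost kernel i)) row≤)))))))))
  (s≤s (+-mono-≤ (size-nat≤ n) (size-nat≤ β))))
  where
  open Kernel I
  M = candidateBound n β
  m′≤M : m′ ≤ M
  m′≤M = *-monoʳ-≤ (suc n) ℓ≤
  k′≤M : approval kernel ≤ M
  k′≤M = ≤-trans (≤-reflexive k′≡) (k′≤M′ _)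
    where
    k′≤M′ : ∀ x → (if x then ℓ else 0) ≤ M
    k′≤M′ true  = ≤-trans (m≤m+n ℓ (n * ℓ)) m′≤M
    k′≤M′ false = z≤n
  row≤ : ∀ i → size row (encodeVote (votes kernel i) , encodeCosts (cost kernel i)) ≤ rowBound M β
  row≤ i = s≤s (+-mono-≤
    (≤-trans (size-encodeVote (votes kernel i)) (s≤s (*-mono-≤ m′≤M (s≤s m′≤M))))
    (≤-trans (size-encodeCosts (cost kernel i) (λ s → ≤-trans (≤-reflexive (swapCost≡ i s)) (kernelCost≤ β L (C i) (toℕ (left s)) (toℕ (right s))))) (s≤s (*-mono-≤ m′≤M (s≤s (*-monoˡ-≤ (suc (suc β)) m′≤M))))))

votes≤ : ∀ {n β} → 1 ≤ n → 1 ≤ β → n ≤ 8 * (n ^ 2 * β)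
votes≤ {n} {β} 1≤n 1≤β = begin
  n                  ≡⟨ *-identityʳ n ⟨
  n * 1              ≤⟨ *-monoʳ-≤ n (*-mono-≤ 1≤n (≤-refl {1})) ⟩
  n ^ 2              ≡⟨ *-identityʳ (n ^ 2) ⟨
  n ^ 2 * 1          ≤⟨ *-monoʳ-≤ (n ^ 2) 1≤β ⟩
  n ^ 2 * β          ≤⟨ m≤n*m (n ^ 2 * β) 8 ⟩
  8 * (n ^ 2 * β)    ∎
  where open ≤-Reasoning

-- Origin of the constant: for positive `n` and `β`, `n + 1` is at most `2 * n` and `2 + 2 * n * β`
-- at most `4 * n * β`. The product is still linear in `β`; the last step weakens it to the square.
candidates≤ : ∀ {n β} → 1 ≤ n → 1 ≤ β → candidateBound n β ≤ 8 * (n ^ 2 * β ^ 2)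
candidates≤ {n} {β} 1≤n 1≤β = begin
  suc n * (2 + n * (2 * β))                          ≤⟨ *-mono-≤ (+-monoˡ-≤ n 1≤n) (+-monoˡ-≤ (n * (2 * β)) (*-monoʳ-≤ 2 (*-mono-≤ 1≤n 1≤β))) ⟩
  (n + n) * (2 * (n * β) + n * (2 * β))              ≡⟨ eq n β ⟩
  8 * (n ^ 2 * (β * 1))                              ≤⟨ *-monoʳ-≤ 8 (*-monoʳ-≤ (n ^ 2) (*-monoʳ-≤ β (*-mono-≤ 1≤β (≤-refl {1})))) ⟩
  8 * (n ^ 2 * β ^ 2)                                ∎
  where
  open ≤-Reasoning
  eq : ∀ n β → (n + n) * (2 * (n * β) + n * (2 * β)) ≡ 8 * (n * (n * 1) * (β * 1))
  eq = solve-∀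

-- Scores, and the passage from one vote to all votes

sum-tabulate-mono : ∀ {n} {f g : Fin n → ℕ} → (∀ i → f i ≤ g i) → sum (tabulate f) ≤ sum (tabulate g)
sum-tabulate-mono {zero}  f≤g = z≤n
sum-tabulate-mono {suc n} f≤g = +-mono-≤ (f≤g zero) (sum-tabulate-mono (f≤g ∘ suc))

term≤sum : ∀ {n} (f : Fin n → ℕ) i → f i ≤ sum (tabulate f)
term≤sum f zero    = m≤m+n _ _
term≤sum f (suc i) = ≤-trans (term≤sum (f ∘ suc) i) (m≤n+m _ (f zero))

indicator : ∀ {P : Set} → Dec P → ℕ
indicator P? = if does P? then 1 else 0

indicator-mono : ∀ {P Q : Set} (P? : Dec P) (Q? : Dec Q) → (P → Q) → indicator P? ≤ indicator Q?
indicator-mono (no _)  Q?      f = z≤n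
indicator-mono (yes p) (yes _) f = ≤-refl
indicator-mono (yes p) (no ¬q) f = contradiction (f p) ¬q

indicators≡0 : ∀ {n} {P : Fin n → Set} (P? : ∀ i → Dec (P i)) → (∀ i → ¬ P i) → sum (tabulate (indicator ∘ P?)) ≡ 0
indicators≡0 {zero}  P? ¬P = refl
indicators≡0 {suc n} P? ¬P with P? zero
... | yes p = contradiction p (¬P zero)
... | no _  = indicators≡0 (P? ∘ suc) (¬P ∘ suc)

indicators≤1 : ∀ {n} {P : Fin n → Set} (P? : ∀ i → Dec (P i)) → (∀ i j → P i → P j → i ≡ j) →
               sum (tabulate (indicator ∘ P?)) ≤ 1
indicators≤1 {zero}  P? same = z≤n
indicators≤1 {suc n} P? same with P? zero
... | yes p = s≤s (≤-reflexive (indicators≡0 (P? ∘ suc) λ i q → case same zero (suc i) p q of λ ()))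
... | no _  = indicators≤1 (P? ∘ suc) λ i j p q → Fin.suc-injective (same (suc i) (suc j) p q)

score-mono : ∀ {n m m′} k k′ (V : Fin n → Vote m) (V′ : Fin n → Vote m′) {c c′} →
             (∀ i → at (V i) c < k → at (V′ i) c′ < k′) → score k V c ≤ score k′ V′ c′
score-mono k k′ V V′ {c} {c′} h = sum-tabulate-mono λ i → indicator-mono (rank c (V i) ≤? k) (rank c′ (V′ i) ≤? k′) (h i)

-- The candidate on top of vote `i` is approved. A winner therefore has a point, which is all that a
-- dummy can have.
someApproved : ∀ {n m k} (W : Fin n → Vote m) → Fin m → 1 ≤ k → Fin n → ∃[ c ] 1 ≤ score k W c
someApproved {m = m} {k} W p 1≤k i = c , ≤-trans (one (rank c (W i) ≤? k)) (term≤sum (λ j → indicator (rank c (W j) ≤? k)) i)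
  where
  first : ∀ {m} → Fin m → Fin m
  first zero    = zero
  first (suc _) = zero
  first≡0 : ∀ {m} (c : Fin m) → toℕ (first c) ≡ 0
  first≡0 zero    = refl
  first≡0 (suc _) = refl
  c = W i ⟨$⟩ˡ first p
  one : (P? : Dec (rank c (W i) ≤ k)) → 1 ≤ indicator P?
  one (yes _) = ≤-refl
  one (no ≰k) = contradiction (subst (λ j → suc (toℕ j) ≤ k) (sym (inverseʳ (W i)))
    (≤-trans (s≤s (≤-reflexive (first≡0 p))) 1≤k)) ≰k

points≡score : ∀ {n m} k (V : Fin n → Vote m) c → points k (tabulate (encodeVote ∘ V)) (toℕ c) ≡ score k V c
points≡score k V c = cong sum (trans (map-tabulate (encodeVote ∘ V) (λ v → bit (pos (toℕ c) v <ᵇ k)))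
  (tabulate-cong λ i → cong (λ j → bit (j <ᵇ k)) (pos-encodeVote (V i) c)))

unique-resp-↭ : ∀ {X : Set} {xs ys : List X} → xs ↭ ys → Unique xs → Unique ys
unique-resp-↭ {X} xs↭ys = ↭ₛ.Unique-resp-↭ (setoid X) (↭⇒↭ₛ xs↭ys)

Response : ∀ {m m′} → (Swap m → ℕ) → (Swap m′ → ℕ) → (Vote m → Vote m′ → Set) →
           Vote m′ → List (Swap m) → Vote m → Set
Response γ γ′ P v′ ss w = ∃₂ λ ss′ w′ →
  v′ ⟶[ ss′ ] w′ × sum (map γ′ ss′) ≤ sum (map γ ss) × (Unique ss → Unique ss′) × P w w′

Transferred : ∀ {n m m′} → (Fin n → Vote m′) → (Fin n → Swap m′ → ℕ) → ℕ →
              (Fin n → Vote m → Vote m′ → Set) → (Fin n → Vote m) → Set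
Transferred {n} {m′ = m′} V′ γ′ β P W =
  Σ[ Γ′ ∈ (Fin n → List (Swap m′)) ] Σ[ W′ ∈ (Fin n → Vote m′) ]
  (∀ i → ResultOf (V′ i) (Γ′ i) (W′ i)) ×
  sum (tabulate λ i → sum (map (γ′ i) (Γ′ i))) ≤ β × (∀ i → P i (W i) (W′ i))

-- No vote uses more than the whole budget, so the votes can be treated separately with budget `β`
-- each; the total stays within `β` because every part becomes no more expensive. The given set may
-- be applied in another order, but its cost is invariant under permutation. The new set is listed
-- in its order of application.
transfer : ∀ {n m m′} {V : Fin n → Vote m} {V′ : Fin n → Vote m′}
  (γ : Fin n → Swap m → ℕ) (γ′ : Fin n → Swap m′ → ℕ) {β} (P : Fin n → Vote m → Vote m′ → Set) →
  (∀ i {ss w} → V i ⟶[ ss ] w → sum (map (γ i) ss) ≤ β → Response (γ i) (γ′ i) (P i) (V′ i) ss w) →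
  (Γ : Fin n → List (Swap m)) (W : Fin n → Vote m) → (∀ i → ResultOf (V i) (Γ i) (W i)) →
  sum (tabulate λ i → sum (map (γ i) (Γ i))) ≤ β →
  Transferred V′ γ′ β P W
transfer {n} {V = V} {V′} γ γ′ {β} P respond Γ W results ≤β =
  Γ′ , (λ i → proj₁ (proj₂ (response i))) ,
  (λ i → unique′ i , Γ′ i , ↭-refl , proj₁ (proj₂ (proj₂ (response i)))) ,
  ≤-trans (sum-tabulate-mono cheap) ≤β ,
  (λ i → proj₂ (proj₂ (proj₂ (proj₂ (proj₂ (response i))))))
  where
  ss : ∀ i → List (Swap _)
  ss i = proj₁ (proj₂ (results i))
  same-cost : ∀ i → sum (map (γ i) (ss i)) ≡ sum (map (γ i) (Γ i))
  same-cost i = sum-↭ (map⁺ (γ i) (proj₁ (proj₂ (proj₂ (results i)))))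
  response : ∀ i → Response (γ i) (γ′ i) (P i) (V′ i) (ss i) (W i)
  response i = respond i (proj₂ (proj₂ (proj₂ (results i))))
    (≤-trans (≤-reflexive (same-cost i)) (≤-trans (term≤sum (λ j → sum (map (γ j) (Γ j))) i) ≤β))
  Γ′ : ∀ i → List (Swap _)
  Γ′ i = proj₁ (response i)
  cheap : ∀ i → sum (map (γ′ i) (Γ′ i)) ≤ sum (map (γ i) (Γ i))
  cheap i = ≤-trans (proj₁ (proj₂ (proj₂ (proj₂ (response i))))) (≤-reflexive (same-cost i))
  unique′ : ∀ i → Unique (Γ′ i)
  unique′ i = proj₁ (proj₂ (proj₂ (proj₂ (proj₂ (response i)))))
    (unique-resp-↭ (↭-sym (proj₁ (proj₂ (proj₂ (results i))))) (proj₁ (results i)))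

bribable-already : ∀ I → Winner (approval I) (votes I) (preferred I) → Bribable I
bribable-already I win = (λ _ → []) , votes I , (λ i → [] , [] , ↭-refl , done) ,
  ≤-trans (≤-reflexive (zeros (#votes I))) z≤n , win
  where
  zeros : ∀ n → sum (tabulate {n = n} λ _ → 0) ≡ 0
  zeros zero    = refl
  zeros (suc n) = zeros n

-- Equivalence of an instance and its kernel

block-< : ∀ {ℓ b b′ t t′} → t < ℓ → b < b′ → ℓ * suc b + t < ℓ * suc b′ + t′
block-< {ℓ} {b} {b′} {t} {t′} t< b< = begin-strict
  ℓ * suc b + t     <⟨ +-monoʳ-< (ℓ * suc b) t< ⟩
  ℓ * suc b + ℓ     ≡⟨ +-comm (ℓ * suc b) ℓ ⟩
  ℓ + ℓ * suc b     ≡⟨ *-suc ℓ (suc b) ⟨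
  ℓ * suc (suc b)   ≤⟨ *-monoʳ-≤ ℓ (s≤s b<) ⟩
  ℓ * suc b′        ≤⟨ m≤m+n _ t′ ⟩
  ℓ * suc b′ + t′   ∎
  where open ≤-Reasoning

block-unique : ∀ {ℓ b b′ t t′} → t < ℓ → t′ < ℓ → ℓ * suc b + t ≡ ℓ * suc b′ + t′ → b ≡ b′
block-unique {ℓ} {b} {b′} t< t′< eq with <-cmp b b′
... | tri≈ _ b≡b′ _ = b≡b′
... | tri< b<b′ _ _ = contradiction eq (<⇒≢ (block-< t< b<b′))
... | tri> _ _ b>b′ = contradiction (sym eq) (<⇒≢ (block-< t′< b>b′))

kernelCost-dummy : ∀ β L C x y → length L ≤ x ⊎ length L ≤ y → β < kernelCost β L C x y
kernelCost-dummy β L C x y d with x <ᵇ length L in x< | y <ᵇ length L in y<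
... | true  | true  = contradiction d λ
      { (inj₁ x≥) → <⇒≱ (<ᵇ⇒< x (length L) (Equivalence.from T-≡ x<)) x≥
      ; (inj₂ y≥) → <⇒≱ (<ᵇ⇒< y (length L) (Equivalence.from T-≡ y<)) y≥ }
... | true  | false = ≤-refl
... | false | _     = ≤-refl

kernelCost-kept : ∀ β L C {a b} → a ∈ L → b ∈ L →
                  kernelCost β L C (pos a L) (pos b L) ≡ suc (β ∸ (β ∸ (nth 0 (nth [] C a) b ∸ 1)))
kernelCost-kept β L C {a} {b} a∈ b∈
  rewrite Equivalence.to T-≡ (<⇒<ᵇ (pos<length a∈)) | Equivalence.to T-≡ (<⇒<ᵇ (pos<length b∈))
        | nth-pos {0} a∈ | nth-pos {0} b∈ = refl

-- For positive `c` the term is the minimum of `c` and `β + 1`: affordable costs are unchanged, and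
-- unaffordable ones stay unaffordable.
truncated≤ : ∀ {β c} → 1 ≤ c → c ≤ β → suc (β ∸ (β ∸ (c ∸ 1))) ≤ c
truncated≤ {β} {suc c} _ c<β = s≤s (≤-reflexive (m∸[m∸n]≡n (<⇒≤ c<β)))

≤truncated : ∀ {β c} → suc (β ∸ (β ∸ (c ∸ 1))) ≤ β → c ≤ suc (β ∸ (β ∸ (c ∸ 1)))
≤truncated {β} {zero}  _ = z≤n
≤truncated {β} {suc c} t≤β with c ≤? β
... | yes c≤β = s≤s (≤-reflexive (sym (m∸[m∸n]≡n c≤β)))
... | no c≰β  = contradiction (subst (λ z → suc (β ∸ z) ≤ β) (m≤n⇒m∸n≡0 (<⇒≤ (≰⇒> c≰β))) t≤β) (<-irrefl refl)

module Correct (I : Instance) (1≤k : 1 ≤ approval I) (k<m : approval I < #candidates I) where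

  open Kernel I

  W′ = votes kernel

  R : Fin m → Fin m′ → Set
  R a x = toℕ a ∈ L × pos (toℕ a) L ≡ toℕ x

  R-functional : ∀ {a x y} → R a x → R a y → x ≡ y
  R-functional (_ , ax) (_ , ay) = Fin.toℕ-injective (trans (sym ax) ay)

  R-injective : ∀ {a b x} → R a x → R b x → a ≡ b
  R-injective (a∈ , ax) (_ , bx) = Fin.toℕ-injective (pos-injective a∈ (trans ax (sym bx)))

  R-index : ∀ {x : Fin m′} → toℕ x < ℓ → ∃[ a ] R a x
  R-index {x} x<ℓ = fromℕ< (kept-bounded a∈) , subst (_∈ L) (sym a≡) a∈ ,
    trans (cong (λ c → pos c L) a≡) (pos-nth kept-unique x<ℓ)
    where
    a∈ : nth 0 L (toℕ x) ∈ L
    a∈ = nth∈ 0 L x<ℓ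
    a≡ = Fin.toℕ-fromℕ< (kept-bounded a∈)

  R-kept : ∀ {a} → toℕ a ∈ L → ∃[ x ] R a x
  R-kept a∈ = fromℕ< (≤-trans (pos<length a∈) (m≤m+n ℓ (n * ℓ))) , a∈ , sym (Fin.toℕ-fromℕ< _)

  index<ℓ : ∀ {a x} → R a x → toℕ x < ℓ
  index<ℓ (a∈ , ax) = subst (_< ℓ) ax (pos<length a∈)

  preferred-R : R (preferred I) (preferred kernel)
  preferred-R = p∈kept , trans pos-p (sym toℕ-first)

  cost-kept : ∀ i {s s′} → R (left s) (left s′) → R (right s) (right s′) →
              cost kernel i s′ ≡ suc (β ∸ (β ∸ (cost I i s ∸ 1)))
  cost-kept i {s} {s′} (l∈ , l≡) (r∈ , r≡) = begin
    swapCost i s′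
      ≡⟨ swapCost≡ i s′ ⟩
    kernelCost β L (C i) (toℕ (left s′)) (toℕ (right s′))
      ≡⟨ cong₂ (kernelCost β L (C i)) l≡ r≡ ⟨
    kernelCost β L (C i) (pos (toℕ (left s)) L) (pos (toℕ (right s)) L)
      ≡⟨ kernelCost-kept β L (C i) l∈ r∈ ⟩
    suc (β ∸ (β ∸ (nth 0 (nth [] (C i) (toℕ (left s))) (toℕ (right s)) ∸ 1)))
      ≡⟨ cong (λ c → suc (β ∸ (β ∸ (c ∸ 1)))) (trans (nth-encodeCosts (cost I i) (left s) (right s)) (costOf-swap (cost I i) s)) ⟩
    suc (β ∸ (β ∸ (cost I i s ∸ 1))) ∎
    where open ≡-Reasoning

  module _ (i : Fin n) where

    open Front′ i using (#dummies; inL)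

    rest : List ℕ
    rest = filterᵇ (λ x → not (member x (front k L (b i) (v i)))) (upTo m′)

    place : ℕ → ℕ
    place = Front′.place i rest

    at-V : ∀ a → pos (toℕ a) (v i) ≡ at (V i) a
    at-V = pos-encodeVote (V i)

    at-W′ : ∀ {a x} → R a x → place (toℕ a) ≡ at (W′ i) x
    at-W′ {a} {x} (_ , ax) = trans (cong (λ y → pos y (front k L (b i) (v i) ++ rest)) ax) (sym (kernelVote-at i x))

    approval⇔ : ∀ {a x} → R a x → (at (V i) a < k → at (W′ i) x < ℓ) × (at (W′ i) x < ℓ → at (V i) a < k)
    approval⇔ {a} Rax =
      (λ <k → subst (_< ℓ) (at-W′ Rax) (Front′.approved⁺ i rest (proj₁ Rax) (subst (_< k) (sym (at-V a)) <k))) ,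
      (λ <ℓ → subst (_< k) (at-V a) (Front′.approved⁻ i rest (proj₁ Rax) (subst (_< ℓ) (sym (at-W′ Rax)) <ℓ)))

    window⇒relevant : ∀ {c} → k ≤ pos c (v i) + β → pos c (v i) < k + β → T (relevant k β vs c)
    window⇒relevant {c} lo hi = any⁺ (λ u → inWindow k β u c) (∈-tabulate⁺ i) (inWindow⁺ {k} {β} {v i} {c} lo hi)

    close⇒kept : ∀ {c} → c ∈ v i → k ≤ pos c (v i) + β → pos c (v i) < k + β → c ∈ L
    close⇒kept c∈ lo hi = relevant⇒kept (firstVote-complete V i (bounded (encodeVote-ranking (V i)) c∈))
      (window⇒relevant lo hi)

    X Y : ℕ
    X = k ∸ β
    Y = #dummies + count inL X (v i)

    aligned : ∀ {a x} → R a x → k ≤ at (V i) a + β → at (V i) a < k + β → at (W′ i) x + X ≡ at (V i) a + Y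
    aligned {a} Rax lo hi = begin
      at (W′ i) _ + X            ≡⟨ cong (_+ X) (at-W′ Rax) ⟨
      place (toℕ a) + X          ≡⟨ Front′.aligned i rest close⇒kept (proj₁ Rax)
                                      (subst (λ j → k ≤ j + β) (sym (at-V a)) lo) (subst (_< k + β) (sym (at-V a)) hi) ⟩
      pos (toℕ a) (v i) + Y      ≡⟨ cong (_+ Y) (at-V a) ⟩
      at (V i) a + Y             ∎
      where open ≡-Reasoning

    window⁻ : ∀ {a x} → R a x → ℓ ≤ at (W′ i) x + β → at (W′ i) x < ℓ + β → k ≤ at (V i) a + β × at (V i) a < k + β
    window⁻ {a} Rax lo hi with Front′.window⁻ i rest close⇒kept
        (≤-trans (<⇒≤ k<m) (≤-reflexive (sym (length≡ (encodeVote-ranking (V i))))))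
        (proj₁ Rax) (subst (λ j → ℓ ≤ j + β) (sym (at-W′ Rax)) lo) (subst (_< ℓ + β) (sym (at-W′ Rax)) hi)
    ... | lo′ , hi′ = subst (λ j → k ≤ j + β) (at-V a) lo′ , subst (_< k + β) (at-V a) hi′

    cheaper-to : ∀ {s s′} → R (left s) (left s′) → R (right s) (right s′) → cost I i s ≤ β → swapCost i s′ ≤ cost I i s
    cheaper-to {s} {s′} Rl Rr c≤β = ≤-trans (≤-reflexive (cost-kept i {s} {s′} Rl Rr)) (truncated≤ (cost≥1 I i s) c≤β)

    cheaper-from : ∀ {s′ s} → R (left s) (left s′) → R (right s) (right s′) → swapCost i s′ ≤ β → cost I i s ≤ swapCost i s′
    cheaper-from {s′} {s} Rl Rr c≤β = subst (cost I i s ≤_) (sym eq) (≤truncated (subst (_≤ β) eq c≤β))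
      where eq = cost-kept i {s} {s′} Rl Rr

    dummy-cost : ∀ s → ℓ ≤ toℕ (left s) ⊎ ℓ ≤ toℕ (right s) → β < swapCost i s
    dummy-cost s d = subst (β <_) (sym (swapCost≡ i s)) (kernelCost-dummy β L (C i) (toℕ (left s)) (toℕ (right s)) d)

    no-dummy : ∀ (s : Swap m) → ⊥ ⊎ ⊥ → β < cost I i s
    no-dummy s (inj₁ ())
    no-dummy s (inj₂ ())

    -- In this direction there are no dummies, since every candidate in the window is kept. In the
    -- converse direction the window of the kernel vote may contain some, and `R` and the two
    -- offsets change roles.
    module To = Simulation β k ℓ R R-functional R-injective (cost I i) (swapCost i) (cost≥1 I i)
      cheaper-to (λ _ → ⊥) no-dummy X Y

    module From = Simulation β ℓ k (λ x a → R a x) R-injective R-functional (swapCost i) (cost I i) (swapCost≥1 i)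
      cheaper-from (λ x → ℓ ≤ toℕ x) dummy-cost Y X

    -- The second component concerns the candidates that `R` does not reach. Here these are the
    -- dummies, which the simulation leaves in place. In `Back` they are among the irrelevant
    -- candidates, which may move but cannot cross the boundary.
    Forth : Vote m → Vote m′ → Set
    Forth w w′ = To.SameApproval w w′ × (∀ x → ℓ ≤ toℕ x → at w′ x ≡ at (W′ i) x)

    forth : ∀ {ss w} → V i ⟶[ ss ] w → sum (map (cost I i) ss) ≤ β →
            Response (cost I i) (cost kernel i) Forth (W′ i) ss w
    forth {ss} {w} run ≤β = swaps , result , path , cheap , distinct , same ,
      λ x ℓ≤x → fixed x λ a Rax → <⇒≱ (index<ℓ Rax) ℓ≤x
      where
      alignment : To.Aligned β (V i) (W′ i)
      alignment a (lo , hi) = inj₂ (proj₁ kept-a , proj₂ kept-a , aligned (proj₂ kept-a) lo hi)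
        where
        kept-a : ∃[ x ] R a x
        kept-a = R-kept (close⇒kept (complete (encodeVote-ranking (V i)) (Fin.toℕ<n a))
          (subst (λ j → k ≤ j + β) (sym (at-V a)) lo) (subst (_< k + β) (sym (at-V a)) hi))
      simulated : To.Simulated ss w (W′ i)
      simulated = To.simulate β (W′ i) run ≤β ≤-refl alignment approval⇔
      open To.Simulated simulated

    Irrelevant : Fin m → Set
    Irrelevant a = ¬ T (relevant k β vs (toℕ a))

    Back : Vote m′ → Vote m → Set
    Back w′ w = From.SameApproval w′ w ×
                (∀ a → Irrelevant a → (at w a < k → at (V i) a < k) × (at (V i) a < k → at w a < k))

    -- By `drift` the candidate moves by at most `β`, so a change of its approval would put its
    -- original position into the window.
    stays : ∀ {ss w} → V i ⟶[ ss ] w → sum (map (cost I i) ss) ≤ β → ∀ a → Irrelevant a →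
            (at w a < k → at (V i) a < k) × (at (V i) a < k → at w a < k)
    stays {ss} {w} run ≤β a irr with drift (cost I i) (cost≥1 I i) run a
    ... | up , down = stay₁ , stay₂
      where
      up′ : at w a ≤ at (V i) a + β
      up′ = ≤-trans up (+-monoʳ-≤ _ ≤β)
      down′ : at (V i) a ≤ at w a + β
      down′ = ≤-trans down (+-monoʳ-≤ _ ≤β)
      outside : k ≤ at (V i) a + β → at (V i) a < k + β → ⊥
      outside lo hi = irr (window⇒relevant (subst (λ j → k ≤ j + β) (sym (at-V a)) lo) (subst (_< k + β) (sym (at-V a)) hi))
      stay₁ : at w a < k → at (V i) a < k
      stay₁ w<k with at (V i) a <? k
      ... | yes <k = <k
      ... | no ≮k = ⊥-elim (outside (≤-trans (≮⇒≥ ≮k) (m≤m+n _ β)) (≤-trans (s≤s down′) (+-monoˡ-≤ β w<k)))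
      stay₂ : at (V i) a < k → at w a < k
      stay₂ V<k with at w a <? k
      ... | yes <k = <k
      ... | no ≮k = ⊥-elim (outside (≤-trans (≮⇒≥ ≮k) up′) (≤-trans V<k (m≤m+n k β)))

    back : ∀ {ss w} → W′ i ⟶[ ss ] w → sum (map (cost kernel i) ss) ≤ β →
           Response (cost kernel i) (cost I i) Back (V i) ss w
    back {ss} {w} run ≤β = swaps , result , path , cheap , distinct , same , stays path (≤-trans cheap ≤β)
      where
      alignment : From.Aligned β (W′ i) (V i)
      alignment x (lo , hi) with toℕ x <? ℓ
      ... | no x≮ℓ  = inj₁ (≮⇒≥ x≮ℓ)
      ... | yes x<ℓ with R-index x<ℓ
      ...   | a , Rax with window⁻ Rax lo hi
      ...     | lo′ , hi′ = inj₂ (a , Rax , sym (aligned Rax lo′ hi′))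
      simulated : From.Simulated ss w (V i)
      simulated = From.simulate β (V i) run ≤β ≤-refl alignment
        (λ Rax → proj₂ (approval⇔ Rax) , proj₁ (approval⇔ Rax))
      open From.Simulated simulated

  approval≡ : approval kernel ≡ ℓ
  approval≡ = trans k′≡ (cong (λ t → if t then ℓ else 0) (cong₂ _∧_ (Equivalence.to T-≡ (<⇒<ᵇ 1≤k)) (Equivalence.to T-≡ (<⇒<ᵇ k<m))))

  -- The name of a dummy determines its block, and only the vote of this block can approve it.
  dummy-score : ∀ {x : Fin m′} → ℓ ≤ toℕ x → score ℓ W′ x ≤ 1
  dummy-score {x} ℓ≤x = indicators≤1 (λ i → rank x (W′ i) ≤? ℓ) λ i j i< j< →
    let t , t< , t≡ = block i i< ; u , u< , u≡ = block j j< in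
    Fin.toℕ-injective (suc-injective (∸-cancelˡ-≡ (Fin.toℕ<n i) (Fin.toℕ<n j) (block-unique t< u< (trans (sym t≡) u≡))))
    where
    block : ∀ i → at (W′ i) x < ℓ → ∃[ t ] (t < ℓ × toℕ x ≡ ℓ * suc (b i) + t)
    block i x< = Front′.dummy-approved i (rest i) ℓ≤x (subst (_< ℓ) (kernelVote-at i x) x<)

  forward : Bribable I → Bribable kernel
  forward (Γ , W , results , ≤β , win) = finish (transfer (cost I) (cost kernel) Forth forth Γ W results ≤β)
    where
    finish : Transferred W′ (cost kernel) β Forth W → Bribable kernel
    finish (Γ′ , U , results′ , ≤β′ , P) = Γ′ , U , results′ , ≤β′ ,
        subst (λ k′ → Winner k′ U (preferred kernel)) (sym approval≡) wins
      where
      open ≤-Reasoning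
      preferred≤ : score k W (preferred I) ≤ score ℓ U (preferred kernel)
      preferred≤ = score-mono k ℓ W U λ i → proj₁ (proj₁ (P i) preferred-R)
      wins : Winner ℓ U (preferred kernel)
      wins x with toℕ x <? ℓ
      ... | yes x<ℓ with R-index x<ℓ
      ...   | a , Rax = begin
        score ℓ U x                   ≤⟨ score-mono ℓ k U W (λ i → proj₂ (proj₁ (P i) Rax)) ⟩
        score k W a                   ≤⟨ win a ⟩
        score k W (preferred I)       ≤⟨ preferred≤ ⟩
        score ℓ U (preferred kernel)  ∎
      wins x | no x≮ℓ = begin
        score ℓ U x                   ≤⟨ score-mono ℓ ℓ U W′ (λ i → subst (_< ℓ) (proj₂ (P i) x (≮⇒≥ x≮ℓ))) ⟩
        score ℓ W′ x                  ≤⟨ nonempty n W W′ (dummy-score (≮⇒≥ x≮ℓ)) win ⟩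
        score k W (preferred I)       ≤⟨ preferred≤ ⟩
        score ℓ U (preferred kernel)  ∎
        where
        -- Generalized over `n` and both elections to permit matching on `n`. Without votes all
        -- scores are 0; otherwise `someApproved` supplies a point that the winner must match.
        nonempty : ∀ n (W : Fin n → Vote m) (W′ : Fin n → Vote m′) → score ℓ W′ x ≤ 1 → Winner k W (preferred I) →
                   score ℓ W′ x ≤ score k W (preferred I)
        nonempty zero    W W′ _  _   = z≤n
        nonempty (suc n) W W′ ≤1 win with someApproved W (preferred I) 1≤k zero
        ... | c , 1≤ = ≤-trans ≤1 (≤-trans 1≤ (win c))

  backward : Bribable kernel → Bribable I
  backward (Γ , U , results , ≤β , win) = finish (transfer (cost kernel) (cost I) Back back Γ U results ≤β)
    where
    finish : Transferred V (cost I) β Back U → Bribable I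
    finish (Γ′ , W , results′ , ≤β′ , P) = Γ′ , W , results′ , ≤β′ , wins
      where
      open ≤-Reasoning
      win′ : Winner ℓ U (preferred kernel)
      win′ = subst (λ k′ → Winner k′ U (preferred kernel)) approval≡ win
      wins-kept : ∀ a → toℕ a ∈ L → score k W a ≤ score k W (preferred I)
      wins-kept a a∈ with R-kept a∈
      ... | x , Rax = begin
        score k W a                   ≤⟨ score-mono k ℓ W U (λ i → proj₂ (proj₁ (P i) Rax)) ⟩
        score ℓ U x                   ≤⟨ win′ x ⟩
        score ℓ U (preferred kernel)  ≤⟨ score-mono ℓ k U W (λ i → proj₁ (proj₁ (P i) preferred-R)) ⟩
        score k W (preferred I)       ∎
      wins : Winner k W (preferred I)
      wins a with member? (toℕ a) L
      ... | yes a∈ = wins-kept a a∈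
      -- Candidates are listed from the first vote, so the comparison with a kept far candidate
      -- requires a vote. Without votes all scores are 0.
      ... | no a∉ with inhabited n
        where
        inhabited : ∀ n → Fin n ⊎ n ≡ 0
        inhabited zero    = inj₂ refl
        inhabited (suc n) = inj₁ zero
      ...   | inj₂ n≡0 = ≤-trans (≤-reflexive (indicators≡0 (λ i → rank a (W i) ≤? k) λ i → case subst Fin n≡0 i of λ ())) z≤n
      ...   | inj₁ i with unkept (firstVote-complete V i (Fin.toℕ<n a)) a∉
      ...     | irr , q , q∈ , _ , irr-q , a≤q = begin
        score k W a                   ≤⟨ score-mono k k W V (λ i → proj₁ (proj₂ (P i) a irr)) ⟩
        score k V a                   ≡⟨ points≡score k V a ⟨
        points k vs (toℕ a)           ≤⟨ a≤q ⟩
        points k vs q                 ≡⟨ cong (points k vs) q≡ ⟨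
        points k vs (toℕ q′)          ≡⟨ points≡score k V q′ ⟩
        score k V q′                  ≤⟨ score-mono k k V W (λ i → proj₂ (proj₂ (P i) q′ (irr-q ∘ subst (T ∘ relevant k β vs) q≡))) ⟩
        score k W q′                  ≤⟨ wins-kept q′ (subst (_∈ L) (sym q≡) q∈) ⟩
        score k W (preferred I)       ∎
        where
        q′ : Fin m
        q′ = fromℕ< (kept-bounded q∈)
        q≡ : toℕ q′ ≡ q
        q≡ = Fin.toℕ-fromℕ< (kept-bounded q∈)

tied : ∀ I → (∀ i c → at (votes I i) c < approval I) ⊎ approval I ≡ 0 → Bribable I
tied I (inj₁ all)  = bribable-already I λ c → score-mono (approval I) (approval I) (votes I) (votes I) λ i _ → all i (preferred I)
tied I (inj₂ none) = bribable-already I λ c → score-mono (approval I) (approval I) (votes I) (votes I) λ i <k →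
  contradiction (subst (at (votes I i) c <_) none <k) λ ()

correct : ∀ I → Bribable I ⇔ Bribable (Kernel.kernel I)
correct I = go (1 ≤? k) (k <? m)
  where
  open Kernel I
  k′≡0 : (0 <ᵇ k) ∧ (k <ᵇ m) ≡ false → k′ ≡ 0
  k′≡0 eq = trans k′≡ (cong (λ t → if t then ℓ else 0) eq)
  go : Dec (1 ≤ k) → Dec (k < m) → Bribable I ⇔ Bribable kernel
  go (yes 1≤k) (yes k<m) = mk⇔ (Correct.forward I 1≤k k<m) (Correct.backward I 1≤k k<m)
  go (no 1≰k) _ = mk⇔
    (λ _ → tied kernel (inj₂ (k′≡0 (cong (_∧ (k <ᵇ m)) (Equivalence.to T-not-≡ (T-not (1≰k ∘ <ᵇ⇒< 0 k)))))))
    (λ _ → tied I (inj₂ (n≤0⇒n≡0 (≮⇒≥ 1≰k))))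
  go (yes _) (no k≮m) = mk⇔
    (λ _ → tied kernel (inj₂ (k′≡0 (trans (cong ((0 <ᵇ k) ∧_) (Equivalence.to T-not-≡ (T-not (k≮m ∘ <ᵇ⇒< k m)))) (∧-zeroʳ (0 <ᵇ k))))))
    (λ _ → tied I (inj₁ λ i c → ≤-trans (Fin.toℕ<n _) (≮⇒≥ k≮m)))

-- Assembling the kernelization

kernelizationₚ : PT (instanceTy ⊗ nat ⊗ nat) (instanceTy ⊗ nat ⊗ nat) (λ (e , q) → kernelCode e , q)
kernelizationₚ = ⟨ topₚ ⟫ kernelCodeₚ , popₚ ⟩

PT⇒PolynomialTime : ∀ {X Y A B f} (encX : X → ⟦ A ⟧) (encY : Y → ⟦ B ⟧) (g : X → Y) →
                    PT A B f → (∀ x → f (encX x) ≡ encY (g x)) → PolynomialTime A B encX encY g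
PT⇒PolynomialTime {A = A} encX encY g F eq with ⟪⟫-power (time F)
... | c , d , time≤ = prog F , c , d , λ x → let t , run-x , t≤ = run F (encX x) in
  t , subst (λ y → prog F ⊢ encX x ⇓ y [ t ]) (eq x) run-x , ≤-trans t≤ (time≤ (size A (encX x)) (size≥1 A (encX x)))

PT⇒Computable : ∀ {A B f} → PT A B f → Computable {A} {B} f
PT⇒Computable F = prog F , λ x → let t , run-x , _ = run F x in t , run-x

kernelization : Kernelization SwapBribery[n,β]
kernelization = record
  { kernel          = Kernel.kernel
  ; polynomialTime  = PT⇒PolynomialTime encodePair encodePair Kernel.kernel kernelizationₚ
      λ I → cong (_, (#votes I , budget I)) (sym (Kernel.encode-kernel I))
  ; correct         = correct
  ; bound           = kernelBound
  ; boundComputable = PT⇒Computable kernelBoundₚ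
  ; sizeBound       = kernel-size
  }
  where open ParameterizedProblem SwapBribery[n,β] using (encodePair)

theorem8 : Σ[ K ∈ Kernelization SwapBribery[n,β] ] Σ[ c ∈ ℕ ]
    (∀ (I : Instance) → 1 ≤ #votes I → 1 ≤ budget I →
    #votes (Kernelization.kernel K I) ≤ c * (#votes I ^ 2 * budget I) ×
    #candidates (Kernelization.kernel K I) ≤ c * (#votes I ^ 2 * budget I ^ 2))
theorem8 = kernelization , 8 , λ I 1≤n 1≤β → votes≤ 1≤n 1≤β ,
  ≤-trans (*-monoʳ-≤ (suc (#votes I)) (Kernel.ℓ≤ I)) (candidates≤ 1≤n 1≤β)
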